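{- Let $\alpha>0$. There exists $C=C(\alpha)>0$ such that for all real $x\geq 2$, we have $\#T_{\leq x}(\alpha)\leq C\,x(\log x)^{15}$.
   Context: $\mathbb{N}$ is the set of positive integers; $\lfloor x\rfloor$ is the integer part (floor) of $x$. For $X\subseteq\mathbb{N}$, $T(X)$ is the set of all tuples $(k,\ell,m)\in\mathbb{N}^3$ with $k\leq \ell\leq m$ such that all of $k,\ \ell,\ m,\ k+\ell,\ \ell+m,\ m+k,\ k+\ell+m$ belong to $X$. For $\alpha>0$, let $S(\alpha)=\{\lfloor \alpha n^2\rfloor : n\in\mathbb{N},\ n\geq \alpha^{ -1/2}\}$ and $T(\alpha)=T(S(\alpha))$. For $\alpha>0$ and $x>1$, let $T_{\leq x}(\alpha)=\{(\lfloor \alpha n_1^2\rfloor,\lfloor\alpha n_2^2\rfloor,\lfloor\alpha n_3^2\rfloor)\in T(\alpha) : n_1,n_2,n_3\in[\alpha^{ -1/2},x]\cap\mathbb{N}\}$. -}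

module Defs where

open import Data.Integer.Base as ℤ using (+_)
import Data.Integer.Properties as ℤ
open import Data.List.Base using (length)
open import Data.List.Relation.Unary.All using (All)
open import Data.List.Relation.Unary.Unique.Propositional using (Unique)
open import Data.Nat.Base as ℕ using (ℕ; zero; suc)
import Data.Nat.Properties as ℕ
open import Data.Product using (∃-syntax; _×_; _,_; proj₁; proj₂)
open import Data.Rational as ℚ using (ℚ; 0ℚ; 1ℚ; ½)
open import Data.Rational.Literals using (fromℤ)
import Data.Rational.Properties as ℚ
open import Data.Sum using (_⊎_; inj₁; inj₂)
open import Level using (0ℓ)
open import Relation.Binary.PropositionalEquality
open import Relation.Nullary using (¬_; Dec; yes; no; contradiction)
open import Relation.Unary using (Pred)

module Rational where

  open import Data.Rational.Base using (_+_; _*_; _-_; -_; ∣_∣; _≤_; _<_)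
  open import Algebra.Definitions.RawSemiring ℚ.+-*-rawSemiring public
    using (_^_)
  open import Data.Rational.Solver
  open +-*-Solver using (solve; _:=_; con) renaming
    (_:+_ to _⊕_; _:*_ to _⊗_; _:-_ to _⊖_; :-_ to ⊝_)

  private
    a-b+b : ∀ a b → (a - b) + b ≡ a
    a-b+b = solve 2 (λ a b → (a ⊖ b) ⊕ b := a) refl
    b+a-b : ∀ a b → b + (a - b) ≡ a
    b+a-b = solve 2 (λ a b → b ⊕ (a ⊖ b) := a) refl
    sub-sub : ∀ a b → b ≡ a - (a - b)
    sub-sub = solve 2 (λ a b → b := a ⊖ (a ⊖ b)) refl
    neg-sub : ∀ a b → - (a - b) ≡ b - a
    neg-sub = solve 2 (λ a b → ⊝ (a ⊖ b) := b ⊖ a) refl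
    sub-negs : ∀ a b → b - a ≡ (- a) - (- b)
    sub-negs = solve 2 (λ a b → b ⊖ a := (⊝ a) ⊖ (⊝ b)) refl
    telescope : ∀ a b c → (a - b) + (b - c) ≡ a - c
    telescope = solve 3 (λ a b c → (a ⊖ b) ⊕ (b ⊖ c) := a ⊖ c) refl
    sub-plus : ∀ a t c → (a - c) + t ≡ (a + t) - c
    sub-plus = solve 3 (λ a t c → (a ⊖ c) ⊕ t := (a ⊕ t) ⊖ c) refl
    shift-sub : ∀ a b h → h + (a - (b + h)) ≡ a - b
    shift-sub = solve 3 (λ a b h → h ⊕ (a ⊖ (b ⊕ h)) := a ⊖ b) refl
    sum-sub : ∀ a b c d → (a - c) + (b - d) ≡ (a + b) - (c + d)
    sum-sub = solve 4 (λ a b c d → (a ⊖ c) ⊕ (b ⊖ d) := (a ⊕ b) ⊖ (c ⊕ d)) refl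
    product-sub : ∀ a b c d → a * (b - d) + d * (a - c) ≡ (a * b) - (c * d)
    product-sub = solve 4 (λ a b c d → a ⊗ (b ⊖ d) ⊕ d ⊗ (a ⊖ c) := (a ⊗ b) ⊖ (c ⊗ d)) refl
    recip-sub : ∀ a b r s → (r * s) * (b - a) ≡ r * (b * s) - s * (a * r)
    recip-sub = solve 4 (λ a b r s → (r ⊗ s) ⊗ (b ⊖ a) := r ⊗ (b ⊗ s) ⊖ s ⊗ (a ⊗ r)) refl
    squares-sub : ∀ a b → b * (a - b) + b * (a - b) ≡ (a * a - b * b) - (a - b) * (a - b)
    squares-sub = solve 2 (λ a b → b ⊗ (a ⊖ b) ⊕ b ⊗ (a ⊖ b) := (a ⊗ a ⊖ b ⊗ b) ⊖ (a ⊖ b) ⊗ (a ⊖ b)) refl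
    swapˡ : ∀ a b c → b * (a * c) ≡ (a * b) * c
    swapˡ = solve 3 (λ a b c → b ⊗ (a ⊗ c) := (a ⊗ b) ⊗ c) refl
    swapʳ : ∀ a b c → (a * b) * c ≡ (a * c) * b
    swapʳ = solve 3 (λ a b c → (a ⊗ b) ⊗ c := (a ⊗ c) ⊗ b) refl
    rotate : ∀ a b c → a * (b * c) ≡ (a * c) * b
    rotate = solve 3 (λ a b c → a ⊗ (b ⊗ c) := (a ⊗ c) ⊗ b) refl
    regroup : ∀ a b c d → a * ((c * d) * b) ≡ (a * c) * (b * d)
    regroup = solve 4 (λ a b c d → a ⊗ ((c ⊗ d) ⊗ b) := (a ⊗ c) ⊗ (b ⊗ d)) refl
    halves : ∀ a → ½ * a + ½ * a ≡ a
    halves = solve 1 (λ a → con ½ ⊗ a ⊕ con ½ ⊗ a := a) refl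
    double : ∀ a → a + a ≡ (1ℚ + 1ℚ) * a
    double = solve 1 (λ a → a ⊕ a := (con 1ℚ ⊕ con 1ℚ) ⊗ a) refl
    triple : ∀ a → (a + a) + a ≡ (1ℚ + 1ℚ + 1ℚ) * a
    triple = solve 1 (λ a → (a ⊕ a) ⊕ a := (con 1ℚ ⊕ con 1ℚ ⊕ con 1ℚ) ⊗ a) refl
    suc-times : ∀ a b → (a + 1ℚ) * b ≡ a * b + b
    suc-times = solve 2 (λ a b → (a ⊕ con 1ℚ) ⊗ b := a ⊗ b ⊕ b) refl
    bernoulli-base : ∀ a → 1ℚ * (1ℚ + 0ℚ * a) ≡ 1ℚ
    bernoulli-base = solve 1 (λ a → con 1ℚ ⊗ (con 1ℚ ⊕ con 0ℚ ⊗ a) := con 1ℚ) refl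
    bernoulli-step : ∀ a b → a * (b * b) + b * b ≡ (1ℚ + a * b) - (1ℚ - b) * (1ℚ + (a + 1ℚ) * b)
    bernoulli-step = solve 2 (λ a b → a ⊗ (b ⊗ b) ⊕ b ⊗ b := (con 1ℚ ⊕ a ⊗ b) ⊖ (con 1ℚ ⊖ b) ⊗ (con 1ℚ ⊕ (a ⊕ con 1ℚ) ⊗ b)) refl
    ratio-upper-eq : ∀ a c → (a - 1ℚ) * c + (c + c) ≡ (a + 1ℚ) * c
    ratio-upper-eq = solve 2 (λ a c → (a ⊖ con 1ℚ) ⊗ c ⊕ (c ⊕ c) := (a ⊕ con 1ℚ) ⊗ c) refl
    ratio-lower-eq : ∀ a c → - ((a + 1ℚ) * c) + (a * c + a * c) ≡ (a - 1ℚ) * c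
    ratio-lower-eq = solve 2 (λ a c → ⊝ ((a ⊕ con 1ℚ) ⊗ c) ⊕ (a ⊗ c ⊕ a ⊗ c) := (a ⊖ con 1ℚ) ⊗ c) refl
    a+b-b : ∀ a b → (a + b) - b ≡ a
    a+b-b = solve 2 (λ a b → (a ⊕ b) ⊖ b := a) refl
    geometric : ∀ a b c → (a - b) + (1ℚ - c) * b ≡ a - c * b
    geometric = solve 3 (λ a b c → (a ⊖ b) ⊕ (con 1ℚ ⊖ c) ⊗ b := a ⊖ c ⊗ b) refl

  fromℕ : ℕ → ℚ
  fromℕ n = fromℤ (+ n)

  -- Total reciprocal, with recip 0 = 0.
  recip : ℚ → ℚ
  recip q with q ℚ.≟ 0ℚ
  ... | yes _   = 0ℚ
  ... | no  q≢0 = ℚ.1/_ q {{ℚ.≢-nonZero q≢0}}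

  private
    ≤-resp : ∀ {a b c d} → a ≡ b → c ≡ d → a ≤ c → b ≤ d
    ≤-resp refl refl a≤c = a≤c

  0<1 : 0ℚ < 1ℚ
  0<1 = ℚ.*<* (ℤ.+<+ (ℕ.s≤s ℕ.z≤n))

  0<½ : 0ℚ < ½
  0<½ = ℚ.*<* (ℤ.+<+ (ℕ.s≤s ℕ.z≤n))

  *-pos : ∀ {a b} → 0ℚ < a → 0ℚ < b → 0ℚ < a * b
  *-pos {a} {b} 0<a 0<b =
    ℚ.positive⁻¹ (a * b) {{ℚ.pos*pos⇒pos a {{ℚ.positive 0<a}} b {{ℚ.positive 0<b}}}}

  *-nonNeg : ∀ {a b} → 0ℚ ≤ a → 0ℚ ≤ b → 0ℚ ≤ a * b
  *-nonNeg {a} {b} 0≤a 0≤b = ℚ.nonNegative⁻¹ (a * b)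
    {{ℚ.nonNeg*nonNeg⇒nonNeg a {{ℚ.nonNegative 0≤a}} b {{ℚ.nonNegative 0≤b}}}}

  +-pos : ∀ {a b} → 0ℚ < a → 0ℚ < b → 0ℚ < a + b
  +-pos {a} {b} 0<a 0<b = ℚ.+-mono-< 0<a 0<b

  *-mono-≤ : ∀ {a b c d} → 0ℚ ≤ a → a ≤ b → 0ℚ ≤ c → c ≤ d → a * c ≤ b * d
  *-mono-≤ {a} {b} {c} {d} 0≤a a≤b 0≤c c≤d = ℚ.≤-trans
    (ℚ.*-monoʳ-≤-nonNeg c {{ℚ.nonNegative 0≤c}} a≤b)
    (ℚ.*-monoˡ-≤-nonNeg b {{ℚ.nonNegative (ℚ.≤-trans 0≤a a≤b)}} c≤d)

  0≤b-a⇒a≤b : ∀ {a b} → 0ℚ ≤ b - a → a ≤ b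
  0≤b-a⇒a≤b {a} {b} p = ≤-resp
    (ℚ.+-identityˡ a)
    (a-b+b b a)
    (ℚ.+-monoˡ-≤ a p)

  +-cancelʳ-≤ : ∀ {a b} c → a + c ≤ b + c → a ≤ b
  +-cancelʳ-≤ {a} {b} c p = ≤-resp (a+b-b a c) (a+b-b b c) (ℚ.+-monoˡ-≤ (- c) p)

  ≤-+ʳ : ∀ {a b} → 0ℚ ≤ b → a ≤ a + b
  ≤-+ʳ {a} 0≤b = ≤-resp (ℚ.+-identityʳ a) refl (ℚ.+-monoʳ-≤ a 0≤b)

  a≤∣a∣ : ∀ a → a ≤ ∣ a ∣
  a≤∣a∣ a with ℚ.≤-total 0ℚ a
  ... | inj₁ 0≤a = ℚ.≤-reflexive (sym (ℚ.0≤p⇒∣p∣≡p 0≤a))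
  ... | inj₂ a≤0 = ℚ.≤-trans a≤0 (ℚ.0≤∣p∣ a)

  -a≤∣a∣ : ∀ a → - a ≤ ∣ a ∣
  -a≤∣a∣ a = ≤-resp refl (ℚ.∣-p∣≡∣p∣ a) (a≤∣a∣ (- a))

  ∣a∣≤ : ∀ {a b} → a ≤ b → - a ≤ b → ∣ a ∣ ≤ b
  ∣a∣≤ {a} p q with ℚ.∣p∣≡p∨∣p∣≡-p a
  ... | inj₁ e = ≤-resp (sym e) refl p
  ... | inj₂ e = ≤-resp (sym e) refl q

  ∣-∣-sym : ∀ a b → ∣ a - b ∣ ≡ ∣ b - a ∣
  ∣-∣-sym a b = trans (sym (ℚ.∣-p∣≡∣p∣ (a - b)))
    (cong ∣_∣ (neg-sub a b))

  ∣-∣-triangle : ∀ a b c → ∣ a - c ∣ ≤ ∣ a - b ∣ + ∣ b - c ∣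
  ∣-∣-triangle a b c = ≤-resp
    (cong ∣_∣ (telescope a b c)) refl
    (ℚ.∣p+q∣≤∣p∣+∣q∣ (a - b) (b - c))

  recip-inverse : ∀ {q} → 0ℚ < q → q * recip q ≡ 1ℚ
  recip-inverse {q} 0<q with q ℚ.≟ 0ℚ
  ... | yes q≡0 = contradiction (sym q≡0) (ℚ.<⇒≢ 0<q)
  ... | no  q≢0 = ℚ.*-inverseʳ q {{ℚ.≢-nonZero q≢0}}

  recip-pos : ∀ {q} → 0ℚ < q → 0ℚ < recip q
  recip-pos {q} 0<q with recip q ℚ.≤? 0ℚ
  ... | no  r≰0 = ℚ.≰⇒> r≰0
  ... | yes r≤0 = contradiction
    (≤-resp (recip-inverse 0<q) (ℚ.*-zeroʳ q)
      (ℚ.*-monoˡ-≤-nonNeg q {{ℚ.nonNegative (ℚ.<⇒≤ 0<q)}} r≤0))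
    (λ 1≤0 → ℚ.<-irrefl refl (ℚ.<-≤-trans 0<1 1≤0))

  recip-antimono : ∀ {a b} → 0ℚ < a → a ≤ b → recip b ≤ recip a
  recip-antimono {a} {b} 0<a a≤b = ≤-resp
    (trans (swapʳ a (recip b) (recip a))
      (trans (cong (_* recip b) (recip-inverse 0<a)) (ℚ.*-identityˡ (recip b))))
    (trans (cong (_* recip a) (recip-inverse 0<b)) (ℚ.*-identityˡ (recip a)))
    (ℚ.*-monoʳ-≤-nonNeg (recip a) {{ℚ.nonNegative (ℚ.<⇒≤ (recip-pos 0<a))}}
      (ℚ.*-monoʳ-≤-nonNeg (recip b) {{ℚ.nonNegative (ℚ.<⇒≤ (recip-pos 0<b))}} a≤b))
    where
    0<b : 0ℚ < b
    0<b = ℚ.<-≤-trans 0<a a≤b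

  fromℕ-mono : ∀ {m n} → m ℕ.≤ n → fromℕ m ≤ fromℕ n
  fromℕ-mono m≤n = ℚ.*≤* (ℤ.*-monoʳ-≤-nonNeg (+ 1) (ℤ.+≤+ m≤n))

  fromℕ-suc : ∀ n → fromℕ (suc n) ≡ fromℕ n + 1ℚ
  fromℕ-suc n = sym (trans
    (ℚ./-cong {q₁ = 1} {q₂ = 1}
      (cong₂ ℤ._+_ (ℤ.*-identityʳ (+ n)) (ℤ.*-identityʳ (+ 1))) refl)
    (trans (ℚ./-cong {q₁ = 1} {q₂ = 1} (cong +_ (ℕ.+-comm n 1)) refl)
      (ℚ.↥p/↧p≡p (fromℕ (suc n)))))

  fromℕ-pos : ∀ n → 0ℚ < fromℕ (suc n)
  fromℕ-pos n = ℚ.<-≤-trans 0<1 (fromℕ-mono (ℕ.s≤s (ℕ.z≤n {n})))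

  natAbove : ℚ → ℕ
  natAbove q = ℤ.∣ ℚ.↥ q ∣

  ≤-natAbove : ∀ q → q ≤ fromℕ (natAbove q)
  ≤-natAbove q@record{} = ℚ.*≤* (ℤ.≤-trans
    (ℤ.≤-reflexive (ℤ.*-identityʳ (ℚ.↥ q)))
    (ℤ.≤-trans (i≤∣i∣ (ℚ.↥ q))
    (ℤ.≤-trans (ℤ.≤-reflexive (sym (ℤ.*-identityʳ (+ ℤ.∣ ℚ.↥ q ∣))))
      (ℤ.*-monoˡ-≤-nonNeg (+ ℤ.∣ ℚ.↥ q ∣) (ℤ.+≤+ (ℕ.s≤s ℕ.z≤n))))))
    where
    i≤∣i∣ : ∀ i → i ℤ.≤ + ℤ.∣ i ∣
    i≤∣i∣ (+ n)        = ℤ.≤-refl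
    i≤∣i∣ (ℤ.-[1+ n ]) = ℤ.-≤+

  IsCauchy : (ℕ → ℚ) → Set
  IsCauchy s = ∀ ε → 0ℚ < ε → ∃[ N ] ∀ m n → N ℕ.≤ m → N ℕ.≤ n → ∣ s m - s n ∣ < ε

  cauchy-scaled : ∀ s K → 0ℚ < K →
    (∀ ε → 0ℚ < ε → ∃[ N ] ∀ m n → N ℕ.≤ m → N ℕ.≤ n → ∣ s m - s n ∣ ≤ K * ε) →
    IsCauchy s
  cauchy-scaled s K 0<K h ε 0<ε = proj₁ hε′ , λ m n N≤m N≤n →
    ℚ.≤-<-trans (proj₂ hε′ m n N≤m N≤n) Kε′<ε
    where
    ε′ : ℚ
    ε′ = (½ * ε) * recip K
    0<½ε : 0ℚ < ½ * ε
    0<½ε = *-pos 0<½ 0<ε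
    hε′ = h ε′ (*-pos 0<½ε (recip-pos 0<K))
    Kε′≡½ε : K * ε′ ≡ ½ * ε
    Kε′≡½ε = trans
      (rotate K (½ * ε) (recip K))
      (trans (cong (_* (½ * ε)) (recip-inverse 0<K)) (ℚ.*-identityˡ (½ * ε)))
    Kε′<ε : K * ε′ < ε
    Kε′<ε = subst₂ _<_
      (trans (ℚ.+-identityˡ (½ * ε)) (sym Kε′≡½ε))
      (halves ε)
      (ℚ.+-monoˡ-< (½ * ε) 0<½ε)

  const-cauchy : ∀ q → IsCauchy (λ _ → q)
  const-cauchy q ε 0<ε = 0 , λ _ _ _ _ →
    subst (_< ε) (sym (cong ∣_∣ (ℚ.+-inverseʳ q))) 0<ε

  bounded : ∀ {s} → IsCauchy s → ∃[ B ] (0ℚ < B × ∃[ N ] ∀ n → N ℕ.≤ n → ∣ s n ∣ ≤ B)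
  bounded {s} cs = ∣ s N ∣ + 1ℚ , ℚ.+-mono-≤-< (ℚ.0≤∣p∣ (s N)) 0<1 , N , λ n N≤n →
    ℚ.≤-trans
      (≤-resp (cong ∣_∣ (b+a-b (s n) (s N))) refl
        (ℚ.∣p+q∣≤∣p∣+∣q∣ (s N) (s n - s N)))
      (ℚ.+-monoʳ-≤ ∣ s N ∣ (ℚ.<⇒≤ (proj₂ c n N N≤n ℕ.≤-refl)))
    where
    c = cs 1ℚ 0<1
    N = proj₁ c

  neg-cauchy : ∀ {s} → IsCauchy s → IsCauchy (λ n → - s n)
  neg-cauchy {s} cs ε 0<ε = proj₁ (cs ε 0<ε) , λ m n N≤m N≤n →
    subst (_< ε)
      (trans (∣-∣-sym (s m) (s n))
        (cong ∣_∣ (sub-negs (s m) (s n))))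
      (proj₂ (cs ε 0<ε) m n N≤m N≤n)

  +-cauchy : ∀ {s t} → IsCauchy s → IsCauchy t → IsCauchy (λ n → s n + t n)
  +-cauchy {s} {t} cs ct = cauchy-scaled (λ n → s n + t n) (1ℚ + 1ℚ) (+-pos 0<1 0<1) λ ε 0<ε →
    let N₁ , h₁ = cs ε 0<ε
        N₂ , h₂ = ct ε 0<ε
    in N₁ ℕ.⊔ N₂ , λ m n N≤m N≤n → ℚ.≤-trans
      (≤-resp (cong ∣_∣ (sum-sub (s m) (t m) (s n) (t n))) refl
        (ℚ.∣p+q∣≤∣p∣+∣q∣ (s m - s n) (t m - t n)))
      (≤-resp refl (double ε)
        (ℚ.+-mono-≤
          (ℚ.<⇒≤ (h₁ m n (ℕ.m⊔n≤o⇒m≤o N₁ N₂ N≤m) (ℕ.m⊔n≤o⇒m≤o N₁ N₂ N≤n)))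
          (ℚ.<⇒≤ (h₂ m n (ℕ.m⊔n≤o⇒n≤o N₁ N₂ N≤m) (ℕ.m⊔n≤o⇒n≤o N₁ N₂ N≤n)))))

  *-close : ∀ a b c d {A B ε} → ∣ a ∣ ≤ A → ∣ d ∣ ≤ B → ∣ a - c ∣ ≤ ε → ∣ b - d ∣ ≤ ε →
    ∣ a * b - c * d ∣ ≤ (A + B) * ε
  *-close a b c d {A} {B} {ε} a≤A d≤B ac≤ε bd≤ε = begin
    ∣ a * b - c * d ∣
      ≡⟨ cong ∣_∣ (product-sub a b c d) ⟨
    ∣ a * (b - d) + d * (a - c) ∣
      ≤⟨ ℚ.∣p+q∣≤∣p∣+∣q∣ (a * (b - d)) (d * (a - c)) ⟩
    ∣ a * (b - d) ∣ + ∣ d * (a - c) ∣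
      ≡⟨ cong₂ _+_ (ℚ.∣p*q∣≡∣p∣*∣q∣ a (b - d)) (ℚ.∣p*q∣≡∣p∣*∣q∣ d (a - c)) ⟩
    ∣ a ∣ * ∣ b - d ∣ + ∣ d ∣ * ∣ a - c ∣
      ≤⟨ ℚ.+-mono-≤ (*-mono-≤ (ℚ.0≤∣p∣ a) a≤A (ℚ.0≤∣p∣ (b - d)) bd≤ε)
                    (*-mono-≤ (ℚ.0≤∣p∣ d) d≤B (ℚ.0≤∣p∣ (a - c)) ac≤ε) ⟩
    A * ε + B * ε
      ≡⟨ ℚ.*-distribʳ-+ ε A B ⟨
    (A + B) * ε ∎
    where open ℚ.≤-Reasoning

  *-cauchy : ∀ {s t} → IsCauchy s → IsCauchy t → IsCauchy (λ n → s n * t n)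
  *-cauchy {s} {t} cs ct =
    let A , 0<A , M₁ , hA = bounded {s} cs
        B , 0<B , M₂ , hB = bounded {t} ct
    in cauchy-scaled (λ n → s n * t n) (A + B) (+-pos 0<A 0<B) λ ε 0<ε →
    let N₁ , h₁ = cs ε 0<ε
        N₂ , h₂ = ct ε 0<ε
        N = N₁ ℕ.⊔ N₂
        M = M₁ ℕ.⊔ M₂
    in N ℕ.⊔ M , λ m n p q →
    let pN = ℕ.m⊔n≤o⇒m≤o N M p
        pM = ℕ.m⊔n≤o⇒n≤o N M p
        qN = ℕ.m⊔n≤o⇒m≤o N M q
        qM = ℕ.m⊔n≤o⇒n≤o N M q
    in *-close (s m) (t m) (s n) (t n)
      (hA m (ℕ.m⊔n≤o⇒m≤o M₁ M₂ pM))
      (hB n (ℕ.m⊔n≤o⇒n≤o M₁ M₂ qM))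
      (ℚ.<⇒≤ (h₁ m n (ℕ.m⊔n≤o⇒m≤o N₁ N₂ pN) (ℕ.m⊔n≤o⇒m≤o N₁ N₂ qN)))
      (ℚ.<⇒≤ (h₂ m n (ℕ.m⊔n≤o⇒n≤o N₁ N₂ pN) (ℕ.m⊔n≤o⇒n≤o N₁ N₂ qN)))

  recip-close : ∀ {δ} a b {ε} → 0ℚ < δ → δ ≤ a → δ ≤ b → ∣ b - a ∣ ≤ ε →
    ∣ recip a - recip b ∣ ≤ (recip δ * recip δ) * ε
  recip-close {δ} a b {ε} 0<δ δ≤a δ≤b d≤ε = begin
    ∣ recip a - recip b ∣
      ≡⟨ cong ∣_∣ eq ⟩
    ∣ (recip a * recip b) * (b - a) ∣
      ≡⟨ ℚ.∣p*q∣≡∣p∣*∣q∣ (recip a * recip b) (b - a) ⟩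
    ∣ recip a * recip b ∣ * ∣ b - a ∣
      ≡⟨ cong (_* ∣ b - a ∣) (ℚ.0≤p⇒∣p∣≡p 0≤rr) ⟩
    (recip a * recip b) * ∣ b - a ∣
      ≤⟨ *-mono-≤ 0≤rr
           (*-mono-≤ (ℚ.<⇒≤ (recip-pos 0<a)) (recip-antimono 0<δ δ≤a)
                     (ℚ.<⇒≤ (recip-pos 0<b)) (recip-antimono 0<δ δ≤b))
           (ℚ.0≤∣p∣ (b - a)) d≤ε ⟩
    (recip δ * recip δ) * ε ∎
    where
    open ℚ.≤-Reasoning
    0<a : 0ℚ < a
    0<a = ℚ.<-≤-trans 0<δ δ≤a
    0<b : 0ℚ < b
    0<b = ℚ.<-≤-trans 0<δ δ≤b
    0≤rr : 0ℚ ≤ recip a * recip b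
    0≤rr = ℚ.<⇒≤ (*-pos (recip-pos 0<a) (recip-pos 0<b))
    eq : recip a - recip b ≡ (recip a * recip b) * (b - a)
    eq = begin-equality
      recip a - recip b
        ≡⟨ cong₂ _-_ (ℚ.*-identityʳ (recip a)) (ℚ.*-identityʳ (recip b)) ⟨
      recip a * 1ℚ - recip b * 1ℚ
        ≡⟨ cong₂ (λ x y → recip a * x - recip b * y) (recip-inverse 0<b) (recip-inverse 0<a) ⟨
      recip a * (b * recip b) - recip b * (a * recip a)
        ≡⟨ recip-sub a b (recip a) (recip b) ⟨
      (recip a * recip b) * (b - a) ∎

  recip-cauchy : ∀ {s} → IsCauchy s → ∀ {δ} → 0ℚ < δ →
    (∃[ N ] ∀ n → N ℕ.≤ n → δ ≤ s n) → IsCauchy (λ n → recip (s n))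
  recip-cauchy {s} cs {δ} 0<δ (M , hM) =
    cauchy-scaled (λ n → recip (s n)) (recip δ * recip δ)
      (*-pos (recip-pos 0<δ) (recip-pos 0<δ)) λ ε 0<ε →
    let N , h = cs ε 0<ε
    in N ℕ.⊔ M , λ m n p q → recip-close (s m) (s n) 0<δ
      (hM m (ℕ.m⊔n≤o⇒n≤o N M p))
      (hM n (ℕ.m⊔n≤o⇒n≤o N M q))
      (ℚ.<⇒≤ (h n m (ℕ.m⊔n≤o⇒m≤o N M q) (ℕ.m⊔n≤o⇒m≤o N M p)))

  largest : {P : ℕ → Set} → (∀ j → Dec (P j)) → ℕ → ℕ
  largest P? zero = zero
  largest P? (suc b) with P? (suc b)
  ... | yes _ = suc b
  ... | no  _ = largest P? b

  largest-holds : ∀ {P : ℕ → Set} (P? : ∀ j → Dec (P j)) b →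
    largest P? b ≡ 0 ⊎ P (largest P? b)
  largest-holds P? zero = inj₁ refl
  largest-holds P? (suc b) with P? (suc b)
  ... | yes p = inj₂ p
  ... | no  _ = largest-holds P? b

  largest-max : ∀ {P : ℕ → Set} (P? : ∀ j → Dec (P j)) b →
    ¬ P (suc b) → ¬ P (suc (largest P? b))
  largest-max P? zero ¬p = ¬p
  largest-max P? (suc b) ¬p with P? (suc b)
  ... | yes _ = ¬p
  ... | no ¬q = largest-max P? b ¬q

  mesh : ℕ → ℚ
  mesh n = recip (fromℕ (suc n))

  mesh-pos : ∀ n → 0ℚ < mesh n
  mesh-pos n = recip-pos (fromℕ-pos n)

  mesh-small : ∀ ε → 0ℚ < ε → ∃[ N ] ∀ n → N ℕ.≤ n → mesh n ≤ ε
  mesh-small ε 0<ε = natAbove (recip ε) , λ n N≤n → ≤-resp refl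
    (trans (ℚ.*-comm (mesh n) (fromℕ (suc n) * ε))
      (trans (swapʳ (fromℕ (suc n)) ε (mesh n))
        (trans (cong (_* ε) (recip-inverse (fromℕ-pos n))) (ℚ.*-identityˡ ε))))
    (≤-resp (ℚ.*-identityʳ (mesh n)) refl
      (ℚ.*-monoˡ-≤-nonNeg (mesh n) {{ℚ.nonNegative (ℚ.<⇒≤ (mesh-pos n))}}
        (≤-resp (trans (ℚ.*-comm (recip ε) ε) (recip-inverse 0<ε)) refl
          (ℚ.*-monoʳ-≤-nonNeg ε {{ℚ.nonNegative (ℚ.<⇒≤ 0<ε)}}
            (ℚ.≤-trans (≤-natAbove (recip ε))
              (fromℕ-mono (ℕ.≤-trans N≤n (ℕ.n≤1+n n))))))))

  square≤? : ∀ n a j → Dec ((fromℕ j * mesh n) * (fromℕ j * mesh n) ≤ a)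
  square≤? n a j = _ ℚ.≤? a

  gridBound : ℕ → ℚ → ℕ
  gridBound n a = natAbove ((∣ a ∣ + 1ℚ) * fromℕ (suc n))

  -- The largest multiple r of 1/(n+1) with r² ≤ a, or 0 if there is none.
  rootApprox : ℕ → ℚ → ℚ
  rootApprox n a = fromℕ (largest (square≤? n a) (gridBound n a)) * mesh n

  rootApprox-nonNeg : ∀ n a → 0ℚ ≤ rootApprox n a
  rootApprox-nonNeg n a =
    *-nonNeg (fromℕ-mono {0} {largest (square≤? n a) (gridBound n a)} ℕ.z≤n) (ℚ.<⇒≤ (mesh-pos n))

  rootApprox-lower : ∀ n a →
    rootApprox n a ≡ 0ℚ ⊎ rootApprox n a * rootApprox n a ≤ a
  rootApprox-lower n a with largest-holds (square≤? n a) (gridBound n a)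
  ... | inj₁ e = inj₁ (trans (cong (λ j → fromℕ j * mesh n) e) (ℚ.*-zeroˡ (mesh n)))
  ... | inj₂ p = inj₂ p

  rootApprox-upper : ∀ n a →
    a < (rootApprox n a + mesh n) * (rootApprox n a + mesh n)
  rootApprox-upper n a = subst (λ t → a < t * t) (step (largest (square≤? n a) b))
    (ℚ.≰⇒> (largest-max (square≤? n a) b λ t²≤a →
      ℚ.<-irrefl refl (ℚ.<-≤-trans big t²≤a)))
    where
    h = mesh n
    b = gridBound n a
    c = ∣ a ∣ + 1ℚ
    t = fromℕ (suc b) * h
    step : ∀ j → fromℕ (suc j) * h ≡ fromℕ j * h + h
    step j = trans (cong (_* h) (fromℕ-suc j))
      (suc-times (fromℕ j) h)
    c≤t : c ≤ t
    c≤t = ≤-resp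
      (trans (ℚ.*-assoc c (fromℕ (suc n)) h)
        (trans (cong (c *_) (recip-inverse (fromℕ-pos n))) (ℚ.*-identityʳ c)))
      refl
      (ℚ.*-monoʳ-≤-nonNeg h {{ℚ.nonNegative (ℚ.<⇒≤ (mesh-pos n))}}
        (ℚ.≤-trans (≤-natAbove (c * fromℕ (suc n))) (fromℕ-mono (ℕ.n≤1+n b))))
    1≤c : 1ℚ ≤ c
    1≤c = ≤-resp (ℚ.+-identityˡ 1ℚ) refl (ℚ.+-monoˡ-≤ 1ℚ (ℚ.0≤∣p∣ a))
    a<c : a < c
    a<c = subst (_< c) (ℚ.+-identityʳ a) (ℚ.+-mono-≤-< (a≤∣a∣ a) 0<1)
    0≤1 : 0ℚ ≤ 1ℚ
    0≤1 = ℚ.<⇒≤ 0<1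
    big : a < t * t
    big = ℚ.<-≤-trans a<c (≤-resp (ℚ.*-identityʳ c) refl
      (*-mono-≤ (ℚ.≤-trans 0≤1 1≤c) c≤t 0≤1 (ℚ.≤-trans 1≤c c≤t)))

  root-cauchy : ∀ {s} → IsCauchy s → IsCauchy (λ n → rootApprox n (s n))
  root-cauchy {s} cs = cauchy-scaled (λ n → rootApprox n (s n)) (1ℚ + 1ℚ) (+-pos 0<1 0<1) λ ε 0<ε →
    let N₁ , h₁ = cs (ε * ε) (*-pos 0<ε 0<ε)
        N₂ , h₂ = mesh-small ε 0<ε
    in N₁ ℕ.⊔ N₂ , λ m n p q →
    let one = λ i j (p : N₁ ℕ.⊔ N₂ ℕ.≤ i) (q : N₁ ℕ.⊔ N₂ ℕ.≤ j) →
          oneSided i j 0<ε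
            (ℚ.<⇒≤ (h₁ i j (ℕ.m⊔n≤o⇒m≤o N₁ N₂ p) (ℕ.m⊔n≤o⇒m≤o N₁ N₂ q)))
            (h₂ j (ℕ.m⊔n≤o⇒n≤o N₁ N₂ q))
    in ∣a∣≤ (one m n p q)
      (≤-resp (sym (neg-sub (rootApprox m (s m)) (rootApprox n (s n)))) refl (one n m q p))
    where
    oneSided : ∀ m n {ε} → 0ℚ < ε → ∣ s m - s n ∣ ≤ ε * ε → mesh n ≤ ε →
      rootApprox m (s m) - rootApprox n (s n) ≤ (1ℚ + 1ℚ) * ε
    oneSided m n {ε} 0<ε d≤ h≤ε = ≤-resp refl
      (double ε)
      (≤-resp (shift-sub r r′ h) refl
        (ℚ.+-mono-≤ h≤ε u≤ε))
      where
      r = rootApprox m (s m)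
      r′ = rootApprox n (s n)
      h = mesh n
      t = r′ + h
      u = r - t
      0<t : 0ℚ < t
      0<t = ℚ.+-mono-≤-< (rootApprox-nonNeg n (s n)) (mesh-pos n)
      u≤ε : u ≤ ε
      u≤ε with u ℚ.≤? ε
      ... | yes p = p
      ... | no ¬p = contradiction (ℚ.<-≤-trans εε<uu uu≤εε) (ℚ.<-irrefl refl)
        where
        ε<u : ε < u
        ε<u = ℚ.≰⇒> ¬p
        0<u : 0ℚ < u
        0<u = ℚ.<-trans 0<ε ε<u
        εε<uu : ε * ε < u * u
        εε<uu = ℚ.<-trans
          (ℚ.*-monoʳ-<-pos ε {{ℚ.positive 0<ε}} ε<u)
          (ℚ.*-monoˡ-<-pos u {{ℚ.positive 0<u}} ε<u)
        t≤r : t ≤ r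
        t≤r = 0≤b-a⇒a≤b (ℚ.<⇒≤ 0<u)
        r²≤ : r * r ≤ s m
        r²≤ with rootApprox-lower m (s m)
        ... | inj₂ p = p
        ... | inj₁ r≡0 = contradiction
          (ℚ.<-≤-trans 0<t (subst (t ≤_) r≡0 t≤r)) (ℚ.<-irrefl refl)
        uu≤ : u * u ≤ r * r - t * t
        uu≤ = 0≤b-a⇒a≤b (≤-resp refl
          (squares-sub r t)
          (ℚ.<⇒≤ (+-pos (*-pos 0<t 0<u) (*-pos 0<t 0<u))))
        uu≤εε : u * u ≤ ε * ε
        uu≤εε = ℚ.≤-trans uu≤ (ℚ.≤-trans
          (ℚ.+-mono-≤ r²≤ (ℚ.neg-antimono-≤ (ℚ.<⇒≤ (rootApprox-upper n (s n)))))
          (ℚ.≤-trans (a≤∣a∣ (s m - s n)) d≤))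

  -- Partial sums of  artanh q = Σₖ q²ᵏ⁺¹ / (2k+1).
  artanhSum : ℕ → ℚ → ℚ
  artanhSum zero    q = 0ℚ
  artanhSum (suc k) q =
    artanhSum k q + q ^ suc (2 ℕ.* k) * recip (fromℕ (suc (2 ℕ.* k)))

  ^-cauchy : ∀ {s} k → IsCauchy s → IsCauchy (λ n → s n ^ k)
  ^-cauchy zero    cs = const-cauchy 1ℚ
  ^-cauchy {s} (suc k) cs = *-cauchy {s} {λ n → s n ^ k} cs (^-cauchy {s} k cs)

  artanhSum-cauchy : ∀ {s} k → IsCauchy s → IsCauchy (λ n → artanhSum k (s n))
  artanhSum-cauchy zero    cs = const-cauchy 0ℚ
  artanhSum-cauchy {s} (suc k) cs = +-cauchy {λ n → artanhSum k (s n)} {λ n → s n ^ j * r}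
    (artanhSum-cauchy {s} k cs)
    (*-cauchy {λ n → s n ^ j} {λ _ → r} (^-cauchy {s} j cs) (const-cauchy r))
    where
    j = suc (2 ℕ.* k)
    r = recip (fromℕ j)

  module _ {ρ : ℚ} (0≤ρ : 0ℚ ≤ ρ) (ρ<1 : ρ < 1ℚ) where

    private
      σ : ℚ
      σ = 1ℚ - ρ

      0<σ : 0ℚ < σ
      0<σ = subst (_< σ) (ℚ.+-inverseʳ ρ) (ℚ.+-monoˡ-< (- ρ) ρ<1)

      0≤σ : 0ℚ ≤ σ
      0≤σ = ℚ.<⇒≤ 0<σ

      0≤1 : 0ℚ ≤ 1ℚ
      0≤1 = ℚ.<⇒≤ 0<1

      ρ≡1-σ : ρ ≡ 1ℚ - σ
      ρ≡1-σ = sub-sub 1ℚ ρ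

    ^-nonNeg : ∀ k → 0ℚ ≤ ρ ^ k
    ^-nonNeg zero    = 0≤1
    ^-nonNeg (suc k) = *-nonNeg 0≤ρ (^-nonNeg k)

    ^-step : ∀ k → ρ ^ suc k ≤ ρ ^ k
    ^-step k = ≤-resp refl (ℚ.*-identityˡ (ρ ^ k))
      (ℚ.*-monoʳ-≤-nonNeg (ρ ^ k) {{ℚ.nonNegative (^-nonNeg k)}} (ℚ.<⇒≤ ρ<1))

    ^-antimono : ∀ {j k} → j ℕ.≤′ k → ρ ^ k ≤ ρ ^ j
    ^-antimono (ℕ.≤′-reflexive refl) = ℚ.≤-refl
    ^-antimono {j} (ℕ.≤′-step {k} j≤k) = ℚ.≤-trans (^-step k) (^-antimono j≤k)

    bernoulli : ∀ k → ρ ^ k * (1ℚ + fromℕ k * σ) ≤ 1ℚ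
    bernoulli zero = ℚ.≤-reflexive
      (bernoulli-base σ)
    bernoulli (suc k) = ℚ.≤-trans
      (≤-resp (swapˡ ρ (ρ ^ k) (1ℚ + fromℕ (suc k) * σ)) refl
        (ℚ.*-monoˡ-≤-nonNeg (ρ ^ k) {{ℚ.nonNegative (^-nonNeg k)}} key))
      (bernoulli k)
      where
      f = fromℕ k
      0≤f : 0ℚ ≤ f
      0≤f = fromℕ-mono {0} {k} ℕ.z≤n
      key : ρ * (1ℚ + fromℕ (suc k) * σ) ≤ 1ℚ + f * σ
      key = 0≤b-a⇒a≤b (≤-resp refl
        (trans
          (bernoulli-step f σ)
          (cong₂ (λ r g → (1ℚ + f * σ) - r * (1ℚ + g * σ)) (sym ρ≡1-σ) (sym (fromℕ-suc k))))
        (ℚ.+-mono-≤ (*-nonNeg 0≤f (*-nonNeg 0≤σ 0≤σ)) (*-nonNeg 0≤σ 0≤σ)))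

    ^-small : ∀ ε → 0ℚ < ε → ∃[ N ] ρ ^ N ≤ ε
    ^-small ε 0<ε = N , ℚ.≤-trans
      (≤-resp (ℚ.*-identityʳ (ρ ^ N)) refl
        (ℚ.≤-trans (ℚ.*-monoˡ-≤-nonNeg (ρ ^ N) {{ℚ.nonNegative (^-nonNeg N)}} 1≤εg)
          (≤-resp (trans (swapˡ (ρ ^ N) ε g) (ℚ.*-assoc (ρ ^ N) ε g))
            (ℚ.*-identityʳ ε)
            (ℚ.*-monoˡ-≤-nonNeg ε {{ℚ.nonNegative (ℚ.<⇒≤ 0<ε)}} (bernoulli N)))))
      ℚ.≤-refl
      where
      q = recip ε * recip σ
      N = natAbove q
      g = 1ℚ + fromℕ N * σ
      1≤εg : 1ℚ ≤ ε * g
      1≤εg = ≤-resp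
        (trans (regroup ε σ (recip ε) (recip σ))
          (trans (cong₂ _*_ (recip-inverse 0<ε) (recip-inverse 0<σ)) (ℚ.*-identityˡ 1ℚ)))
        refl
        (ℚ.*-monoˡ-≤-nonNeg ε {{ℚ.nonNegative (ℚ.<⇒≤ 0<ε)}}
          (ℚ.≤-trans
            (ℚ.*-monoʳ-≤-nonNeg σ {{ℚ.nonNegative 0≤σ}} (≤-natAbove q))
            (≤-resp (ℚ.+-identityˡ (fromℕ N * σ)) refl (ℚ.+-monoˡ-≤ (fromℕ N * σ) 0≤1))))

    ∣^∣≤ : ∀ {q} → ∣ q ∣ ≤ ρ → ∀ k → ∣ q ^ k ∣ ≤ ρ ^ k
    ∣^∣≤ q≤ρ zero = ℚ.≤-refl
    ∣^∣≤ {q} q≤ρ (suc k) = ≤-resp (sym (ℚ.∣p*q∣≡∣p∣*∣q∣ q (q ^ k))) refl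
      (*-mono-≤ (ℚ.0≤∣p∣ q) q≤ρ (ℚ.0≤∣p∣ (q ^ k)) (∣^∣≤ q≤ρ k))

    term-bound : ∀ {q} → ∣ q ∣ ≤ ρ → ∀ k →
      ∣ q ^ suc (2 ℕ.* k) * recip (fromℕ (suc (2 ℕ.* k))) ∣ ≤ ρ ^ k
    term-bound {q} q≤ρ k = ≤-resp
      (sym (ℚ.∣p*q∣≡∣p∣*∣q∣ (q ^ j) (recip (fromℕ j))))
      (ℚ.*-identityʳ (ρ ^ k))
      (*-mono-≤ (ℚ.0≤∣p∣ (q ^ j))
        (ℚ.≤-trans (∣^∣≤ q≤ρ j) (^-antimono (ℕ.≤⇒≤′ (ℕ.≤-trans (ℕ.m≤m+n k (k ℕ.+ 0)) (ℕ.n≤1+n _)))))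
        (ℚ.0≤∣p∣ (recip (fromℕ j)))
        (≤-resp (sym (ℚ.0≤p⇒∣p∣≡p (ℚ.<⇒≤ (mesh-pos (2 ℕ.* k))))) refl
          (recip-antimono 0<1 (fromℕ-mono {1} {j} (ℕ.s≤s ℕ.z≤n)))))
      where
      j = suc (2 ℕ.* k)

    tail-bound : ∀ {q} → ∣ q ∣ ≤ ρ → ∀ {M n} → M ℕ.≤′ n →
      σ * ∣ artanhSum n q - artanhSum M q ∣ ≤ ρ ^ M - ρ ^ n
    tail-bound {q} q≤ρ {M} (ℕ.≤′-reflexive refl) = ℚ.≤-reflexive
      (trans (cong (λ z → σ * ∣ z ∣) (ℚ.+-inverseʳ (artanhSum M q)))
        (trans (ℚ.*-zeroʳ σ) (sym (ℚ.+-inverseʳ (ρ ^ M)))))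
    tail-bound {q} q≤ρ {M} (ℕ.≤′-step {n} M≤n) = ℚ.≤-trans
      (ℚ.*-monoˡ-≤-nonNeg σ {{ℚ.nonNegative 0≤σ}}
        (≤-resp (cong ∣_∣ (sub-plus A T C)) refl
          (ℚ.∣p+q∣≤∣p∣+∣q∣ (A - C) T)))
      (≤-resp (sym (ℚ.*-distribˡ-+ σ ∣ A - C ∣ ∣ T ∣))
        (geometric (ρ ^ M) (ρ ^ n) ρ)
        (ℚ.+-mono-≤ (tail-bound q≤ρ M≤n)
          (ℚ.*-monoˡ-≤-nonNeg σ {{ℚ.nonNegative 0≤σ}} (term-bound q≤ρ n))))
      where
      A = artanhSum n q
      C = artanhSum M q
      T = q ^ suc (2 ℕ.* n) * recip (fromℕ (suc (2 ℕ.* n)))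

    artanh-cauchy : ∀ {s} → IsCauchy s → (∃[ N ] ∀ n → N ℕ.≤ n → ∣ s n ∣ ≤ ρ) →
      IsCauchy (λ n → artanhSum n (s n))
    artanh-cauchy {s} cs (N₀ , hρ) =
      cauchy-scaled (λ n → artanhSum n (s n)) (1ℚ + 1ℚ + 1ℚ) (+-pos (+-pos 0<1 0<1) 0<1) λ ε 0<ε →
      let M , ρᴹ≤ = ^-small (σ * ε) (*-pos 0<σ 0<ε)
          N₁ , h₁ = artanhSum-cauchy {s} M cs ε 0<ε
          L = M ℕ.⊔ N₀
      in N₁ ℕ.⊔ L , λ m n p q →
      let p₁ = ℕ.m⊔n≤o⇒m≤o N₁ L p
          pL = ℕ.m⊔n≤o⇒n≤o N₁ L p
          q₁ = ℕ.m⊔n≤o⇒m≤o N₁ L q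
          qL = ℕ.m⊔n≤o⇒n≤o N₁ L q
          tail = λ i (r : L ℕ.≤ i) →
            tail≤ε (s i) (hρ i (ℕ.m⊔n≤o⇒n≤o M N₀ r)) (ℕ.m⊔n≤o⇒m≤o M N₀ r) ρᴹ≤
          a = artanhSum m (s m)
          b = artanhSum M (s m)
          c = artanhSum M (s n)
          d = artanhSum n (s n)
      in ℚ.≤-trans (∣-∣-triangle a c d)
        (≤-resp refl
          (triple ε)
          (ℚ.+-mono-≤
            (ℚ.≤-trans (∣-∣-triangle a b c)
              (ℚ.+-mono-≤ (tail m pL) (ℚ.<⇒≤ (h₁ m n p₁ q₁))))
            (≤-resp (∣-∣-sym d c) refl (tail n qL))))
      where
      tail≤ε : ∀ q → ∣ q ∣ ≤ ρ → ∀ {M n ε} → M ℕ.≤ n → ρ ^ M ≤ σ * ε →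
        ∣ artanhSum n q - artanhSum M q ∣ ≤ ε
      tail≤ε q q≤ρ {M} {n} M≤n ρᴹ≤ = ℚ.*-cancelˡ-≤-pos σ {{ℚ.positive 0<σ}}
        (ℚ.≤-trans (tail-bound q≤ρ (ℕ.≤⇒≤′ M≤n))
        (ℚ.≤-trans (0≤b-a⇒a≤b (≤-resp refl
            (sub-sub (ρ ^ M) (ρ ^ n)) (^-nonNeg n)))
          ρᴹ≤))

  strictBound : (s : ℕ → ℚ) →
    (∃[ ε ] (0ℚ < ε × ∃[ N ] ∀ n → N ℕ.≤ n → - 1ℚ + ε ≤ s n)) →
    (∃[ ε ] (0ℚ < ε × ∃[ N ] ∀ n → N ℕ.≤ n → s n + ε ≤ 1ℚ)) →
    ∃[ ρ ] (0ℚ ≤ ρ × ρ < 1ℚ × ∃[ N ] ∀ n → N ℕ.≤ n → ∣ s n ∣ ≤ ρ)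
  strictBound s (δ , 0<δ , M , lower) (ε , 0<ε , N , upper) =
    ρ , ℚ.≤-trans (ℚ.0≤∣p∣ (s L)) (bound L ℕ.≤-refl) , ρ<1 , L , bound
    where
    open ℚ.≤-Reasoning
    L : ℕ
    L = M ℕ.⊔ N
    σ ρ : ℚ
    σ = δ ℚ.⊓ ε
    ρ = 1ℚ - σ
    0<σ : 0ℚ < σ
    0<σ with ℚ.⊓-sel δ ε
    ... | inj₁ e = subst (0ℚ <_) (sym e) 0<δ
    ... | inj₂ e = subst (0ℚ <_) (sym e) 0<ε
    ρ<1 : ρ < 1ℚ
    ρ<1 = begin-strict
      1ℚ - σ   <⟨ ℚ.+-monoʳ-< 1ℚ (ℚ.neg-antimono-< 0<σ) ⟩
      1ℚ       ∎
    bound : ∀ n → L ℕ.≤ n → ∣ s n ∣ ≤ ρ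
    bound n L≤n = ∣a∣≤
      (begin
        s n              ≡⟨ a+b-b (s n) ε ⟨
        (s n + ε) - ε    ≤⟨ ℚ.+-monoˡ-≤ (- ε) (upper n (ℕ.m⊔n≤o⇒n≤o M N L≤n)) ⟩
        1ℚ - ε           ≤⟨ ℚ.+-monoʳ-≤ 1ℚ (ℚ.neg-antimono-≤ (ℚ.p⊓q≤q δ ε)) ⟩
        1ℚ - σ           ∎)
      (begin
        - s n            ≤⟨ ℚ.neg-antimono-≤ (lower n (ℕ.m⊔n≤o⇒m≤o M N L≤n)) ⟩
        - (- 1ℚ + δ)     ≡⟨ ℚ.neg-distrib-+ (- 1ℚ) δ ⟩
        1ℚ - δ           ≤⟨ ℚ.+-monoʳ-≤ 1ℚ (ℚ.neg-antimono-≤ (ℚ.p⊓q≤p δ ε)) ⟩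
        1ℚ - σ           ∎)

  ratio : ℚ → ℚ
  ratio a = (a - 1ℚ) * recip (a + 1ℚ)

  ratio-upper : ∀ {a B} → 0ℚ < a + 1ℚ → a ≤ B → ratio a + (recip (B + 1ℚ) + recip (B + 1ℚ)) ≤ 1ℚ
  ratio-upper {a} {B} 0<a+1 a≤B = begin
    ratio a + (recip (B + 1ℚ) + recip (B + 1ℚ))
      ≤⟨ ℚ.+-monoʳ-≤ (ratio a) (ℚ.+-mono-≤ β≤c β≤c) ⟩
    ratio a + (recip (a + 1ℚ) + recip (a + 1ℚ))
      ≡⟨ ratio-upper-eq a (recip (a + 1ℚ)) ⟩
    (a + 1ℚ) * recip (a + 1ℚ)
      ≡⟨ recip-inverse 0<a+1 ⟩
    1ℚ ∎
    where
    open ℚ.≤-Reasoning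
    β≤c : recip (B + 1ℚ) ≤ recip (a + 1ℚ)
    β≤c = recip-antimono 0<a+1 (ℚ.+-monoˡ-≤ 1ℚ a≤B)

  ratio-lower : ∀ {a B δ} → 0ℚ < δ → δ ≤ a → a ≤ B →
    - 1ℚ + (δ * recip (B + 1ℚ) + δ * recip (B + 1ℚ)) ≤ ratio a
  ratio-lower {a} {B} {δ} 0<δ δ≤a a≤B = begin
    - 1ℚ + (δ * recip (B + 1ℚ) + δ * recip (B + 1ℚ))
      ≤⟨ ℚ.+-monoʳ-≤ (- 1ℚ) (ℚ.+-mono-≤ δβ≤ac δβ≤ac) ⟩
    - 1ℚ + (a * recip (a + 1ℚ) + a * recip (a + 1ℚ))
      ≡⟨ cong (λ z → - z + (a * recip (a + 1ℚ) + a * recip (a + 1ℚ))) (recip-inverse 0<a+1) ⟨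
    - ((a + 1ℚ) * recip (a + 1ℚ)) + (a * recip (a + 1ℚ) + a * recip (a + 1ℚ))
      ≡⟨ ratio-lower-eq a (recip (a + 1ℚ)) ⟩
    ratio a ∎
    where
    open ℚ.≤-Reasoning
    0<a+1 : 0ℚ < a + 1ℚ
    0<a+1 = +-pos (ℚ.<-≤-trans 0<δ δ≤a) 0<1
    0<B+1 : 0ℚ < B + 1ℚ
    0<B+1 = ℚ.<-≤-trans 0<a+1 (ℚ.+-monoˡ-≤ 1ℚ a≤B)
    δβ≤ac : δ * recip (B + 1ℚ) ≤ a * recip (a + 1ℚ)
    δβ≤ac = *-mono-≤ (ℚ.<⇒≤ 0<δ) δ≤a (ℚ.<⇒≤ (recip-pos 0<B+1))
      (recip-antimono 0<a+1 (ℚ.+-monoˡ-≤ 1ℚ a≤B))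

-- Real numbers are Cauchy sequences of rationals.  Two sequences denote
-- the same real number when their difference tends to 0, equivalently
-- when x ≤ y and y ≤ x; all operations below respect this relation.
record ℝ : Set where
  constructor mkℝ
  field
    seq    : ℕ → ℚ
    cauchy : Rational.IsCauchy seq

open ℝ public

infix  8 -_
infixr 8 _^_
infixl 7 _*_
infixl 6 _+_ _-_
infix  4 _≤_ _<_

_≤_ : ℝ → ℝ → Set
x ≤ y = ∀ ε → 0ℚ ℚ.< ε → ∃[ N ] ∀ n → N ℕ.≤ n → seq x n ℚ.≤ seq y n ℚ.+ ε

_<_ : ℝ → ℝ → Set
x < y = ∃[ ε ] (0ℚ ℚ.< ε × ∃[ N ] ∀ n → N ℕ.≤ n → seq x n ℚ.+ ε ℚ.≤ seq y n)

fromℚ : ℚ → ℝ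
fromℚ q = mkℝ (λ _ → q) (Rational.const-cauchy q)

fromℕ : ℕ → ℝ
fromℕ n = fromℚ (Rational.fromℕ n)

0ℝ 1ℝ : ℝ
0ℝ = fromℕ 0
1ℝ = fromℕ 1

_+_ : ℝ → ℝ → ℝ
x + y = mkℝ (λ n → seq x n ℚ.+ seq y n)
            (Rational.+-cauchy {seq x} {seq y} (cauchy x) (cauchy y))

-_ : ℝ → ℝ
- x = mkℝ (λ n → ℚ.- seq x n) (Rational.neg-cauchy {seq x} (cauchy x))

_-_ : ℝ → ℝ → ℝ
x - y = x + - y

_*_ : ℝ → ℝ → ℝ
x * y = mkℝ (λ n → seq x n ℚ.* seq y n)
            (Rational.*-cauchy {seq x} {seq y} (cauchy x) (cauchy y))

_^_ : ℝ → ℕ → ℝ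
x ^ zero  = 1ℝ
x ^ suc n = x * x ^ n

private
  eventually-above : ∀ x → 0ℝ < x → ∃[ δ ] (0ℚ ℚ.< δ × ∃[ N ] ∀ n → N ℕ.≤ n → δ ℚ.≤ seq x n)
  eventually-above x (δ , 0<δ , N , h) =
    δ , 0<δ , N , λ n N≤n → subst (ℚ._≤ seq x n) (ℚ.+-identityˡ δ) (h n N≤n)

-- The positivity proof only serves to show that the sequence of
-- reciprocals is Cauchy.
inv : (x : ℝ) → 0ℝ < x → ℝ
inv x 0<x = mkℝ (λ n → Rational.recip (seq x n))
  (let δ , 0<δ , above = eventually-above x 0<x
   in Rational.recip-cauchy {seq x} (cauchy x) 0<δ above)

-- √ x = 0 for negative x.
√_ : ℝ → ℝ
√ x = mkℝ (λ n → Rational.rootApprox n (seq x n)) (Rational.root-cauchy {seq x} (cauchy x))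

artanh : (x : ℝ) → - 1ℝ < x → x < 1ℝ → ℝ
artanh x -1<x x<1 = mkℝ (λ n → Rational.artanhSum n (seq x n))
  (Rational.artanh-cauchy (proj₁ (proj₂ ρ)) (proj₁ (proj₂ (proj₂ ρ))) {seq x} (cauchy x)
    (proj₂ (proj₂ (proj₂ ρ))))
  where
  ρ : ∃[ ρ ] (0ℚ ℚ.≤ ρ × ρ ℚ.< 1ℚ × ∃[ N ] ∀ n → N ℕ.≤ n → ℚ.∣ seq x n ∣ ℚ.≤ ρ)
  ρ = Rational.strictBound (seq x) -1<x x<1

private
  eventually-bounded : ∀ x → ∃[ B ] (0ℚ ℚ.< B × ∃[ N ] ∀ n → N ℕ.≤ n → seq x n ℚ.≤ B)
  eventually-bounded x =
    let B , 0<B , N , h = Rational.bounded {seq x} (cauchy x)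
    in B , 0<B , N , λ n N≤n → ℚ.≤-trans (Rational.a≤∣a∣ (seq x n)) (h n N≤n)

  0<⇒0<+1 : ∀ x → 0ℝ < x → 0ℝ < x + 1ℝ
  0<⇒0<+1 x (δ , 0<δ , N , h) = δ , 0<δ , N , λ n N≤n →
    ℚ.≤-trans (h n N≤n) (Rational.≤-+ʳ (ℚ.<⇒≤ Rational.0<1))

  -1<ratio : ∀ x → 0ℝ < x → (0<x+1 : 0ℝ < x + 1ℝ) → - 1ℝ < (x - 1ℝ) * inv (x + 1ℝ) 0<x+1
  -1<ratio x 0<x 0<x+1 =
    let B , 0<B , M , x≤B = eventually-bounded x
        δ , 0<δ , N , δ≤x = eventually-above x 0<x
        0<δβ = Rational.*-pos 0<δ (Rational.recip-pos (Rational.+-pos 0<B Rational.0<1))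
    in _ , Rational.+-pos 0<δβ 0<δβ , M ℕ.⊔ N , λ n p →
      Rational.ratio-lower {seq x n} {B} {δ} 0<δ
        (δ≤x n (ℕ.m⊔n≤o⇒n≤o M N p)) (x≤B n (ℕ.m⊔n≤o⇒m≤o M N p))

  ratio<1 : ∀ x → 0ℝ < x → (0<x+1 : 0ℝ < x + 1ℝ) → (x - 1ℝ) * inv (x + 1ℝ) 0<x+1 < 1ℝ
  ratio<1 x 0<x 0<x+1 =
    let B , 0<B , M , x≤B = eventually-bounded x
        δ , 0<δ , N , δ≤x = eventually-above x 0<x
        0<β = Rational.recip-pos (Rational.+-pos 0<B Rational.0<1)
    in _ , Rational.+-pos 0<β 0<β , M ℕ.⊔ N , λ n p →
      Rational.ratio-upper {seq x n} {B}
        (Rational.+-pos (ℚ.<-≤-trans 0<δ (δ≤x n (ℕ.m⊔n≤o⇒n≤o M N p))) Rational.0<1)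
        (x≤B n (ℕ.m⊔n≤o⇒m≤o M N p))

-- The natural logarithm: log x = 2 artanh ((x - 1) / (x + 1)), where the
-- argument of artanh lies in (-1, 1) for every x > 0.
log : (x : ℝ) → 0ℝ < x → ℝ
log x 0<x = fromℕ 2 * artanh ((x - 1ℝ) * inv (x + 1ℝ) 0<x+1)
    (-1<ratio x 0<x 0<x+1) (ratio<1 x 0<x 0<x+1)
  where
  0<x+1 : 0ℝ < x + 1ℝ
  0<x+1 = 0<⇒0<+1 x 0<x

2≤⇒0< : ∀ x → fromℕ 2 ≤ x → 0ℝ < x
2≤⇒0< x 2≤x =
  let N , h = 2≤x 1ℚ Rational.0<1
  in 1ℚ , Rational.0<1 , N , λ n N≤n → Rational.+-cancelʳ-≤ 1ℚ (h n N≤n)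

-- The floor of a real number is not computable, hence a relation.  Only
-- floors of non-negative reals are needed.
⌊_⌋≡_ : ℝ → ℕ → Set
⌊ x ⌋≡ k = fromℕ k ≤ x × x < fromℕ (suc k)

-- X consists of positive integers, and so must k, ℓ and m; as k ≤ ℓ ≤ m
-- it suffices to require 0 < k.
T : Pred ℕ 0ℓ → Pred (ℕ × ℕ × ℕ) 0ℓ
T X (k , ℓ , m) =
  0 ℕ.< k × k ℕ.≤ ℓ × ℓ ℕ.≤ m ×
  X k × X ℓ × X m × X (k ℕ.+ ℓ) × X (ℓ ℕ.+ m) × X (m ℕ.+ k) × X (k ℕ.+ ℓ ℕ.+ m)

module _ (α : ℝ) (0<α : 0ℝ < α) where

  α^-½ : ℝ
  α^-½ = √ (inv α 0<α)

  S : Pred ℕ 0ℓ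
  S k = ∃[ n ] (0 ℕ.< n × α^-½ ≤ fromℕ n × ⌊ α * fromℕ n ^ 2 ⌋≡ k)

  T≤ : ℝ → Pred (ℕ × ℕ × ℕ) 0ℓ
  T≤ x (k , ℓ , m) = T S (k , ℓ , m) × small k × small ℓ × small m
    where
    small : Pred ℕ 0ℓ
    small j = ∃[ n ]
      (0 ℕ.< n × α^-½ ≤ fromℕ n × fromℕ n ≤ x × ⌊ α * fromℕ n ^ 2 ⌋≡ j)

-- #P ≤ y.  Membership in P need not be decidable, so P has no enumeration
-- in general; its cardinality is bounded through its finite subsets.
Card≤ : {A : Set} → Pred A 0ℓ → ℝ → Set
Card≤ P y = ∀ xs → Unique xs → All P xs → fromℕ (length xs) ≤ y

{-# OPTIONS --safe #-}

-- Write k = ⌊αa²⌋, ℓ = ⌊αb²⌋, m = ⌊αc²⌋, k + ℓ = ⌊αd²⌋ and m + k = ⌊αf²⌋.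
-- Then a² + b² - d² and a² + c² - f² are bounded by some H = H(α), and
-- d ≠ b, f ≠ c because k > 0.  So (d - b)(d + b) = a² - h with ∣h∣ ≤ H, and
-- given a and h, the divisor d + b of a² - h ≠ 0 determines b; likewise c.
-- Hence it suffices that ∑ τ(∣a² - h∣)², over a ≤ x with a² ≠ h, is
-- O(x (log x)¹⁵) for each h; write τₖ for the k-fold divisor function.
--
-- For h = 0, τ(a²)² ≤ τ(a)⁴ ≤ τ₁₆(a).  For h ≠ 0, a Landreau-type
-- inequality bounds τ(n)² by 9 ∑ τ₇(d) over the divisors d ≤ √n of n.  At
-- most τ(d) (O(x/d) + 1) of the a ≤ x satisfy d ∣ a² - h, so the sum is at
-- most a constant times ∑ τ₇(d) τ(d) x/d ≤ ∑ τ₁₄(d) x/d = O(x (log x)¹⁴).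

module Submission where

open import Data.Product using (∃-syntax; _×_)
open import Data.Product using (_,_; proj₁; proj₂)
open import Data.Sum using (_⊎_; inj₁; inj₂)
open import Relation.Binary.PropositionalEquality hiding ([_])
open import Relation.Nullary using (¬_; Dec; yes; no; contradiction)

-- The obstacle is one of length: a² - h reaches x², but a runs only up to x. The number of roots
-- modulo d is bounded by a multiple of τ(d)(x/d + 1), and for d far beyond x the summand 1
-- dominates. So only divisors d = O(x) may enter. Pairing complementary divisors achieves this for
-- τ, but not for τ²: two divisors below √n can have an lcm as large as n. This is what the
-- Landreau-type inequality repairs. Its majorant can be at most 7-fold here. Root counting
-- contributes a further τ(d), τ₇ τ ≤ τ₁₄, and ∑ τ₁₄(d)/d costs 14 logarithms; an 8-fold majorant
-- would cost 16. The exponent 15 itself comes from h = 0, where ∑ τ₁₆(a) over a ≤ x costs 15. The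
-- square of τ arises because, for fixed a, b and c are encoded independently, each by a shift h and
-- a divisor of a² - h. Up to the last step the logarithm is represented by an exponent K with N <
-- 2ᴷ, so that all counting takes place in ℕ.

module Counting where

  open import Data.Nat
  open import Data.Nat.Properties
  open import Data.Nat.DivMod
  open import Data.Nat.Divisibility
  open import Data.Nat.GCD
  open import Data.Nat.LCM
  open import Data.Nat.Coprimality using (Coprime; coprime-divisor)
  open import Data.Nat.Induction using (<-rec)
  open import Data.Nat.Primality
  open import Data.Nat.Primality.Factorisation using (factorise; PrimeFactorisation)
  open import Data.Nat.Tactic.RingSolver using (solve-∀)
  open import Data.List.Base using (List; []; _∷_; [_]; _++_; map; filter; length; cartesianProduct)
  open import Data.List.Membership.Propositional using (_∈_)
  open import Data.List.Membership.Propositional.Properties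
    using (∈-∃++; ∈-++⁻; ∈-++⁺ˡ; ∈-++⁺ʳ; ∈-map⁺; ∈-filter⁺; ∈-filter⁻; ∈-cartesianProduct⁺; ∈-cartesianProduct⁻)
  open import Data.List.Properties using (length-++; length-map)
  open import Data.List.Relation.Unary.All as All using (All; []; _∷_)
  open import Data.List.Relation.Unary.AllPairs using ([]; _∷_)
  open import Data.List.Relation.Unary.Any using (here; there)
  open import Data.List.Relation.Unary.Unique.Propositional using (Unique)
  open import Data.List.Relation.Unary.Unique.Propositional.Properties as Unique using ()
  open import Function using (_∘_)

  private variable
    A B : Set

  -- Finite sums

  ∑ : List A → (A → ℕ) → ℕ
  ∑ []       f = 0
  ∑ (x ∷ xs) f = f x + ∑ xs f

  ∑-mono : ∀ xs {f g : A → ℕ} → (∀ {x} → x ∈ xs → f x ≤ g x) → ∑ xs f ≤ ∑ xs g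
  ∑-mono []       f≤g = z≤n
  ∑-mono (x ∷ xs) f≤g = +-mono-≤ (f≤g (here refl)) (∑-mono xs (f≤g ∘ there))

  ∑-cong : ∀ xs {f g : A → ℕ} → (∀ {x} → x ∈ xs → f x ≡ g x) → ∑ xs f ≡ ∑ xs g
  ∑-cong []       f≡g = refl
  ∑-cong (x ∷ xs) f≡g = cong₂ _+_ (f≡g (here refl)) (∑-cong xs (f≡g ∘ there))

  ∑-++ : ∀ xs {ys} (f : A → ℕ) → ∑ (xs ++ ys) f ≡ ∑ xs f + ∑ ys f
  ∑-++ []       f = refl
  ∑-++ (x ∷ xs) f = trans (cong (f x +_) (∑-++ xs f)) (sym (+-assoc (f x) _ _))

  ∑-distrib-+ : ∀ xs (f g : A → ℕ) → ∑ xs (λ x → f x + g x) ≡ ∑ xs f + ∑ xs g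
  ∑-distrib-+ []       f g = refl
  ∑-distrib-+ (x ∷ xs) f g =
    trans (cong (f x + g x +_) (∑-distrib-+ xs f g)) (interchange (f x) (g x) _ _)
    where
    interchange : ∀ a b c d → a + b + (c + d) ≡ a + c + (b + d)
    interchange = solve-∀

  ∑-*ˡ : ∀ xs (f : A → ℕ) c → ∑ xs (λ x → c * f x) ≡ c * ∑ xs f
  ∑-*ˡ []       f c = sym (*-zeroʳ c)
  ∑-*ˡ (x ∷ xs) f c = trans (cong (c * f x +_) (∑-*ˡ xs f c)) (sym (*-distribˡ-+ c (f x) _))

  ∑-*ʳ : ∀ xs (f : A → ℕ) c → ∑ xs (λ x → f x * c) ≡ ∑ xs f * c
  ∑-*ʳ xs f c = trans (∑-cong xs (λ {x} _ → *-comm (f x) c)) (trans (∑-*ˡ xs f c) (*-comm c _))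

  ∑-zero : ∀ (xs : List A) → ∑ xs (λ _ → 0) ≡ 0
  ∑-zero []       = refl
  ∑-zero (_ ∷ xs) = ∑-zero xs

  ∑-const : ∀ (xs : List A) c → ∑ xs (λ _ → c) ≡ length xs * c
  ∑-const []       c = refl
  ∑-const (_ ∷ xs) c = cong (c +_) (∑-const xs c)

  ∑-swap : ∀ (xs : List A) (ys : List B) (f : A → B → ℕ) →
    ∑ xs (λ x → ∑ ys (f x)) ≡ ∑ ys (λ y → ∑ xs (λ x → f x y))
  ∑-swap []       ys f = sym (∑-zero ys)
  ∑-swap (x ∷ xs) ys f =
    trans (cong (∑ ys (f x) +_) (∑-swap xs ys f)) (sym (∑-distrib-+ ys _ _))

  -- Iverson bracket.
  ⟦_⟧ : {P : Set} → Dec P → ℕ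
  ⟦ yes _ ⟧ = 1
  ⟦ no  _ ⟧ = 0

  ∑-filter : ∀ {P : A → Set} (P? : ∀ x → Dec (P x)) xs (f : A → ℕ) →
    ∑ (filter P? xs) f ≡ ∑ xs (λ x → ⟦ P? x ⟧ * f x)
  ∑-filter P? []       f = refl
  ∑-filter P? (x ∷ xs) f with P? x
  ... | yes _ = cong₂ _+_ (sym (+-identityʳ (f x))) (∑-filter P? xs f)
  ... | no  _ = ∑-filter P? xs f

  ∑-swap-filter : ∀ {R : A → B → Set} (R? : ∀ x y → Dec (R x y)) xs ys (f : A → B → ℕ) →
    ∑ xs (λ x → ∑ (filter (R? x) ys) (f x)) ≡
    ∑ ys (λ y → ∑ (filter (λ x → R? x y) xs) (λ x → f x y))
  ∑-swap-filter R? xs ys f = begin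
    ∑ xs (λ x → ∑ (filter (R? x) ys) (f x))
      ≡⟨ ∑-cong xs (λ {x} _ → ∑-filter (R? x) ys (f x)) ⟩
    ∑ xs (λ x → ∑ ys (λ y → ⟦ R? x y ⟧ * f x y))
      ≡⟨ ∑-swap xs ys _ ⟩
    ∑ ys (λ y → ∑ xs (λ x → ⟦ R? x y ⟧ * f x y))
      ≡⟨ ∑-cong ys (λ {y} _ → ∑-filter (λ x → R? x y) xs (λ x → f x y)) ⟨
    ∑ ys (λ y → ∑ (filter (λ x → R? x y) xs) (λ x → f x y)) ∎
    where open ≡-Reasoning

  -- A relation in place of a map lets bare existence statements (a factorisation, a code) serve as
  -- the matching. The partner of the head is struck out of `ys`; injectivity keeps every later
  -- partner off the struck entry.
  ∑-matching : ∀ (R : A → B → Set) {xs : List A} {ys : List B} {f g} → Unique xs →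
    (∀ {x} → x ∈ xs → ∃[ y ] y ∈ ys × R x y × f x ≤ g y) →
    (∀ {x x′ y} → x ∈ xs → x′ ∈ xs → R x y → R x′ y → x ≡ x′) →
    ∑ xs f ≤ ∑ ys g
  ∑-matching R {[]}     _          _     _   = z≤n
  ∑-matching R {x ∷ xs} {ys} {f} {g} (x∉xs ∷ uniq) match inj
    with y , y∈ys , xRy , fx≤gy ← match (here refl)
    with as , bs , refl ← ∈-∃++ y∈ys = begin
      f x + ∑ xs f              ≤⟨ +-mono-≤ fx≤gy (∑-matching R uniq match′ (λ p q → inj (there p) (there q))) ⟩
      g y + ∑ (as ++ bs) g      ≡⟨ cong (g y +_) (∑-++ as g) ⟩
      g y + (∑ as g + ∑ bs g)   ≡⟨ rearrange (g y) (∑ as g) (∑ bs g) ⟩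
      ∑ as g + (g y + ∑ bs g)   ≡⟨ ∑-++ as g ⟨
      ∑ (as ++ [ y ] ++ bs) g   ∎
    where
    open ≤-Reasoning
    rearrange : ∀ a b c → a + (b + c) ≡ b + (a + c)
    rearrange = solve-∀
    match′ : ∀ {x′} → x′ ∈ xs → ∃[ y′ ] y′ ∈ as ++ bs × R x′ y′ × f x′ ≤ g y′
    match′ x′∈xs with match (there x′∈xs)
    ... | y′ , y′∈ys , x′Ry′ , le with ∈-++⁻ as y′∈ys
    ...   | inj₁ p           = y′ , ∈-++⁺ˡ p , x′Ry′ , le
    ...   | inj₂ (there p)   = y′ , ∈-++⁺ʳ as p , x′Ry′ , le
    ...   | inj₂ (here refl) =
      contradiction (inj (here refl) (there x′∈xs) xRy x′Ry′) (All.lookup x∉xs x′∈xs)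

  ∑-embed : ∀ (φ : A → B) {xs : List A} {ys : List B} {f g} → Unique xs →
    (∀ {x} → x ∈ xs → φ x ∈ ys × f x ≤ g (φ x)) →
    (∀ {x x′} → x ∈ xs → x′ ∈ xs → φ x ≡ φ x′ → x ≡ x′) →
    ∑ xs f ≤ ∑ ys g
  ∑-embed φ uniq into inj = ∑-matching (λ x y → φ x ≡ y) uniq
    (λ {x} x∈ → φ x , proj₁ (into x∈) , refl , proj₂ (into x∈))
    (λ x∈ x′∈ e e′ → inj x∈ x′∈ (trans e (sym e′)))

  ∑-⊆ : ∀ {xs ys : List A} (f : A → ℕ) → Unique xs → (∀ {x} → x ∈ xs → x ∈ ys) → ∑ xs f ≤ ∑ ys f
  ∑-⊆ f uniq xs⊆ys = ∑-embed (λ x → x) uniq (λ x∈ → xs⊆ys x∈ , ≤-refl) (λ _ _ e → e)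

  ∑-cartesianProduct : ∀ (xs : List A) (ys : List B) (f : A × B → ℕ) →
    ∑ (cartesianProduct xs ys) f ≡ ∑ xs (λ x → ∑ ys (λ y → f (x , y)))
  ∑-cartesianProduct []       ys f = refl
  ∑-cartesianProduct (x ∷ xs) ys f =
    trans (∑-++ (map (x ,_) ys) f) (cong₂ _+_ (row ys) (∑-cartesianProduct xs ys f))
    where
    row : ∀ zs → ∑ (map (x ,_) zs) f ≡ ∑ zs (λ y → f (x , y))
    row []       = refl
    row (z ∷ zs) = cong (f (x , z) +_) (row zs)

  ∑-cartesianProduct-* : ∀ (xs : List A) (ys : List B) (f : A → ℕ) (g : B → ℕ) →
    ∑ (cartesianProduct xs ys) (λ (x , y) → f x * g y) ≡ ∑ xs f * ∑ ys g
  ∑-cartesianProduct-* xs ys f g = trans (∑-cartesianProduct xs ys _)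
    (trans (∑-cong xs (λ {x} _ → ∑-*ˡ ys g (f x))) (∑-*ʳ xs f (∑ ys g)))

  length≡∑ : ∀ (xs : List A) → length xs ≡ ∑ xs (λ _ → 1)
  length≡∑ xs = sym (trans (∑-const xs 1) (*-identityʳ _))

  range : ℕ → List ℕ
  range zero    = []
  range (suc n) = suc n ∷ range n

  ∈-range⁻ : ∀ {x} n → x ∈ range n → 0 < x × x ≤ n
  ∈-range⁻ (suc n) (here refl) = z<s , ≤-refl
  ∈-range⁻ (suc n) (there p)   = proj₁ (∈-range⁻ n p) , m≤n⇒m≤1+n (proj₂ (∈-range⁻ n p))

  ∈-range⁺ : ∀ {x} n → 0 < x → x ≤ n → x ∈ range n
  ∈-range⁺ zero    0<x x≤0 = contradiction (<-≤-trans 0<x x≤0) λ ()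
  ∈-range⁺ {x} (suc n) 0<x x≤1+n with x ≟ suc n
  ... | yes refl  = here refl
  ... | no  x≢1+n = there (∈-range⁺ n 0<x (≤-pred (≤∧≢⇒< x≤1+n x≢1+n)))

  range-unique : ∀ n → Unique (range n)
  range-unique zero    = []
  range-unique (suc n) =
    All.tabulate (λ p e → <-irrefl (sym e) (s≤s (proj₂ (∈-range⁻ n p)))) ∷ range-unique n

  length-range : ∀ n → length (range n) ≡ n
  length-range zero    = refl
  length-range (suc n) = cong suc (length-range n)

  infixl 7 _÷_
  -- Totalised by m ÷ 0 = 0, so that sums of quotients carry no `NonZero` instances and `÷-assoc`
  -- has no side conditions.
  _÷_ : ℕ → ℕ → ℕ
  m ÷ zero  = 0
  m ÷ suc d = m / suc d

  ÷-assoc : ∀ m a b → m ÷ (a * b) ≡ m ÷ a ÷ b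
  ÷-assoc m zero    zero    = refl
  ÷-assoc m zero    (suc b) = sym (0/n≡0 (suc b))
  ÷-assoc m (suc a) zero    = cong (m ÷_) (*-zeroʳ a)
  ÷-assoc m (suc a) (suc b) = sym (m/n/o≡m/[n*o] m (suc a) (suc b))

  ÷-*-≤ : ∀ m d → m ÷ d * d ≤ m
  ÷-*-≤ m zero    = z≤n
  ÷-*-≤ m (suc d) = m/n*n≤m m (suc d)

  ≤-÷ : ∀ {a m d} → 0 < d → a * d ≤ m → a ≤ m ÷ d
  ≤-÷ {a} {m} {suc d} _ ad≤m =
    subst (_≤ m / suc d) (m*n/n≡m a (suc d)) (/-monoˡ-≤ (suc d) ad≤m)

  ÷-monoʳ : ∀ m {d e} → 0 < d → d ≤ e → m ÷ e ≤ m ÷ d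
  ÷-monoʳ m {d} {e} 0<d d≤e =
    ≤-÷ 0<d (≤-trans (*-monoʳ-≤ (m ÷ e) d≤e) (÷-*-≤ m e))

  divisors : ℕ → List ℕ
  divisors n = filter (_∣? n) (range n)

  ∈-divisors⁺ : ∀ {d n} → 0 < n → d ∣ n → d ∈ divisors n
  ∈-divisors⁺ {d} {suc n} 0<n d∣n = ∈-filter⁺ (_∣? suc n)
    (∈-range⁺ (suc n) (pos d d∣n) (∣⇒≤ d∣n)) d∣n
    where
    pos : ∀ d → d ∣ suc n → 0 < d
    pos zero    0∣ = contradiction (0∣⇒≡0 0∣) λ ()
    pos (suc d) _  = z<s

  ∈-divisors⁻ : ∀ {d} n → d ∈ divisors n → d ∣ n × 0 < d × d ≤ n
  ∈-divisors⁻ n p with q , d∣n ← ∈-filter⁻ (_∣? n) {xs = range n} p =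
    d∣n , ∈-range⁻ n q

  divisors-unique : ∀ n → Unique (divisors n)
  divisors-unique n = Unique.filter⁺ (_∣? n) (range-unique n)

  multiples : ℕ → ℕ → List ℕ
  multiples e n = filter (e ∣?_) (range n)

  ∑-range-≤ : ∀ r {m c} (f : ℕ → ℕ) → (∀ {d} → m < d → f d ≤ c) →
    ∑ (range (r + m)) f ≤ r * c + ∑ (range m) f
  ∑-range-≤ zero    f f≤c = ≤-refl
  ∑-range-≤ (suc r) {m} {c} f f≤c = begin
    f (suc (r + m)) + ∑ (range (r + m)) f  ≤⟨ +-mono-≤ (f≤c (s≤s (m≤n+m m r))) (∑-range-≤ r f f≤c) ⟩
    c + (r * c + ∑ (range m) f)            ≡⟨ +-assoc c (r * c) _ ⟨
    c + r * c + ∑ (range m) f              ∎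
    where open ≤-Reasoning

  -- Each dyadic block [2ᴷ, 2ᴷ⁺¹) contributes at most y.
  ∑-÷-≤ : ∀ K {M} y → M < 2 ^ K → ∑ (range M) (y ÷_) ≤ y * K
  ∑-÷-≤ zero    {zero}  y M<1 = z≤n
  ∑-÷-≤ zero    {suc M} y (s≤s ())
  ∑-÷-≤ (suc K) {M} y M<2^K+1 with M <? 2 ^ K
  ... | yes M<2^K = ≤-trans (∑-÷-≤ K y M<2^K) (*-monoʳ-≤ y (n≤1+n K))
  ... | no  M≮2^K = begin
    ∑ (range M) (y ÷_)                      ≡⟨ cong (λ i → ∑ (range i) (y ÷_)) (m∸n+n≡m m≤M) ⟨
    ∑ (range (r + m)) (y ÷_)                ≤⟨ ∑-range-≤ r (y ÷_) (λ {d} m<d → ÷-monoʳ y 0<2^K (subst (_≤ d) 1+m≡2^K m<d)) ⟩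
    r * (y ÷ 2 ^ K) + ∑ (range m) (y ÷_)    ≤⟨ +-mono-≤ (*-monoˡ-≤ (y ÷ 2 ^ K) r≤2^K) (∑-÷-≤ K y (≤-reflexive 1+m≡2^K)) ⟩
    2 ^ K * (y ÷ 2 ^ K) + y * K             ≤⟨ +-monoˡ-≤ (y * K) (≤-trans (≤-reflexive (*-comm (2 ^ K) _)) (÷-*-≤ y (2 ^ K))) ⟩
    y + y * K                               ≡⟨ *-suc y K ⟨
    y * suc K                               ∎
    where
    open ≤-Reasoning
    0<2^K = m^n>0 2 K
    -- The range up to m holds the earlier blocks. The last block starts at m + 1 = 2ᴷ and has at
    -- most 2ᴷ entries, each contributing at most y ÷ 2ᴷ.
    m = pred (2 ^ K)
    r = M ∸ m
    1+m≡2^K : suc m ≡ 2 ^ K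
    1+m≡2^K = suc-pred (2 ^ K) {{m^n≢0 2 K}}
    m≤M : m ≤ M
    m≤M = ≤-trans (n≤1+n m) (≤-trans (≤-reflexive 1+m≡2^K) (≮⇒≥ M≮2^K))
    r≤2^K : r ≤ 2 ^ K
    r≤2^K = m≤n+o⇒m∸n≤o M m (≤-pred (begin
      suc M             ≤⟨ M<2^K+1 ⟩
      2 ^ K + (2 ^ K + 0) ≡⟨ cong₂ _+_ (sym 1+m≡2^K) (+-identityʳ _) ⟩
      suc (m + 2 ^ K)   ∎))

  ÷-≤ : ∀ m d → m ÷ d ≤ m
  ÷-≤ m zero    = z≤n
  ÷-≤ m (suc d) = m/n≤m m (suc d)

  ∣⇒÷-* : ∀ {e d} → 0 < e → e ∣ d → d ÷ e * e ≡ d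
  ∣⇒÷-* {suc e} _ = m/n*n≡m

  ∑-multiples-≤ : ∀ {e} n (f : ℕ → ℕ) → 0 < e →
    ∑ (multiples e n) f ≤ ∑ (range (n ÷ e)) (λ j → f (j * e))
  ∑-multiples-≤ {e} n f 0<e = ∑-embed (_÷ e) (Unique.filter⁺ (e ∣?_) (range-unique n)) into inj
    where
    quot : ∀ {d} → d ∈ multiples e n → d ÷ e * e ≡ d
    quot d∈ = ∣⇒÷-* 0<e (proj₂ (∈-filter⁻ (e ∣?_) {xs = range n} d∈))
    into : ∀ {d} → d ∈ multiples e n → d ÷ e ∈ range (n ÷ e) × f d ≤ f (d ÷ e * e)
    into {d} d∈ with 0<d , d≤n ← ∈-range⁻ n (proj₁ (∈-filter⁻ (e ∣?_) {xs = range n} d∈)) =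
      ∈-range⁺ (n ÷ e)
        (n≢0⇒n>0 λ z → <⇒≢ 0<d (trans (cong (_* e) (sym z)) (quot d∈)))
        (≤-÷ 0<e (≤-trans (≤-reflexive (quot d∈)) d≤n)) ,
      ≤-reflexive (cong f (sym (quot d∈)))
    inj : ∀ {d d′} → d ∈ multiples e n → d′ ∈ multiples e n → d ÷ e ≡ d′ ÷ e → d ≡ d′
    inj d∈ d′∈ eq = trans (sym (quot d∈)) (trans (cong (_* e) eq) (quot d′∈))

  length-multiples-≤ : ∀ {e} n → 0 < e → length (multiples e n) ≤ n ÷ e
  length-multiples-≤ {e} n 0<e = begin
    length (multiples e n)            ≡⟨ length≡∑ (multiples e n) ⟩
    ∑ (multiples e n) (λ _ → 1)       ≤⟨ ∑-multiples-≤ n (λ _ → 1) 0<e ⟩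
    ∑ (range (n ÷ e)) (λ _ → 1)       ≡⟨ length≡∑ (range (n ÷ e)) ⟨
    length (range (n ÷ e))            ≡⟨ length-range (n ÷ e) ⟩
    n ÷ e                             ∎
    where open ≤-Reasoning

  -- Divisor functions

  -- τ k is the (k + 1)-fold divisor function; τ 1 counts divisors.
  τ : ℕ → ℕ → ℕ
  τ zero    n = 1
  τ (suc k) n = ∑ (divisors n) (τ k)

  -- Summation over pairs e ∣ d in the other order; it peels one layer off a divisor function under
  -- an average.
  ∑-∑-divisors : ∀ M (f g : ℕ → ℕ) →
    ∑ (range M) (λ d → g d * ∑ (divisors d) f) ≤
    ∑ (range M) (λ e → f e * ∑ (multiples e M) g)
  ∑-∑-divisors M f g = begin
    ∑ (range M) (λ d → g d * ∑ (divisors d) f)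
      ≤⟨ ∑-mono (range M) (λ {d} d∈ → *-monoʳ-≤ (g d) (∑-⊆ f (divisors-unique d) λ {e} e∈ →
           let e∣d , 0<e , e≤d = ∈-divisors⁻ d e∈
           in ∈-filter⁺ (_∣? d) (∈-range⁺ M 0<e (≤-trans e≤d (proj₂ (∈-range⁻ M d∈)))) e∣d)) ⟩
    ∑ (range M) (λ d → g d * ∑ (filter (_∣? d) (range M)) f)
      ≡⟨ ∑-cong (range M) (λ {d} _ → ∑-*ˡ (filter (_∣? d) (range M)) f (g d)) ⟨
    ∑ (range M) (λ d → ∑ (filter (_∣? d) (range M)) (λ e → g d * f e))
      ≡⟨ ∑-swap-filter (λ d e → e ∣? d) (range M) (range M) (λ d e → g d * f e) ⟩
    ∑ (range M) (λ e → ∑ (multiples e M) (λ d → g d * f e))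
      ≡⟨ ∑-cong (range M) (λ {e} _ → trans (∑-*ʳ (multiples e M) g (f e)) (*-comm _ (f e))) ⟩
    ∑ (range M) (λ e → f e * ∑ (multiples e M) g) ∎
    where open ≤-Reasoning

  -- Writing d = j e turns y ÷ d into (y ÷ e) ÷ j, so each layer of the divisor function costs one
  -- harmonic sum over j, hence one factor K.
  ∑-÷-τ-≤ : ∀ k K {M} y → M < 2 ^ K → ∑ (range M) (λ d → (y ÷ d) * τ k d) ≤ y * K ^ suc k
  ∑-÷-τ-≤ zero K {M} y M<2^K = begin
    ∑ (range M) (λ d → (y ÷ d) * 1)  ≡⟨ ∑-cong (range M) (λ {d} _ → *-identityʳ (y ÷ d)) ⟩
    ∑ (range M) (y ÷_)               ≤⟨ ∑-÷-≤ K y M<2^K ⟩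
    y * K                            ≡⟨ cong (y *_) (*-identityʳ K) ⟨
    y * (K * 1)                      ∎
    where open ≤-Reasoning
  ∑-÷-τ-≤ (suc k) K {M} y M<2^K = begin
    ∑ (range M) (λ d → (y ÷ d) * ∑ (divisors d) (τ k))
      ≤⟨ ∑-∑-divisors M (τ k) (y ÷_) ⟩
    ∑ (range M) (λ e → τ k e * ∑ (multiples e M) (y ÷_))
      ≤⟨ ∑-mono (range M) (λ {e} e∈ → *-monoʳ-≤ (τ k e) (inner e (proj₁ (∈-range⁻ M e∈)))) ⟩
    ∑ (range M) (λ e → τ k e * ((y ÷ e) * K))
      ≡⟨ ∑-cong (range M) (λ {e} _ → rearrange (τ k e) (y ÷ e) K) ⟩
    ∑ (range M) (λ e → (y ÷ e) * τ k e * K)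
      ≡⟨ ∑-*ʳ (range M) (λ e → (y ÷ e) * τ k e) K ⟩
    ∑ (range M) (λ e → (y ÷ e) * τ k e) * K
      ≤⟨ *-monoˡ-≤ K (∑-÷-τ-≤ k K y M<2^K) ⟩
    y * K ^ suc k * K
      ≡⟨ trans (*-assoc y _ K) (cong (y *_) (*-comm _ K)) ⟩
    y * K ^ suc (suc k) ∎
    where
    open ≤-Reasoning
    rearrange : ∀ a b c → a * (b * c) ≡ b * a * c
    rearrange = solve-∀
    inner : ∀ e → 0 < e → ∑ (multiples e M) (y ÷_) ≤ (y ÷ e) * K
    inner e 0<e = begin
      ∑ (multiples e M) (y ÷_)
        ≤⟨ ∑-multiples-≤ M (y ÷_) 0<e ⟩
      ∑ (range (M ÷ e)) (λ j → y ÷ (j * e))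
        ≡⟨ ∑-cong (range (M ÷ e)) (λ {j} _ → trans (cong (y ÷_) (*-comm j e)) (÷-assoc y e j)) ⟩
      ∑ (range (M ÷ e)) (λ j → (y ÷ e) ÷ j)
        ≤⟨ ∑-÷-≤ K (y ÷ e) (≤-<-trans (÷-≤ M e) M<2^K) ⟩
      (y ÷ e) * K ∎

  -- The outermost layer only counts the multiples of e up to N, which supplies the weight N ÷ e for
  -- free. An r-fold divisor function thus costs r - 1 factors K here, against r in the weighted
  -- sum.
  ∑-τ-≤ : ∀ k K {N} → N < 2 ^ K → ∑ (range N) (τ (suc k)) ≤ N * K ^ suc k
  ∑-τ-≤ k K {N} N<2^K = begin
    ∑ (range N) (τ (suc k))
      ≡⟨ ∑-cong (range N) (λ {a} _ → +-identityʳ (τ (suc k) a)) ⟨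
    ∑ (range N) (λ a → 1 * ∑ (divisors a) (τ k))
      ≤⟨ ∑-∑-divisors N (τ k) (λ _ → 1) ⟩
    ∑ (range N) (λ e → τ k e * ∑ (multiples e N) (λ _ → 1))
      ≤⟨ ∑-mono (range N) (λ {e} e∈ → *-monoʳ-≤ (τ k e)
           (≤-trans (≤-reflexive (sym (length≡∑ (multiples e N))))
             (length-multiples-≤ N (proj₁ (∈-range⁻ N e∈))))) ⟩
    ∑ (range N) (λ e → τ k e * (N ÷ e))
      ≡⟨ ∑-cong (range N) (λ {e} _ → *-comm (τ k e) (N ÷ e)) ⟩
    ∑ (range N) (λ e → (N ÷ e) * τ k e)
      ≤⟨ ∑-÷-τ-≤ k K N N<2^K ⟩
    N * K ^ suc k ∎
    where open ≤-Reasoning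

  between : ℕ → ℕ → List ℕ
  between e n = filter (e ∣?_) (divisors n)

  ∣⇒0< : ∀ {d n} → 0 < n → d ∣ n → 0 < d
  ∣⇒0< {zero}  0<n 0∣n = contradiction (0∣⇒≡0 0∣n) (≢-sym (<⇒≢ 0<n))
  ∣⇒0< {suc d} _   _   = z<s

  -- c ↦ (gcd c e , lcm c e) is injective because gcd c e * lcm c e = c * e.
  τ-between : ∀ {e n} → 0 < n → e ∣ n → τ 1 n ≤ τ 1 e * length (between e n)
  τ-between {e} {n} 0<n e∣n = begin
    ∑ (divisors n) (λ _ → 1)
      ≤⟨ ∑-embed (λ c → gcd c e , lcm c e) (divisors-unique n) into inj ⟩
    ∑ (cartesianProduct (divisors e) (between e n)) (λ _ → 1)
      ≡⟨ ∑-cartesianProduct-* (divisors e) (between e n) (λ _ → 1) (λ _ → 1) ⟩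
    τ 1 e * ∑ (between e n) (λ _ → 1)
      ≡⟨ cong (τ 1 e *_) (length≡∑ (between e n)) ⟨
    τ 1 e * length (between e n) ∎
    where
    open ≤-Reasoning
    0<e = ∣⇒0< 0<n e∣n
    into : ∀ {c} → c ∈ divisors n →
      (gcd c e , lcm c e) ∈ cartesianProduct (divisors e) (between e n) × 1 ≤ 1
    into {c} c∈ = ∈-cartesianProduct⁺
      (∈-divisors⁺ 0<e (gcd[m,n]∣n c e))
      (∈-filter⁺ (e ∣?_)
        (∈-divisors⁺ 0<n (lcm-least (proj₁ (∈-divisors⁻ n c∈)) e∣n)) (n∣lcm[m,n] c e)) , ≤-refl
    inj : ∀ {c c′} → c ∈ divisors n → c′ ∈ divisors n →
      (gcd c e , lcm c e) ≡ (gcd c′ e , lcm c′ e) → c ≡ c′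
    inj {c} {c′} _ _ eq = *-cancelʳ-≡ c c′ e {{>-nonZero 0<e}}
      (trans (sym (gcd*lcm c e)) (trans (cong (λ (g , l) → g * l) eq) (gcd*lcm c′ e)))

  -- In conventional indexing τᵣ τ ≤ τ₂ᵣ with r = k + 1. In τᵣ₊₁(n) τ(n) = ∑ τᵣ(e) τ(n) over e ∣ n,
  -- bound τ(n) by τ(e) times the number of g with e ∣ g ∣ n. Induction applies to τᵣ(e) τ(e), and
  -- the chains e ∣ g ∣ n add the two missing layers.
  τ-*-τ₂ : ∀ k {n} → 0 < n → τ k n * τ 1 n ≤ τ (suc (k + k)) n
  τ-*-τ₂ zero {n} 0<n = ≤-reflexive (+-identityʳ (τ 1 n))
  τ-*-τ₂ (suc k) {n} 0<n = begin
    ∑ (divisors n) (τ k) * τ 1 n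
      ≡⟨ ∑-*ʳ (divisors n) (τ k) (τ 1 n) ⟨
    ∑ (divisors n) (λ e → τ k e * τ 1 n)
      ≤⟨ ∑-mono (divisors n) (λ {e} e∈ → let e∣n , 0<e , _ = ∈-divisors⁻ n e∈ in begin
           τ k e * τ 1 n                              ≤⟨ *-monoʳ-≤ (τ k e) (τ-between 0<n e∣n) ⟩
           τ k e * (τ 1 e * length (between e n))     ≡⟨ *-assoc (τ k e) _ _ ⟨
           τ k e * τ 1 e * length (between e n)       ≤⟨ *-monoˡ-≤ (length (between e n)) (τ-*-τ₂ k 0<e) ⟩
           τ (suc (k + k)) e * length (between e n)   ≡⟨ trans (*-comm (τ (suc (k + k)) e) _) (sym (∑-const (between e n) _)) ⟩
           ∑ (between e n) (λ _ → τ (suc (k + k)) e)  ∎) ⟩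
    ∑ (divisors n) (λ e → ∑ (between e n) (λ _ → τ (suc (k + k)) e))
      ≡⟨ ∑-swap-filter _∣?_ (divisors n) (divisors n) (λ e _ → τ (suc (k + k)) e) ⟩
    ∑ (divisors n) (λ g → ∑ (filter (_∣? g) (divisors n)) (τ (suc (k + k))))
      ≤⟨ ∑-mono (divisors n) (λ {g} g∈ → ∑-⊆ (τ (suc (k + k)))
           (Unique.filter⁺ (_∣? g) (divisors-unique n)) λ e∈ →
             ∈-divisors⁺ (proj₁ (proj₂ (∈-divisors⁻ n g∈)))
               (proj₂ (∈-filter⁻ (_∣? g) {xs = divisors n} e∈))) ⟩
    τ (suc (suc (suc (k + k)))) n
      ≡⟨ cong (λ i → τ (suc (suc i)) n) (+-suc k k) ⟨
    τ (suc (suc k + suc k)) n ∎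
    where open ≤-Reasoning

  -- Each further factor τ doubles the number of folds: 2, 4, 8, 16.
  τ₂⁴-≤ : ∀ {n} → 0 < n → τ 1 n * τ 1 n * (τ 1 n * τ 1 n) ≤ τ 15 n
  τ₂⁴-≤ {n} 0<n = begin
    t * t * (t * t)  ≡⟨ *-assoc (t * t) t t ⟨
    t * t * t * t    ≤⟨ *-monoˡ-≤ t (*-monoˡ-≤ t (τ-*-τ₂ 1 0<n)) ⟩
    τ 3 n * t * t    ≤⟨ *-monoˡ-≤ t (τ-*-τ₂ 3 0<n) ⟩
    τ 7 n * t        ≤⟨ τ-*-τ₂ 7 0<n ⟩
    τ 15 n           ∎
    where
    open ≤-Reasoning
    t = τ 1 n

  -- `τ-between` with e = a; dividing by a embeds the g with a ∣ g ∣ a² into the divisors of a.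
  τ₂-square-≤ : ∀ {a} → 0 < a → τ 1 (a * a) ≤ τ 1 a * τ 1 a
  τ₂-square-≤ {a} 0<a = ≤-trans (τ-between {a} (*-mono-≤ 0<a 0<a) (m∣m*n a)) (*-monoʳ-≤ (τ 1 a) (begin
    length (between a (a * a))           ≡⟨ length≡∑ (between a (a * a)) ⟩
    ∑ (between a (a * a)) (λ _ → 1)      ≤⟨ ∑-embed (_÷ a) (Unique.filter⁺ (a ∣?_) (divisors-unique (a * a))) into inj ⟩
    τ 1 a                                ∎))
    where
    open ≤-Reasoning
    quot : ∀ {g} → g ∈ between a (a * a) → g ÷ a * a ≡ g
    quot g∈ = ∣⇒÷-* 0<a (proj₂ (∈-filter⁻ (a ∣?_) {xs = divisors (a * a)} g∈))
    into : ∀ {g} → g ∈ between a (a * a) → g ÷ a ∈ divisors a × 1 ≤ 1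
    into g∈ = ∈-divisors⁺ 0<a (*-cancelʳ-∣ a {{>-nonZero 0<a}} (subst (_∣ a * a) (sym (quot g∈))
      (proj₁ (∈-divisors⁻ (a * a) (proj₁ (∈-filter⁻ (a ∣?_) {xs = divisors (a * a)} g∈)))))) , ≤-refl
    inj : ∀ {g g′} → g ∈ between a (a * a) → g′ ∈ between a (a * a) → g ÷ a ≡ g′ ÷ a → g ≡ g′
    inj g∈ g′∈ eq = trans (sym (quot g∈)) (trans (cong (_* a) eq) (quot g′∈))

  -- Prime powers

  ^-monoʳ-∣ : ∀ p {i j} → i ≤ j → p ^ i ∣ p ^ j
  ^-monoʳ-∣ p {i} {j} i≤j = divides (p ^ (j ∸ i))
    (trans (cong (p ^_) (sym (m∸n+n≡m i≤j))) (^-distribˡ-+-* p (j ∸ i) i))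

  interval : ℕ → List ℕ
  interval n = 0 ∷ range n

  ∈-interval⁺ : ∀ {i n} → i ≤ n → i ∈ interval n
  ∈-interval⁺ {zero}      _     = here refl
  ∈-interval⁺ {suc i} {n} 1+i≤n = there (∈-range⁺ n z<s 1+i≤n)

  ∈-interval⁻ : ∀ {i n} → i ∈ interval n → i ≤ n
  ∈-interval⁻ (here refl) = z≤n
  ∈-interval⁻ {n = n} (there p) = proj₂ (∈-range⁻ n p)

  interval-unique : ∀ n → Unique (interval n)
  interval-unique n =
    All.tabulate (λ p e → <⇒≢ (proj₁ (∈-range⁻ n p)) e) ∷ range-unique n

  module _ {p} (p-prime : Prime p) where

    private instance
      p≢0 : NonZero p
      p≢0 = prime⇒nonZero p-prime

    ∤⇒coprime : ∀ {c} → ¬ p ∣ c → Coprime c p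
    ∤⇒coprime p∤c (d∣c , d∣p) with prime⇒irreducible p-prime d∣p
    ... | inj₁ d≡1  = d≡1
    ... | inj₂ refl = contradiction d∣c p∤c

    ∣-prime-power-* : ∀ k {c m} → c ∣ p ^ k * m → ∃[ i ] ∃[ e ] i ≤ k × e ∣ m × c ≡ p ^ i * e
    ∣-prime-power-* zero {c} {m} c∣m =
      0 , c , z≤n , subst (c ∣_) (*-identityˡ m) c∣m , sym (*-identityˡ c)
    ∣-prime-power-* (suc k) {c} {m} c∣ with p ∣? c
    ... | yes (divides q refl)
      with i , e , i≤k , e∣m , refl ← ∣-prime-power-* k {q} {m}
        (*-cancelʳ-∣ p (subst (q * p ∣_) (trans (*-assoc p (p ^ k) m) (*-comm p _)) c∣)) =
      suc i , e , s≤s i≤k , e∣m , trans (*-comm (p ^ i * e) p) (sym (*-assoc p (p ^ i) e))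
    ... | no p∤c
      with i , e , i≤k , e∣m , eq ← ∣-prime-power-* k {c} {m}
        (coprime-divisor (∤⇒coprime p∤c) (subst (c ∣_) (*-assoc p (p ^ k) m) c∣)) =
      i , e , m≤n⇒m≤1+n i≤k , e∣m , eq

    τ-prime-power-≤ : ∀ k {m} → 0 < m → τ 1 (p ^ k * m) ≤ suc k * τ 1 m
    τ-prime-power-≤ k {m} 0<m = begin
      τ 1 (p ^ k * m)
        ≤⟨ ∑-matching (λ c (i , e) → c ≡ p ^ i * e) (divisors-unique (p ^ k * m))
             (λ c∈ → let i , e , i≤k , e∣m , eq = ∣-prime-power-* k (proj₁ (∈-divisors⁻ (p ^ k * m) c∈))
                     in (i , e) , ∈-cartesianProduct⁺ (∈-interval⁺ i≤k) (∈-divisors⁺ 0<m e∣m) , eq , ≤-refl)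
             (λ _ _ eq eq′ → trans eq (sym eq′)) ⟩
      ∑ (cartesianProduct (interval k) (divisors m)) (λ _ → 1)
        ≡⟨ ∑-cartesianProduct-* (interval k) (divisors m) (λ _ → 1) (λ _ → 1) ⟩
      ∑ (interval k) (λ _ → 1) * τ 1 m
        ≡⟨ cong (_* τ 1 m) (trans (sym (length≡∑ (interval k))) (cong suc (length-range k))) ⟩
      suc k * τ 1 m ∎
      where open ≤-Reasoning

    prime-power-*-injective : ∀ i j {e f} → ¬ p ∣ e → ¬ p ∣ f → p ^ i * e ≡ p ^ j * f → i ≡ j × e ≡ f
    prime-power-*-injective zero zero {e} {f} _ _ eq =
      refl , trans (sym (*-identityˡ e)) (trans eq (*-identityˡ f))
    prime-power-*-injective zero (suc j) {e} {f} p∤e _ eq = contradiction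
      (subst (p ∣_) (sym (trans (sym (*-identityˡ e)) (trans eq (*-assoc p (p ^ j) f)))) (m∣m*n _)) p∤e
    prime-power-*-injective (suc i) zero {e} {f} _ p∤f eq = contradiction
      (subst (p ∣_) (trans (sym (*-assoc p (p ^ i) e)) (trans eq (*-identityˡ f))) (m∣m*n _)) p∤f
    prime-power-*-injective (suc i) (suc j) {e} {f} p∤e p∤f eq
      with i≡j , e≡f ← prime-power-*-injective i j p∤e p∤f (*-cancelˡ-≡ _ _ p
        (trans (sym (*-assoc p (p ^ i) e)) (trans eq (*-assoc p (p ^ j) f)))) = cong suc i≡j , e≡f

    prime-power-decomposition : ∀ n → 0 < n → ∃[ k ] ∃[ m ] n ≡ p ^ k * m × ¬ p ∣ m × 0 < m
    prime-power-decomposition = <-rec _ step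
      where
      step : ∀ n → (∀ {q} → q < n → 0 < q → ∃[ k ] ∃[ m ] q ≡ p ^ k * m × ¬ p ∣ m × 0 < m) →
        0 < n → ∃[ k ] ∃[ m ] n ≡ p ^ k * m × ¬ p ∣ m × 0 < m
      step n rec 0<n with p ∣? n
      ... | no p∤n = 0 , n , sym (*-identityˡ n) , p∤n , 0<n
      ... | yes (divides zero refl) = contradiction 0<n λ ()
      ... | yes (divides q@(suc _) refl)
        with k , m , q≡ , p∤m , 0<m ← rec (m<m*n q p (nonTrivial⇒n>1 p {{prime⇒nonTrivial p-prime}})) z<s =
        suc k , m , trans (*-comm q p) (trans (cong (p *_) q≡) (sym (*-assoc p (p ^ k) m))) , p∤m , 0<m

  -- w k j = τ k (pʲ).
  w : ℕ → ℕ → ℕ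
  w zero    j = 1
  w (suc k) j = ∑ (interval j) (w k)

  module _ {p} (p-prime : Prime p) where

    private instance
      p≢0 : NonZero p
      p≢0 = prime⇒nonZero p-prime

    -- One half of multiplicativity: (pⁱ, e) ↦ pⁱ e is injective when p does not divide e, and
    -- induction on k bounds each summand.
    τ-prime-power-≥ : ∀ k j {m} → 0 < m → ¬ p ∣ m → w k j * τ k m ≤ τ k (p ^ j * m)
    τ-prime-power-≥ zero    j       _   _   = ≤-refl
    τ-prime-power-≥ (suc k) j {m} 0<m p∤m = begin
      ∑ (interval j) (w k) * ∑ (divisors m) (τ k)
        ≡⟨ ∑-cartesianProduct-* (interval j) (divisors m) (w k) (τ k) ⟨
      ∑ (cartesianProduct (interval j) (divisors m)) (λ (i , e) → w k i * τ k e)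
        ≤⟨ ∑-embed (λ (i , e) → p ^ i * e)
             (Unique.cartesianProduct⁺ (interval-unique j) (divisors-unique m))
             (λ {(i , e)} ie∈ → let i≤j , e∣m = split ie∈ in
               ∈-divisors⁺ (*-mono-≤ (m^n>0 p j) 0<m) (*-pres-∣ (^-monoʳ-∣ p i≤j) e∣m) ,
               τ-prime-power-≥ k i (∣⇒0< 0<m e∣m) (λ p∣e → p∤m (∣-trans p∣e e∣m)))
             (λ {(i , e)} {(i′ , e′)} ie∈ ie′∈ eq →
               let i≡ , e≡ = prime-power-*-injective p-prime i i′
                     (λ p∣e → p∤m (∣-trans p∣e (proj₂ (split ie∈))))
                     (λ p∣e → p∤m (∣-trans p∣e (proj₂ (split ie′∈)))) eq
               in cong₂ _,_ i≡ e≡) ⟩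
      τ (suc k) (p ^ j * m) ∎
      where
      open ≤-Reasoning
      split : ∀ {i e} → (i , e) ∈ cartesianProduct (interval j) (divisors m) → i ≤ j × e ∣ m
      split {i} {e} ie∈ with i∈ , e∈ ← ∈-cartesianProduct⁻ (interval j) (divisors m) ie∈ =
        ∈-interval⁻ i∈ , proj₁ (∈-divisors⁻ m e∈)

  -- Pascal's rule: `w k j` is the binomial coefficient of j + k over k.
  w-suc : ∀ k j → w (suc k) (suc j) ≡ w k (suc j) + w (suc k) j
  w-suc k j = rearrange (w k 0) (w k (suc j)) _
    where
    rearrange : ∀ a b c → a + (b + c) ≡ b + (a + c)
    rearrange = solve-∀

  -- Prepares `w₆-≥`, which compares `w 6` with 7 n² by differences. By `w-suc` the first difference
  -- of `w 6` is `w 5` and the second is `w 4`; those of 7 n² are 7 + 14 n and 14.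
  w₄-≥ : ∀ j → 15 ≤ w 4 (2 + j)
  w₄-≥ zero    = ≤-refl
  w₄-≥ (suc j) = ≤-trans (w₄-≥ j) (≤-trans (m≤n+m (w 4 (2 + j)) (w 3 (3 + j))) (≤-reflexive (sym (w-suc 3 (2 + j)))))

  w₅-≥ : ∀ j → 7 + 14 * (1 + j) ≤ w 5 (2 + j)
  w₅-≥ zero    = ≤-refl {21}
  w₅-≥ (suc j) = begin
    7 + 14 * (2 + j)               ≡⟨ eq j ⟩
    14 + (7 + 14 * (1 + j))        ≤⟨ +-mono-≤ (≤-trans (n≤1+n 14) (w₄-≥ (1 + j))) (w₅-≥ j) ⟩
    w 4 (3 + j) + w 5 (2 + j)      ≡⟨ w-suc 4 (2 + j) ⟨
    w 5 (3 + j)                    ∎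
    where
    open ≤-Reasoning
    eq : ∀ j → 7 + 14 * (2 + j) ≡ 14 + (7 + 14 * (1 + j))
    eq = solve-∀

  w₆-≥ : ∀ j → 7 * (suc j * suc j) ≤ w 6 (suc j)
  w₆-≥ zero    = ≤-refl {7}
  w₆-≥ (suc j) = begin
    7 * ((2 + j) * (2 + j))                                ≡⟨ eq j ⟩
    7 + 14 * (1 + j) + 7 * (suc j * suc j)                 ≤⟨ +-mono-≤ (w₅-≥ j) (w₆-≥ j) ⟩
    w 5 (2 + j) + w 6 (suc j)                              ≡⟨ w-suc 5 (suc j) ⟨
    w 6 (2 + j)                                            ∎
    where
    open ≤-Reasoning
    eq : ∀ j → 7 * ((2 + j) * (2 + j)) ≡ 7 + 14 * (1 + j) + 7 * (suc j * suc j)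
    eq = solve-∀

  w₆-≥-square : ∀ j → suc j * suc j ≤ w 6 j
  w₆-≥-square zero    = ≤-refl
  w₆-≥-square (suc j) = ≤-trans (begin
    (2 + j) * (2 + j)                                      ≤⟨ m≤m+n _ (6 * j * j + 10 * j + 3) ⟩
    (2 + j) * (2 + j) + (6 * j * j + 10 * j + 3)           ≡⟨ eq j ⟩
    7 * (suc j * suc j)                                    ∎) (w₆-≥ j)
    where
    open ≤-Reasoning
    eq : ∀ j → (2 + j) * (2 + j) + (6 * j * j + 10 * j + 3) ≡ 7 * (suc j * suc j)
    eq = solve-∀

  w₆-≥-odd-square : ∀ j → (5 + 2 * j) * (5 + 2 * j) ≤ w 6 (2 + j)
  w₆-≥-odd-square j = ≤-trans (begin
    (5 + 2 * j) * (5 + 2 * j)                                  ≤⟨ m≤m+n _ (3 * j * j + 8 * j + 3) ⟩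
    (5 + 2 * j) * (5 + 2 * j) + (3 * j * j + 8 * j + 3)        ≡⟨ eq j ⟩
    7 * ((2 + j) * (2 + j))                                    ∎) (w₆-≥ (suc j))
    where
    open ≤-Reasoning
    eq : ∀ j → (5 + 2 * j) * (5 + 2 * j) + (3 * j * j + 8 * j + 3) ≡ 7 * ((2 + j) * (2 + j))
    eq = solve-∀

  -- Bounding τ(n)² by a sum over the divisors up to √n

  ⟦⟧-*-mono : ∀ {P Q : Set} (P? : Dec P) (Q? : Dec Q) {a b} → (P → Q × a ≤ b) → ⟦ P? ⟧ * a ≤ ⟦ Q? ⟧ * b
  ⟦⟧-*-mono (no _)  _       _ = z≤n
  ⟦⟧-*-mono (yes p) (yes _) f = +-monoˡ-≤ 0 (proj₂ (f p))
  ⟦⟧-*-mono (yes p) (no ¬q) f = contradiction (proj₁ (f p)) ¬q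

  -- The cutoff is squared, since √n need not be an integer. The slack q ^ h makes the sum
  -- inductive: if n = pᴷ m and d = pʲ e, the cutoff for e is that of m shifted by the factor p^(K -
  -- 2j).
  V : (k q n h : ℕ) → ℕ
  V k q n h = ∑ (divisors n) (λ d → ⟦ d * d ≤? n * q ^ h ⟧ * τ k d)

  -- Primes are split off in decreasing order. Slack that induction supplies in powers of a smaller
  -- base can therefore be restated in powers of the prime in hand.
  V-monoˡ : ∀ k {q r} n h → q ≤ r → V k q n h ≤ V k r n h
  V-monoˡ k {q} {r} n h q≤r = ∑-mono (divisors n) λ {d} _ →
    ⟦⟧-*-mono (d * d ≤? n * q ^ h) (d * d ≤? n * r ^ h)
      λ le → ≤-trans le (*-monoʳ-≤ n (^-monoˡ-≤ h q≤r)) , ≤-refl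

  -- For e ∣ m, the condition (pʲ e)² ≤ pᴷ m pʰ amounts to e² ≤ m p^h′ with h′ = h + K - 2j. Since j
  -- determines h′, distinct entries of `js` belong to distinct powers of p and hence to disjoint
  -- sets of divisors; keeping only some j gives a lower bound.
  V-prime-power-≥ : ∀ k {p} → Prime p → ∀ K h {m} → 0 < m → ¬ p ∣ m →
    (js : List (ℕ × ℕ)) → Unique js → All (λ (j , h′) → j ≤ K × h′ + 2 * j ≡ h + K) js →
    ∑ js (λ (j , h′) → w k j * V k p m h′) ≤ V k p (p ^ K * m) h
  V-prime-power-≥ k {p} p-prime K h {m} 0<m p∤m js js-unique ok = begin
    ∑ js (λ (j , h′) → w k j * V k p m h′)
      ≡⟨ ∑-cong js (λ {(j , h′)} _ → ∑-*ˡ (divisors m) _ (w k j)) ⟨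
    ∑ js (λ (j , h′) → ∑ (divisors m) (λ e → term j h′ e))
      ≡⟨ ∑-cartesianProduct js (divisors m) (λ ((j , h′) , e) → term j h′ e) ⟨
    ∑ (cartesianProduct js (divisors m)) (λ ((j , h′) , e) → term j h′ e)
      ≤⟨ ∑-embed (λ ((j , h′) , e) → p ^ j * e)
           (Unique.cartesianProduct⁺ js-unique (divisors-unique m))
           (λ {((j , h′) , e)} ∈ → let (j≤K , h≡) , e∣m = split ∈ in
             ∈-divisors⁺ (*-mono-≤ (m^n>0 p K) 0<m) (*-pres-∣ (^-monoʳ-∣ p j≤K) e∣m) , (begin
             w k j * (⟦ e * e ≤? m * p ^ h′ ⟧ * τ k e)
               ≡⟨ swap (w k j) ⟦ e * e ≤? m * p ^ h′ ⟧ (τ k e) ⟩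
             ⟦ e * e ≤? m * p ^ h′ ⟧ * (w k j * τ k e)
               ≤⟨ ⟦⟧-*-mono (e * e ≤? m * p ^ h′) (p ^ j * e * (p ^ j * e) ≤? p ^ K * m * p ^ h)
                    (λ le → small j h′ e h≡ le ,
                      τ-prime-power-≥ p-prime k j (∣⇒0< 0<m e∣m) (λ p∣e → p∤m (∣-trans p∣e e∣m))) ⟩
             ⟦ p ^ j * e * (p ^ j * e) ≤? p ^ K * m * p ^ h ⟧ * τ k (p ^ j * e) ∎))
           (λ {((j , h′) , e)} {((j′ , h″) , e′)} ∈ ∈′ eq →
             let (_ , h≡) , e∣m = split ∈
                 (_ , h≡′) , e′∣m = split ∈′
                 j≡ , e≡ = prime-power-*-injective p-prime j j′
                   (λ p∣e → p∤m (∣-trans p∣e e∣m)) (λ p∣e → p∤m (∣-trans p∣e e′∣m)) eq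
             in cong₂ _,_ (cong₂ _,_ j≡ (+-cancelʳ-≡ (2 * j) h′ h″
                  (trans h≡ (trans (sym h≡′) (cong (λ i → h″ + 2 * i) (sym j≡)))))) e≡) ⟩
    V k p (p ^ K * m) h ∎
    where
    open ≤-Reasoning
    instance
      p≢0 : NonZero p
      p≢0 = prime⇒nonZero p-prime
    term : ℕ → ℕ → ℕ → ℕ
    term j h′ e = w k j * (⟦ e * e ≤? m * p ^ h′ ⟧ * τ k e)
    swap : ∀ a b c → a * (b * c) ≡ b * (a * c)
    swap = solve-∀
    split : ∀ {j e} → (j , e) ∈ cartesianProduct js (divisors m) →
      (proj₁ j ≤ K × proj₂ j + 2 * proj₁ j ≡ h + K) × e ∣ m
    split ∈ with j∈ , e∈ ← ∈-cartesianProduct⁻ js (divisors m) ∈ =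
      All.lookup ok j∈ , proj₁ (∈-divisors⁻ m e∈)
    small : ∀ j h′ e → h′ + 2 * j ≡ h + K → e * e ≤ m * p ^ h′ →
      p ^ j * e * (p ^ j * e) ≤ p ^ K * m * p ^ h
    small j h′ e h≡ le = begin
      p ^ j * e * (p ^ j * e)        ≡⟨ eq₁ (p ^ j) e ⟩
      e * e * (p ^ j * p ^ j)        ≤⟨ *-monoˡ-≤ (p ^ j * p ^ j) le ⟩
      m * p ^ h′ * (p ^ j * p ^ j)   ≡⟨ cong (m * p ^ h′ *_) (^-distribˡ-+-* p j j) ⟨
      m * p ^ h′ * p ^ (j + j)       ≡⟨ *-assoc m _ _ ⟩
      m * (p ^ h′ * p ^ (j + j))     ≡⟨ cong (m *_) (^-distribˡ-+-* p h′ (j + j)) ⟨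
      m * p ^ (h′ + (j + j))         ≡⟨ cong (λ i → m * p ^ (h′ + (j + i))) (+-identityʳ j) ⟨
      m * p ^ (h′ + 2 * j)           ≡⟨ cong (λ i → m * p ^ i) h≡ ⟩
      m * p ^ (h + K)                ≡⟨ cong (m *_) (^-distribˡ-+-* p h K) ⟩
      m * (p ^ h * p ^ K)            ≡⟨ eq₂ m (p ^ h) (p ^ K) ⟩
      p ^ K * m * p ^ h              ∎
      where
      eq₁ : ∀ a e → a * e * (a * e) ≡ e * e * (a * a)
      eq₁ = solve-∀
      eq₂ : ∀ m a b → m * (a * b) ≡ b * m * a
      eq₂ = solve-∀

  -- Chosen so that 4 ψ(h) ≤ ψ(h + 1) + 7 ψ(h - 1), with ψ(-1) = 0; this is
  -- the induction step for a prime that divides n exactly once.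
  ψ : ℕ → ℕ
  ψ 0 = 1
  ψ 1 = 4
  ψ _ = 9

  1≤ψ : ∀ h → 1 ≤ ψ h
  1≤ψ 0 = ≤-refl
  1≤ψ 1 = s≤s z≤n
  1≤ψ (suc (suc _)) = s≤s z≤n

  ψ≤9 : ∀ h → ψ h ≤ 9
  ψ≤9 0 = s≤s z≤n
  ψ≤9 1 = s≤s (s≤s (s≤s (s≤s z≤n)))
  ψ≤9 (suc (suc _)) = ≤-refl

  even⊎odd : ∀ n → ∃[ m ] (n ≡ 2 * m ⊎ n ≡ 1 + 2 * m)
  even⊎odd zero = 0 , inj₁ refl
  even⊎odd (suc n) with even⊎odd n
  ... | m , inj₁ refl = m , inj₂ refl
  ... | m , inj₂ refl = suc m , inj₁ (eq m)
    where
    eq : ∀ m → 2 + 2 * m ≡ 2 * suc m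
    eq = solve-∀

  -- The local inequality at a prime of exponent K: (K + 1)² is the local factor of τ², and the
  -- chosen exponents j must outweigh it after their change of slack from h to h′. One or two
  -- exponents near K/2 suffice, since `w 6` grows fast enough.
  record Balanced (h K : ℕ) : Set where
    constructor mkBalanced
    field
      js        : List (ℕ × ℕ)
      js-unique : Unique js
      js-ok     : All (λ (j , h′) → j ≤ K × h′ + 2 * j ≡ h + K) js
      js-weight : ψ h * (suc K * suc K) ≤ ∑ js (λ (j , h′) → w 6 j * ψ h′)

  one : ∀ {h K} j h′ → j ≤ K → h′ + 2 * j ≡ h + K →
    ψ h * (suc K * suc K) ≤ w 6 j * ψ h′ → Balanced h K
  one j h′ j≤K eq le = mkBalanced ((j , h′) ∷ []) ([] ∷ []) ((j≤K , eq) ∷ []) (≤-trans le (m≤m+n (w 6 j * ψ h′) 0))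

  two : ∀ {h K} j h′ h″ → suc j ≤ K → h′ + 2 * j ≡ h + K → h″ + 2 * suc j ≡ h + K →
    ψ h * (suc K * suc K) ≤ w 6 j * ψ h′ + w 6 (suc j) * ψ h″ → Balanced h K
  two j h′ h″ j<K eq eq′ le = mkBalanced
    ((j , h′) ∷ (suc j , h″) ∷ [])
    (((λ e → 1+n≢n (sym (cong proj₁ e))) ∷ []) ∷ [] ∷ [])
    ((≤-trans (n≤1+n j) j<K , eq) ∷ (j<K , eq′) ∷ [])
    (≤-trans le (≤-reflexive (cong (w 6 j * ψ h′ +_) (sym (+-identityʳ (w 6 (suc j) * ψ h″))))))

  -- The middle exponent j = K/2 leaves h unchanged and suffices alone unless K = 2, where `w 6 1` =
  -- 7 falls short of 3² = 9. There a second exponent helps: j = 0 with its large slack if h < 2,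
  -- and j = 2 with its large weight 28 otherwise.
  balanced-even : ∀ h m → Balanced h (2 * m)
  balanced-even h zero = one 0 h z≤n refl (≤-reflexive (*-comm (ψ h) 1))
  balanced-even 0 1 = two 0 2 0 (s≤s z≤n) refl refl (m≤m+n 9 7)
  balanced-even 1 1 = two 0 3 1 (s≤s z≤n) refl refl (m≤m+n 36 1)
  balanced-even (suc (suc h)) 1 = two 1 (2 + h) h ≤-refl refl (eq h)
    (≤-trans (m≤m+n 81 10) (+-monoʳ-≤ 63 (*-monoʳ-≤ 28 (1≤ψ h))))
    where
    eq : ∀ h → h + 4 ≡ 2 + h + 2
    eq = solve-∀
  balanced-even h (suc (suc m)) = one (2 + m) h (m≤m+n (2 + m) _) refl (begin
    ψ h * (suc (2 * (2 + m)) * suc (2 * (2 + m)))  ≡⟨ eq (ψ h) m ⟩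
    (5 + 2 * m) * (5 + 2 * m) * ψ h                ≤⟨ *-monoˡ-≤ (ψ h) (w₆-≥-odd-square m) ⟩
    w 6 (2 + m) * ψ h                              ∎)
    where
    open ≤-Reasoning
    eq : ∀ a m → a * (suc (2 * (2 + m)) * suc (2 * (2 + m))) ≡ (5 + 2 * m) * (5 + 2 * m) * a
    eq = solve-∀

  -- There is no middle exponent: j = m raises the slack by one and j = m + 1 lowers it by one. At h
  -- = 0 only the former is possible, and ψ 1 = 4 pays for the factor 4 in (K + 1)² = 4 (m + 1)².
  balanced-odd : ∀ h m → Balanced h (1 + 2 * m)
  balanced-odd zero m = one m 1 (m≤n⇒m≤1+n (m≤m+n m _)) refl (begin
    1 * ((2 + 2 * m) * (2 + 2 * m))  ≡⟨ eq m ⟩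
    suc m * suc m * 4                ≤⟨ *-monoˡ-≤ 4 (w₆-≥-square m) ⟩
    w 6 m * 4                        ∎)
    where
    open ≤-Reasoning
    eq : ∀ m → 1 * ((2 + 2 * m) * (2 + 2 * m)) ≡ suc m * suc m * 4
    eq = solve-∀
  balanced-odd (suc h) m = two m (2 + h) h (s≤s (m≤m+n m _)) (eq₁ h m) (eq₂ h m) (begin
    ψ (suc h) * ((2 + 2 * m) * (2 + 2 * m))              ≡⟨ eq₃ (ψ (suc h)) m ⟩
    4 * ψ (suc h) * (suc m * suc m)                      ≤⟨ *-monoˡ-≤ (suc m * suc m) (ψ-step h) ⟩
    (9 + 7 * ψ h) * (suc m * suc m)                      ≡⟨ eq₄ (ψ h) (suc m * suc m) ⟩
    suc m * suc m * 9 + 7 * (suc m * suc m) * ψ h        ≤⟨ +-mono-≤ (*-monoˡ-≤ 9 (w₆-≥-square m)) (*-monoˡ-≤ (ψ h) (w₆-≥ m)) ⟩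
    w 6 m * 9 + w 6 (suc m) * ψ h                        ∎)
    where
    open ≤-Reasoning
    eq₁ : ∀ h m → 2 + h + 2 * m ≡ suc h + (1 + 2 * m)
    eq₁ = solve-∀
    eq₂ : ∀ h m → h + 2 * suc m ≡ suc h + (1 + 2 * m)
    eq₂ = solve-∀
    eq₃ : ∀ a m → a * ((2 + 2 * m) * (2 + 2 * m)) ≡ 4 * a * (suc m * suc m)
    eq₃ = solve-∀
    eq₄ : ∀ a b → (9 + 7 * a) * b ≡ b * 9 + 7 * b * a
    eq₄ = solve-∀
    ψ-step : ∀ h → 4 * ψ (suc h) ≤ 9 + 7 * ψ h
    -- Equality, 16 = 9 + 7: this case fixes the value 9 of ψ at 2.
    ψ-step 0             = ≤-refl
    ψ-step 1             = m≤m+n 36 1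
    ψ-step (suc (suc _)) = m≤m+n 36 36

  balanced : ∀ h K → Balanced h K
  balanced h K with even⊎odd K
  ... | m , inj₁ refl = balanced-even h m
  ... | m , inj₂ refl = balanced-odd h m

  Smooth : ℕ → ℕ → Set
  Smooth q n = ∀ {p} → Prime p → p ∣ n → p ≤ q

  smooth-1⇒≡1 : ∀ {n} → 0 < n → Smooth 1 n → n ≡ 1
  smooth-1⇒≡1 {n} 0<n smooth with factorise n {{>-nonZero 0<n}}
  ... | record { factors = [] ; isFactorisation = eq } = eq
  ... | record { factors = p ∷ ps ; isFactorisation = eq ; factorsPrime = p-prime ∷ _ } =
    contradiction (smooth p-prime (subst (p ∣_) (sym eq) (m∣m*n _)))
      (<⇒≱ (nonTrivial⇒n>1 p {{prime⇒nonTrivial p-prime}}))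

  smooth-pred : ∀ {q n} → Smooth (suc q) n → ¬ (Prime (suc q) × suc q ∣ n) → Smooth q n
  smooth-pred smooth ¬q∣n p-prime p∣n = ≤-pred (≤∧≢⇒< (smooth p-prime p∣n)
    λ { refl → ¬q∣n (p-prime , p∣n) })

  -- Induction on q, splitting off the power of the prime q + 2.  The
  -- exponent h records how much larger than √n the divisors may be, in
  -- units of q + 1, an upper bound for the remaining primes.
  τ₂²-≤-V : ∀ q n h → 0 < n → Smooth (suc q) n → ψ h * (τ 1 n * τ 1 n) ≤ 9 * V 6 (suc q) n h
  τ₂²-≤-V zero n h 0<n smooth with smooth-1⇒≡1 0<n smooth
  ... | refl = begin
    ψ h * 1            ≡⟨ *-identityʳ (ψ h) ⟩
    ψ h                ≤⟨ ψ≤9 h ⟩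
    9 * 1              ≤⟨ *-monoʳ-≤ 9 (≤-trans (⟦⟧-*-mono {1 ≡ 1} (yes refl) (1 ≤? 1 * 1 ^ h) λ _ →
                            ≤-reflexive (sym (trans (*-identityˡ (1 ^ h)) (^-zeroˡ h))) , ≤-refl {1}) (m≤m+n (⟦ 1 ≤? 1 * 1 ^ h ⟧ * 1) 0)) ⟩
    9 * V 6 1 1 h      ∎
    where open ≤-Reasoning
  τ₂²-≤-V (suc q) n h 0<n smooth with prime? (2 + q)
  ... | no ¬prime = ≤-trans
    (τ₂²-≤-V q n h 0<n (smooth-pred smooth λ (pr , _) → ¬prime pr))
    (*-monoʳ-≤ 9 (V-monoˡ 6 n h (n≤1+n (suc q))))
  ... | yes p-prime
    with K , m , refl , p∤m , 0<m ← prime-power-decomposition p-prime n 0<n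
    with mkBalanced js js-unique ok le ← balanced h K = begin
    ψ h * (τ 1 (p ^ K * m) * τ 1 (p ^ K * m))
      ≤⟨ *-monoʳ-≤ (ψ h) (*-mono-≤ (τ-prime-power-≤ p-prime K 0<m) (τ-prime-power-≤ p-prime K 0<m)) ⟩
    ψ h * (suc K * t * (suc K * t))
      ≡⟨ eq₁ (ψ h) (suc K) t ⟩
    ψ h * (suc K * suc K) * (t * t)
      ≤⟨ *-monoˡ-≤ (t * t) le ⟩
    ∑ js (λ (j , h′) → w 6 j * ψ h′) * (t * t)
      ≡⟨ ∑-*ʳ js _ (t * t) ⟨
    ∑ js (λ (j , h′) → w 6 j * ψ h′ * (t * t))
      ≤⟨ ∑-mono js (λ {(j , h′)} _ → begin
           w 6 j * ψ h′ * (t * t)        ≡⟨ *-assoc (w 6 j) (ψ h′) _ ⟩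
           w 6 j * (ψ h′ * (t * t))      ≤⟨ *-monoʳ-≤ (w 6 j) (τ₂²-≤-V q m h′ 0<m
                                              (smooth-pred (λ pr p∣m → smooth pr (∣n⇒∣m*n (p ^ K) p∣m)) λ (_ , p∣m) → p∤m p∣m)) ⟩
           w 6 j * (9 * V 6 (suc q) m h′) ≤⟨ *-monoʳ-≤ (w 6 j) (*-monoʳ-≤ 9 (V-monoˡ 6 m h′ (n≤1+n (suc q)))) ⟩
           w 6 j * (9 * V 6 p m h′)      ≡⟨ eq₂ (w 6 j) (V 6 p m h′) ⟩
           9 * (w 6 j * V 6 p m h′)      ∎) ⟩
    ∑ js (λ (j , h′) → 9 * (w 6 j * V 6 p m h′))
      ≡⟨ ∑-*ˡ js _ 9 ⟩
    9 * ∑ js (λ (j , h′) → w 6 j * V 6 p m h′)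
      ≤⟨ *-monoʳ-≤ 9 (V-prime-power-≥ 6 p-prime K h 0<m p∤m js js-unique ok) ⟩
    9 * V 6 p (p ^ K * m) h ∎
    where
    open ≤-Reasoning
    p = 2 + q
    t = τ 1 m
    eq₁ : ∀ a b c → a * (b * c * (b * c)) ≡ a * (b * b) * (c * c)
    eq₁ = solve-∀
    eq₂ : ∀ a b → a * (9 * b) ≡ 9 * (a * b)
    eq₂ = solve-∀

  -- At h = 0 the slack and ψ are both 1, so the cutoff is exactly √n; as a bound for the prime
  -- factors of n, n itself will do.
  τ₂²-≤ : ∀ {n} → 0 < n → τ 1 n * τ 1 n ≤ 9 * ∑ (filter (λ d → d * d ≤? n) (divisors n)) (τ 6)
  τ₂²-≤ {n@(suc n′)} 0<n = begin
    τ 1 n * τ 1 n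
      ≡⟨ +-identityʳ (τ 1 n * τ 1 n) ⟨
    1 * (τ 1 n * τ 1 n)
      ≤⟨ τ₂²-≤-V n′ n 0 0<n (λ _ p∣n → ∣⇒≤ p∣n) ⟩
    9 * V 6 n n 0
      ≤⟨ *-monoʳ-≤ 9 (∑-mono (divisors n) λ {d} _ →
           ⟦⟧-*-mono (d * d ≤? n * 1) (d * d ≤? n) λ le → ≤-trans le (≤-reflexive (*-identityʳ n)) , ≤-refl) ⟩
    9 * ∑ (divisors n) (λ d → ⟦ d * d ≤? n ⟧ * τ 6 d)
      ≡⟨ cong (9 *_) (∑-filter (λ d → d * d ≤? n) (divisors n) (τ 6)) ⟨
    9 * ∑ (filter (λ d → d * d ≤? n) (divisors n)) (τ 6) ∎
    where open ≤-Reasoning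

  -- Roots of a² + u ≡ v modulo d

  -- Congruence without integers. In this form transitivity is addition of equations, whereas for d
  -- ∣ ∣ x - y ∣ it would need a case split on the order of the three numbers.
  Congruent : ℕ → ℕ → ℕ → Set
  Congruent d x y = ∃[ a ] ∃[ b ] x + a * d ≡ y + b * d

  congruent-sym : ∀ {d x y} → Congruent d x y → Congruent d y x
  congruent-sym (a , b , eq) = b , a , sym eq

  congruent-trans : ∀ {d x y z} → Congruent d x y → Congruent d y z → Congruent d x z
  congruent-trans {d} {x} {y} {z} (a , b , eq) (a′ , b′ , eq′) = a + a′ , b + b′ , (begin
    x + (a + a′) * d       ≡⟨ split x a a′ d ⟩
    x + a * d + a′ * d     ≡⟨ cong (_+ a′ * d) eq ⟩
    y + b * d + a′ * d     ≡⟨ swap y (b * d) (a′ * d) ⟩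
    y + a′ * d + b * d     ≡⟨ cong (_+ b * d) eq′ ⟩
    z + b′ * d + b * d     ≡⟨ swap z (b′ * d) (b * d) ⟩
    z + b * d + b′ * d     ≡⟨ split z b b′ d ⟨
    z + (b + b′) * d       ∎)
    where
    open ≡-Reasoning
    split : ∀ x a b d → x + (a + b) * d ≡ x + a * d + b * d
    split = solve-∀
    swap : ∀ x a b → x + a + b ≡ x + b + a
    swap = solve-∀

  ∣⇒congruent : ∀ {d} x y → d ∣ ∣ x - y ∣ → Congruent d x y
  ∣⇒congruent {d} x y (divides q eq) with ≤-total x y
  ... | inj₁ x≤y = q , 0 , (begin
    x + q * d         ≡⟨ cong (x +_) (trans (sym eq) (m≤n⇒∣m-n∣≡n∸m x≤y)) ⟩
    x + (y ∸ x)       ≡⟨ m+[n∸m]≡n x≤y ⟩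
    y                 ≡⟨ +-identityʳ y ⟨
    y + 0             ∎)
    where open ≡-Reasoning
  ... | inj₂ y≤x = 0 , q , (begin
    x + 0             ≡⟨ +-identityʳ x ⟩
    x                 ≡⟨ m+[n∸m]≡n y≤x ⟨
    y + (x ∸ y)       ≡⟨ cong (y +_) (trans (sym eq) (trans (∣-∣-comm x y) (m≤n⇒∣m-n∣≡n∸m y≤x))) ⟨
    y + q * d         ∎)
    where open ≡-Reasoning

  congruent⇒∣-≤ : ∀ {d x y} → x ≤ y → Congruent d x y → d ∣ ∣ x - y ∣
  congruent⇒∣-≤ {d} {x} {y} x≤y (a , b , eq) = subst (d ∣_) (sym (m≤n⇒∣m-n∣≡n∸m x≤y))
    (∣m+n∣m⇒∣n (subst (d ∣_) (+-cancelˡ-≡ x _ _ (begin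
      x + a * d                ≡⟨ eq ⟩
      y + b * d                ≡⟨ cong (_+ b * d) (m+[n∸m]≡n x≤y) ⟨
      x + (y ∸ x) + b * d      ≡⟨ rearrange x (y ∸ x) (b * d) ⟩
      x + (b * d + (y ∸ x))    ∎)) (n∣m*n a)) (n∣m*n b))
    where
    open ≡-Reasoning
    rearrange : ∀ x e b → x + e + b ≡ x + (b + e)
    rearrange = solve-∀

  congruent⇒∣ : ∀ {d} x y → Congruent d x y → d ∣ ∣ x - y ∣
  congruent⇒∣ {d} x y c with ≤-total x y
  ... | inj₁ x≤y = congruent⇒∣-≤ x≤y c
  ... | inj₂ y≤x = subst (d ∣_) (∣-∣-comm y x) (congruent⇒∣-≤ y≤x (congruent-sym c))

  ∣-∣-trans-∣ : ∀ {d} x y z → d ∣ ∣ x - y ∣ → d ∣ ∣ y - z ∣ → d ∣ ∣ x - z ∣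
  ∣-∣-trans-∣ x y z p q = congruent⇒∣ x z (congruent-trans (∣⇒congruent x y p) (∣⇒congruent y z q))

  ∣-∣-sym-∣ : ∀ {d} x y → d ∣ ∣ x - y ∣ → d ∣ ∣ y - x ∣
  ∣-∣-sym-∣ {d} x y = subst (d ∣_) (∣-∣-comm x y)

  ÷-injective-mod : ∀ {l} → 0 < l → ∀ x y → l ∣ ∣ x - y ∣ → x ÷ l ≡ y ÷ l → x ≡ y
  ÷-injective-mod {suc l-1} _ x y l∣ eq with a , b , c ← ∣⇒congruent x y l∣ = begin
    x                  ≡⟨ m≡m%n+[m/n]*n x l ⟩
    x % l + x / l * l  ≡⟨ cong₂ (λ r q → r + q * l) x%l≡y%l eq ⟩
    y % l + y / l * l  ≡⟨ m≡m%n+[m/n]*n y l ⟨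
    y                  ∎
    where
    open ≡-Reasoning
    l = suc l-1
    x%l≡y%l : x % l ≡ y % l
    x%l≡y%l = trans (sym ([m+kn]%n≡m%n x a l)) (trans (cong (_% l) c) ([m+kn]%n≡m%n y b l))

  ∣²-²∣ : ∀ a b → ∣ a * a - b * b ∣ ≡ ∣ a - b ∣ * (a + b)
  ∣²-²∣ a b = wlog (≤-total a b)
    where
    open ≡-Reasoning
    expand : ∀ a e → (a + e) * (a + e) ≡ a * a + e * (a + (a + e))
    expand = solve-∀
    ordered : ∀ a b → a ≤ b → ∣ a * a - b * b ∣ ≡ ∣ a - b ∣ * (a + b)
    ordered a b a≤b with e , refl ← m≤n⇒∃[o]m+o≡n a≤b = begin
      ∣ a * a - (a + e) * (a + e) ∣             ≡⟨ cong (∣ a * a -_∣) (expand a e) ⟩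
      ∣ a * a - a * a + e * (a + (a + e)) ∣     ≡⟨ ∣m-m+n∣≡n (a * a) _ ⟩
      e * (a + (a + e))                         ≡⟨ cong (_* (a + (a + e))) (∣m-m+n∣≡n a e) ⟨
      ∣ a - a + e ∣ * (a + (a + e))             ∎
    wlog : a ≤ b ⊎ b ≤ a → ∣ a * a - b * b ∣ ≡ ∣ a - b ∣ * (a + b)
    wlog (inj₁ a≤b) = ordered a b a≤b
    wlog (inj₂ b≤a) = trans (∣-∣-comm (a * a) (b * b))
      (trans (ordered b a b≤a) (cong₂ _*_ (∣-∣-comm b a) (+-comm b a)))

  roots : (u v d N : ℕ) → List ℕ
  roots u v d N = filter (λ a → d ∣? ∣ a * a + u - v ∣) (range N)

  -- Fix a root a₀.  Any other root a gives a factorisation d = d₁ c with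
  -- d₁ ∣ a - a₀ and c ∣ a + a₀.  The roots with a given d₁ are congruent
  -- modulo lcm(d₁, c) = d / g, where g = gcd(d₁, c) divides 2∣u - v∣.
  module _ {u v d : ℕ} (0<d : 0 < d) (u≢v : u ≢ v) (a₀ : ℕ) (d∣n₀ : d ∣ ∣ a₀ * a₀ + u - v ∣) where

    private
      D = ∣ u - v ∣

      0<D : 0 < D
      0<D = n≢0⇒n>0 λ D≡0 → u≢v (∣m-n∣≡0⇒m≡n D≡0)

      δ : ℕ → ℕ
      δ a = gcd d ∣ a - a₀ ∣

      L : ℕ → ℕ
      L d₁ = lcm d₁ (d ÷ d₁)

    module _ (a : ℕ) (d∣n : d ∣ ∣ a * a + u - v ∣) where

      private
        d₁ c g : ℕ
        d₁ = δ a
        c = d ÷ d₁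
        g = gcd d₁ c

      0<d₁ : 0 < d₁
      0<d₁ = ∣⇒0< 0<d (gcd[m,n]∣m d _)

      c*d₁≡d : c * d₁ ≡ d
      c*d₁≡d = ∣⇒÷-* 0<d₁ (gcd[m,n]∣m d _)

      g*L≡d : g * L d₁ ≡ d
      g*L≡d = trans (gcd*lcm d₁ c) (trans (*-comm d₁ c) c*d₁≡d)

      0<L : 0 < L d₁
      0<L = n≢0⇒n>0 λ L≡0 → <⇒≢ 0<d (sym (trans (sym g*L≡d) (trans (cong (g *_) L≡0) (*-zeroʳ g))))

      d₁∣a-a₀ : d₁ ∣ ∣ a - a₀ ∣
      d₁∣a-a₀ = gcd[m,n]∣n d _

      -- As d ∣ a² - a₀², it divides both (a + a₀) d and (a + a₀) ∣a - a₀∣, hence their gcd (a + a₀)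
      -- d₁; then cancel d₁ from d = c d₁.
      c∣a+a₀ : c ∣ a + a₀
      c∣a+a₀ = *-cancelʳ-∣ d₁ {{>-nonZero 0<d₁}} (subst₂ _∣_ (sym c*d₁≡d) eq
        (gcd-greatest (n∣m*n (a + a₀)) (subst (d ∣_) (trans (∣²-²∣ a a₀) (*-comm _ (a + a₀))) d∣a²-a₀²)))
        where
        eq : gcd ((a + a₀) * d) ((a + a₀) * ∣ a - a₀ ∣) ≡ (a + a₀) * d₁
        eq = sym (c*gcd[m,n]≡gcd[cm,cn] (a + a₀) d _)
        d∣a²-a₀² : d ∣ ∣ a * a - a₀ * a₀ ∣
        d∣a²-a₀² = subst (d ∣_) (trans (cong₂ ∣_-_∣ (+-comm (a * a) u) (+-comm (a₀ * a₀) u)) (∣m+n-m+o∣≡∣n-o∣ u _ _))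
          (∣-∣-trans-∣ (a * a + u) v (a₀ * a₀ + u) d∣n (∣-∣-sym-∣ (a₀ * a₀ + u) v d∣n₀))

      -- g divides a - a₀ and a + a₀, hence 2a₀ and 2a₀². It also divides d, hence 2 (a₀² + u - v),
      -- and so it divides 2 (u - v), which is not 0.
      g≤2D : g ≤ 2 * D
      g≤2D = ∣⇒≤ {{>-nonZero (*-mono-≤ (s≤s (z≤n {1})) 0<D)}}
        (subst (g ∣_) (sym (*-distribˡ-∣-∣ 2 u v)) (∣-∣-trans-∣ (2 * u) (2 * (a₀ * a₀ + u)) (2 * v)
          (∣-∣-sym-∣ (2 * (a₀ * a₀ + u)) (2 * u) (subst (g ∣_) (sym eq₁) (∣m⇒∣m*n a₀ g∣2a₀)))
          (subst (g ∣_) (*-distribˡ-∣-∣ 2 (a₀ * a₀ + u) v) (∣n⇒∣m*n 2 (∣-trans g∣d d∣n₀)))))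
        where
        g∣d : g ∣ d
        g∣d = ∣-trans (gcd[m,n]∣m d₁ c) (gcd[m,n]∣m d _)
        g∣2a₀ : g ∣ a₀ + a₀
        g∣2a₀ = subst (g ∣_) (∣-∣-identityʳ (a₀ + a₀)) (∣-∣-trans-∣ (a₀ + a₀) (a₀ + a) 0
          (subst (g ∣_) (trans (∣-∣-comm a a₀) (sym (∣m+n-m+o∣≡∣n-o∣ a₀ a₀ a)))
            (∣-trans (gcd[m,n]∣m d₁ c) d₁∣a-a₀))
          (subst (g ∣_) (trans (+-comm a a₀) (sym (∣-∣-identityʳ (a₀ + a))))
            (∣-trans (gcd[m,n]∣n d₁ c) c∣a+a₀)))
        eq₁ : ∣ 2 * (a₀ * a₀ + u) - 2 * u ∣ ≡ (a₀ + a₀) * a₀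
        eq₁ = trans (cong (∣_- 2 * u ∣) (expand a₀ u))
          (trans (∣-∣-comm (2 * u + (a₀ + a₀) * a₀) (2 * u)) (∣m-m+n∣≡n (2 * u) _))
          where
          expand : ∀ a u → 2 * (a * a + u) ≡ 2 * u + (a + a) * a
          expand = solve-∀

      ÷L-≤ : ∀ {N} → a ≤ N → a ÷ L d₁ ≤ N * (2 * D) ÷ d
      ÷L-≤ {N} a≤N = ≤-÷ 0<d (begin
        a ÷ L d₁ * d           ≡⟨ cong (a ÷ L d₁ *_) (trans (sym g*L≡d) (*-comm g (L d₁))) ⟩
        a ÷ L d₁ * (L d₁ * g)  ≡⟨ *-assoc (a ÷ L d₁) (L d₁) g ⟨
        a ÷ L d₁ * L d₁ * g    ≤⟨ *-mono-≤ (≤-trans (÷-*-≤ a (L d₁)) a≤N) g≤2D ⟩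
        N * (2 * D)            ∎)
        where open ≤-Reasoning

    -- Every root with this d₁ is a₀ modulo d₁ and -a₀ modulo c. Its residue modulo the lcm is thus
    -- fixed, and the quotient by the lcm determines the rest.
    code-injective : ∀ {a a′} → d ∣ ∣ a * a + u - v ∣ → d ∣ ∣ a′ * a′ + u - v ∣ →
      δ a ≡ δ a′ → a ÷ L (δ a) ≡ a′ ÷ L (δ a′) → a ≡ a′
    code-injective {a} {a′} d∣n d∣n′ δ≡ ÷≡ = ÷-injective-mod (0<L a d∣n) a a′
      (lcm-least
        (∣-∣-trans-∣ a a₀ a′ (d₁∣a-a₀ a d∣n)
          (∣-∣-sym-∣ a′ a₀ (subst (_∣ ∣ a′ - a₀ ∣) (sym δ≡) (d₁∣a-a₀ a′ d∣n′))))
        (subst (d ÷ δ a ∣_) (trans (cong₂ ∣_-_∣ (+-comm a a₀) (+-comm a′ a₀)) (∣m+n-m+o∣≡∣n-o∣ a₀ a a′))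
          (∣-∣-trans-∣ (a + a₀) 0 (a′ + a₀)
            (subst (d ÷ δ a ∣_) (sym (∣-∣-identityʳ (a + a₀))) (c∣a+a₀ a d∣n))
            (subst (λ e → d ÷ e ∣ a′ + a₀) (sym δ≡) (c∣a+a₀ a′ d∣n′)))))
      (trans ÷≡ (cong (λ e → a′ ÷ L e) (sym δ≡)))

    length-roots-≤′ : ∀ N → length (roots u v d N) ≤ τ 1 d * suc (N * (2 * D) ÷ d)
    length-roots-≤′ N = begin
      length rs
        ≡⟨ length≡∑ rs ⟩
      ∑ rs (λ _ → 1)
        ≤⟨ ∑-embed (λ a → δ a , a ÷ L (δ a)) (Unique.filter⁺ root? (range-unique N))
             (λ {a} a∈ → let a∈N , d∣n = ∈-filter⁻ root? {xs = range N} a∈ in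
               ∈-cartesianProduct⁺ (∈-divisors⁺ 0<d (gcd[m,n]∣m d _))
                 (∈-interval⁺ (÷L-≤ a d∣n (proj₂ (∈-range⁻ N a∈N)))) , ≤-refl)
             (λ a∈ a′∈ eq → code-injective
               (proj₂ (∈-filter⁻ root? {xs = range N} a∈)) (proj₂ (∈-filter⁻ root? {xs = range N} a′∈))
               (cong proj₁ eq) (cong proj₂ eq)) ⟩
      ∑ (cartesianProduct (divisors d) (interval Q)) (λ _ → 1)
        ≡⟨ ∑-cartesianProduct-* (divisors d) (interval Q) (λ _ → 1) (λ _ → 1) ⟩
      τ 1 d * ∑ (interval Q) (λ _ → 1)
        ≡⟨ cong (τ 1 d *_) (trans (sym (length≡∑ (interval Q))) (cong suc (length-range Q))) ⟩
      τ 1 d * suc Q ∎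
      where
      open ≤-Reasoning
      rs = roots u v d N
      Q = N * (2 * D) ÷ d
      root? = λ a → d ∣? ∣ a * a + u - v ∣

  length-roots-≤ : ∀ {u v d} → 0 < d → u ≢ v → ∀ N →
    length (roots u v d N) ≤ τ 1 d * suc (N * (2 * ∣ u - v ∣) ÷ d)
  length-roots-≤ {u} {v} {d} 0<d u≢v N with roots u v d N in eq
  ... | []     = z≤n
  ... | a₀ ∷ _ = subst (λ rs → length rs ≤ τ 1 d * suc (N * (2 * ∣ u - v ∣) ÷ d)) eq
    (length-roots-≤′ 0<d u≢v a₀
      (proj₂ (∈-filter⁻ (λ a → d ∣? ∣ a * a + u - v ∣) {xs = range N} (subst (a₀ ∈_) (sym eq) (here refl)))) N)

  -- Second moments of the divisor function and the counting bound

  -- ∣a² - h∣ for the signed shift h = v - u. Later u is H and v runs from 0 to 2H, so that h runs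
  -- from -H to H.
  value : ℕ → ℕ → ℕ → ℕ
  value u v a = ∣ a * a + u - v ∣

  value-≤ : ∀ u v a → value u v a ≤ a * a + ∣ u - v ∣
  value-≤ u v a = ≤-trans (∣-∣-triangle (a * a + u) u v)
    (+-monoˡ-≤ ∣ u - v ∣ (≤-reflexive (trans (∣-∣-comm (a * a + u) u)
      (trans (cong (∣ u -_∣) (+-comm (a * a) u)) (∣m-m+n∣≡n u (a * a))))))

  *-cancel-square-≤ : ∀ {a b} → a * a ≤ b * b → a ≤ b
  *-cancel-square-≤ {a} {b} a²≤b² with a ≤? b
  ... | yes a≤b = a≤b
  ... | no  a≰b = contradiction a²≤b² (<⇒≱ (*-mono-< (≰⇒> a≰b) (≰⇒> a≰b)))

  module _ (u v : ℕ) (u≢v : u ≢ v) (N : ℕ) where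

    private
      D R M : ℕ
      D = ∣ u - v ∣
      R = N + D
      -- R bounds the square root of every value, as N² + D ≤ (N + D)². Adding R to 2DN makes room
      -- for the summand 1 of the root count.
      M = N * (2 * D) + R

      0<D : 0 < D
      0<D = n≢0⇒n>0 λ D≡0 → u≢v (∣m-n∣≡0⇒m≡n D≡0)

      τ₂²-value-≤ : ∀ {a} → a ≤ N →
        τ 1 (value u v a) * τ 1 (value u v a) ≤ 9 * ∑ (filter (_∣? value u v a) (range R)) (τ 6)
      τ₂²-value-≤ {a} a≤N with value u v a in eq
      -- `divisors 0` is empty, so an a with a² = h contributes nothing.
      ... | zero      = z≤n
      ... | n@(suc _) = ≤-trans (τ₂²-≤ {n} z<s) (*-monoʳ-≤ 9 (∑-⊆ (τ 6)
          (Unique.filter⁺ (λ d → d * d ≤? n) (divisors-unique n)) λ {d} d∈ →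
            let d∈′ , d²≤n = ∈-filter⁻ (λ d → d * d ≤? n) {xs = divisors n} d∈
                d∣n , 0<d , _ = ∈-divisors⁻ n d∈′
            in ∈-filter⁺ (_∣? n) (∈-range⁺ R 0<d (*-cancel-square-≤ (≤-trans d²≤n n≤R²))) d∣n))
        where
        open ≤-Reasoning
        expand : ∀ N D → (N + D) * (N + D) ≡ N * N + D * D + 2 * N * D
        expand = solve-∀
        n≤R² : n ≤ R * R
        n≤R² = begin
          n                          ≡⟨ eq ⟨
          value u v a                ≤⟨ value-≤ u v a ⟩
          a * a + D                  ≤⟨ +-mono-≤ (*-mono-≤ a≤N a≤N) (m≤m*n D D {{>-nonZero 0<D}}) ⟩
          N * N + D * D              ≤⟨ m≤m+n _ (2 * N * D) ⟩
          N * N + D * D + 2 * N * D  ≡⟨ expand N D ⟨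
          R * R                      ∎

      -- The cutoff at √n pays off here: d ≤ R gives (q + 1) d ≤ M, so the root count is at most
      -- τ(d) (M ÷ d) with no additive term left.
      weight-≤ : ∀ {d} → d ∈ range R →
        τ 6 d * length (roots u v d N) ≤ (M ÷ d) * τ 13 d
      weight-≤ {d} d∈ with 0<d , d≤R ← ∈-range⁻ R d∈ = begin
        τ 6 d * length (roots u v d N)     ≤⟨ *-monoʳ-≤ (τ 6 d) (length-roots-≤ 0<d u≢v N) ⟩
        τ 6 d * (τ 1 d * suc q)            ≡⟨ *-assoc (τ 6 d) (τ 1 d) (suc q) ⟨
        τ 6 d * τ 1 d * suc q              ≤⟨ *-mono-≤ (τ-*-τ₂ 6 0<d) (≤-÷ 0<d q-≤) ⟩
        τ 13 d * (M ÷ d)                   ≡⟨ *-comm (τ 13 d) (M ÷ d) ⟩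
        (M ÷ d) * τ 13 d                   ∎
        where
        open ≤-Reasoning
        q = N * (2 * D) ÷ d
        q-≤ : suc q * d ≤ M
        q-≤ = begin
          d + q * d             ≤⟨ +-mono-≤ d≤R (÷-*-≤ (N * (2 * D)) d) ⟩
          R + N * (2 * D)       ≡⟨ +-comm R _ ⟩
          M                     ∎

    ∑-τ₂²-value-≤ : ∀ K → M < 2 ^ K →
      ∑ (range N) (λ a → τ 1 (value u v a) * τ 1 (value u v a)) ≤ 9 * (M * K ^ 14)
    ∑-τ₂²-value-≤ K M<2^K = begin
      ∑ (range N) (λ a → τ 1 (value u v a) * τ 1 (value u v a))
        ≤⟨ ∑-mono (range N) (λ {a} a∈ → τ₂²-value-≤ {a} (proj₂ (∈-range⁻ N a∈))) ⟩
      ∑ (range N) (λ a → 9 * ∑ (filter (_∣? value u v a) (range R)) (τ 6))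
        ≡⟨ ∑-*ˡ (range N) _ 9 ⟩
      9 * ∑ (range N) (λ a → ∑ (filter (_∣? value u v a) (range R)) (τ 6))
        ≡⟨ cong (9 *_) (∑-swap-filter (λ a d → d ∣? value u v a) (range N) (range R) (λ _ → τ 6)) ⟩
      9 * ∑ (range R) (λ d → ∑ (roots u v d N) (λ _ → τ 6 d))
        ≡⟨ cong (9 *_) (∑-cong (range R) (λ {d} _ → trans (∑-const (roots u v d N) (τ 6 d)) (*-comm _ (τ 6 d)))) ⟩
      9 * ∑ (range R) (λ d → τ 6 d * length (roots u v d N))
        ≤⟨ *-monoʳ-≤ 9 (∑-mono (range R) weight-≤) ⟩
      9 * ∑ (range R) (λ d → (M ÷ d) * τ 13 d)
        ≤⟨ *-monoʳ-≤ 9 (∑-⊆ _ (range-unique R) λ d∈ →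
             ∈-range⁺ M (proj₁ (∈-range⁻ R d∈)) (≤-trans (proj₂ (∈-range⁻ R d∈)) (m≤n+m R (N * (2 * D))))) ⟩
      9 * ∑ (range M) (λ d → (M ÷ d) * τ 13 d)
        ≤⟨ *-monoʳ-≤ 9 (∑-÷-τ-≤ 13 K M M<2^K) ⟩
      9 * (M * K ^ 14) ∎
      where open ≤-Reasoning

  ^-distribʳ-* : ∀ m n k → (m * n) ^ k ≡ m ^ k * n ^ k
  ^-distribʳ-* m n zero    = refl
  ^-distribʳ-* m n (suc k) =
    trans (cong (m * n *_) (^-distribʳ-* m n k)) (interchange m n (m ^ k) (n ^ k))
    where
    interchange : ∀ a b c d → a * b * (c * d) ≡ a * c * (b * d)
    interchange = solve-∀

  n<2^n : ∀ n → n < 2 ^ n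
  n<2^n zero    = z<s
  n<2^n (suc n) = begin
    2 + n              ≤⟨ +-mono-≤ (m^n>0 2 n) (n<2^n n) ⟩
    2 ^ n + 2 ^ n      ≡⟨ cong (2 ^ n +_) (+-identityʳ (2 ^ n)) ⟨
    2 ^ suc n          ∎
    where open ≤-Reasoning

  -- The two cases are h = 0 and h ≠ 0. The first yields K ^ 15; the second yields K ^ 14 and is
  -- padded by one factor K. In the second, M ≤ N E with E = 3D + 1 < 2ᴱ, so the exponent grows from
  -- K to K + E, which is at most (E + 1) K.
  secondMoment : ∀ u v → ∃[ C ] ∀ N K → 0 < N → N < 2 ^ K →
    ∑ (range N) (λ a → τ 1 (value u v a) * τ 1 (value u v a)) ≤ C * (N * K ^ 15)
  secondMoment u v with u ≟ v
  ... | yes refl = 1 , λ N K 0<N N<2^K → begin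
    ∑ (range N) (λ a → τ 1 (value u u a) * τ 1 (value u u a))
      ≡⟨ ∑-cong (range N) (λ {a} _ → cong (λ n → τ 1 n * τ 1 n) (value≡ a)) ⟩
    ∑ (range N) (λ a → τ 1 (a * a) * τ 1 (a * a))
      ≤⟨ ∑-mono (range N) (λ {a} a∈ → let 0<a = proj₁ (∈-range⁻ N a∈) in
           ≤-trans (*-mono-≤ (τ₂-square-≤ 0<a) (τ₂-square-≤ 0<a)) (τ₂⁴-≤ 0<a)) ⟩
    ∑ (range N) (τ 15)
      ≤⟨ ∑-τ-≤ 14 K N<2^K ⟩
    N * K ^ 15
      ≡⟨ *-identityˡ (N * K ^ 15) ⟨
    1 * (N * K ^ 15) ∎
    where
    open ≤-Reasoning
    value≡ : ∀ a → value u u a ≡ a * a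
    value≡ a = trans (∣-∣-comm (a * a + u) u)
      (trans (cong (∣ u -_∣) (+-comm (a * a) u)) (∣m-m+n∣≡n u (a * a)))
  ... | no u≢v = 9 * (E * suc E ^ 14) , λ N K 0<N N<2^K →
    let 0<K = n≢0⇒n>0 λ { refl → <⇒≱ N<2^K 0<N }
    in begin
    ∑ (range N) (λ a → τ 1 (value u v a) * τ 1 (value u v a))
      ≤⟨ ∑-τ₂²-value-≤ u v u≢v N (K + E) (M<2^K+E N K 0<N N<2^K) ⟩
    9 * ((N * (2 * D) + (N + D)) * (K + E) ^ 14)
      ≤⟨ *-monoʳ-≤ 9 (*-mono-≤ (M≤NE N 0<N) (^-monoˡ-≤ 14 (K+E≤ K 0<K))) ⟩
    9 * (N * E * (suc E * K) ^ 14)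
      ≡⟨ cong (λ i → 9 * (N * E * i)) (^-distribʳ-* (suc E) K 14) ⟩
    9 * (N * E * (suc E ^ 14 * K ^ 14))
      ≡⟨ rearrange N E (suc E ^ 14) (K ^ 14) ⟩
    9 * (E * suc E ^ 14) * (N * K ^ 14)
      ≤⟨ *-monoʳ-≤ (9 * (E * suc E ^ 14)) (*-monoʳ-≤ N (m≤n*m (K ^ 14) K {{>-nonZero 0<K}})) ⟩
    9 * (E * suc E ^ 14) * (N * K ^ 15) ∎
    where
    open ≤-Reasoning
    D = ∣ u - v ∣
    E = 2 * D + 1 + D
    rearrange : ∀ n e a k → 9 * (n * e * (a * k)) ≡ 9 * (e * a) * (n * k)
    rearrange = solve-∀
    M≤NE : ∀ N → 0 < N → N * (2 * D) + (N + D) ≤ N * E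
    M≤NE N 0<N = begin
      N * (2 * D) + (N + D)      ≤⟨ +-monoʳ-≤ (N * (2 * D)) (+-monoʳ-≤ N (m≤n*m D N {{>-nonZero 0<N}})) ⟩
      N * (2 * D) + (N + N * D)  ≡⟨ eq N D ⟩
      N * E                      ∎
      where
      eq : ∀ n d → n * (2 * d) + (n + n * d) ≡ n * (2 * d + 1 + d)
      eq = solve-∀
    M<2^K+E : ∀ N K → 0 < N → N < 2 ^ K → N * (2 * D) + (N + D) < 2 ^ (K + E)
    M<2^K+E N K 0<N N<2^K = begin-strict
      N * (2 * D) + (N + D)      ≤⟨ M≤NE N 0<N ⟩
      N * E                      <⟨ *-mono-< N<2^K (n<2^n E) ⟩
      2 ^ K * 2 ^ E              ≡⟨ ^-distribˡ-+-* 2 K E ⟨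
      2 ^ (K + E)                ∎
    K+E≤ : ∀ K → 0 < K → K + E ≤ suc E * K
    K+E≤ K 0<K = +-monoʳ-≤ K (m≤m*n E K {{>-nonZero 0<K}})

  -- Cauchy-Schwarz with a factor 2 lost by using ab ≤ a² + b², which avoids halving in ℕ.
  ∑-square-≤ : ∀ (xs : List A) f → ∑ xs f * ∑ xs f ≤ 2 * length xs * ∑ xs (λ x → f x * f x)
  ∑-square-≤ xs f = begin
    ∑ xs f * ∑ xs f
      ≡⟨ ∑-*ʳ xs f (∑ xs f) ⟨
    ∑ xs (λ x → f x * ∑ xs f)
      ≡⟨ ∑-cong xs (λ {x} _ → ∑-*ˡ xs f (f x)) ⟨
    ∑ xs (λ x → ∑ xs (λ y → f x * f y))
      ≤⟨ ∑-mono xs (λ {x} _ → ∑-mono xs (λ {y} _ → product-≤ (f x) (f y))) ⟩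
    ∑ xs (λ x → ∑ xs (λ y → f x * f x + f y * f y))
      ≡⟨ ∑-cong xs (λ {x} _ → trans (∑-distrib-+ xs _ _) (cong (_+ Q) (∑-const xs (f x * f x)))) ⟩
    ∑ xs (λ x → n * (f x * f x) + Q)
      ≡⟨ trans (∑-distrib-+ xs _ _) (cong₂ _+_ (∑-*ˡ xs _ n) (∑-const xs Q)) ⟩
    n * Q + n * Q
      ≡⟨ double n Q ⟩
    2 * n * Q ∎
    where
    open ≤-Reasoning
    n = length xs
    Q = ∑ xs (λ x → f x * f x)
    double : ∀ n q → n * q + n * q ≡ 2 * n * q
    double = solve-∀
    product-≤ : ∀ a b → a * b ≤ a * a + b * b
    product-≤ a b with ≤-total a b
    ... | inj₁ a≤b = ≤-trans (*-monoˡ-≤ b a≤b) (m≤n+m (b * b) (a * a))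
    ... | inj₂ b≤a = ≤-trans (*-monoʳ-≤ a b≤a) (m≤m+n (a * a) (b * b))

  pairs : List A → (A → List B) → List (A × B)
  pairs []       ys = []
  pairs (x ∷ xs) ys = map (x ,_) (ys x) ++ pairs xs ys

  ∈-pairs⁺ : ∀ {xs : List A} {ys : A → List B} {x y} → x ∈ xs → y ∈ ys x → (x , y) ∈ pairs xs ys
  ∈-pairs⁺ (here refl) y∈ = ∈-++⁺ˡ (∈-map⁺ (_ ,_) y∈)
  ∈-pairs⁺ {xs = x ∷ _} {ys} (there x∈) y∈ = ∈-++⁺ʳ (map (x ,_) (ys x)) (∈-pairs⁺ x∈ y∈)

  length-pairs : ∀ (xs : List A) (ys : A → List B) → length (pairs xs ys) ≡ ∑ xs (λ x → length (ys x))
  length-pairs []       ys = refl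
  length-pairs (x ∷ xs) ys = trans (length-++ (map (x ,_) (ys x)))
    (cong₂ _+_ (length-map (x ,_) (ys x)) (length-pairs xs ys))

  -- a² + b² differs from d² by i - H; the pair (i , d + b) encodes b.
  record PartnerCode (H a b : ℕ) (code : ℕ × ℕ) : Set where
    constructor mkPartnerCode
    field
      d        : ℕ
      small    : proj₁ code ≤ H + H
      distinct : d ≢ b
      sum      : d + b ≡ proj₂ code
      relation : a * a + b * b + H ≡ d * d + proj₁ code

  Partner : (H a b : ℕ) → Set
  Partner H a b = ∃[ p ] PartnerCode H a b p

  -- The code fixes d + b and, together with a, d² - b². If b grows by e, the fixed sum makes d
  -- shrink by e, so d² - b² strictly decreases unless e = 0.
  partnerCode-injective : ∀ {H a b b′ is} → PartnerCode H a b is → PartnerCode H a b′ is → b ≡ b′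
  partnerCode-injective {H} {a} {b} {b′} {i , s}
    (mkPartnerCode d _ _ s≡ eq) (mkPartnerCode d′ _ _ s≡′ eq′) =
    wlog (≤-total b b′)
    where
    open ≡-Reasoning
    ordered : ∀ b b′ d d′ → b ≤ b′ → d + b ≡ d′ + b′ → b * b + d′ * d′ ≡ b′ * b′ + d * d → b ≡ b′
    ordered b b′ d d′ b≤b′ s≡ sq with e , refl ← m≤n⇒∃[o]m+o≡n b≤b′ =
      sym (trans (cong (b +_) (e≡0 e rest≡0)) (+-identityʳ b))
      where
      d≡ : d ≡ d′ + e
      d≡ = +-cancelʳ-≡ b d (d′ + e) (trans s≡ (eq₁ d′ b e))
        where
        eq₁ : ∀ d b e → d + (b + e) ≡ d + e + b
        eq₁ = solve-∀
      rest = 2 * b * e + 2 * d′ * e + e * e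
      rest≡0 : rest + e * e ≡ 0
      rest≡0 = sym (+-cancelˡ-≡ (b * b + d′ * d′) 0 (rest + e * e) (begin
        b * b + d′ * d′ + 0                       ≡⟨ +-identityʳ _ ⟩
        b * b + d′ * d′                           ≡⟨ sq ⟩
        (b + e) * (b + e) + d * d                 ≡⟨ cong (λ d → (b + e) * (b + e) + d * d) d≡ ⟩
        (b + e) * (b + e) + (d′ + e) * (d′ + e)   ≡⟨ expand b d′ e ⟩
        b * b + d′ * d′ + (rest + e * e)          ∎))
        where
        expand : ∀ b d e → (b + e) * (b + e) + (d + e) * (d + e) ≡
          b * b + d * d + (2 * b * e + 2 * d * e + e * e + e * e)
        expand = solve-∀
      e≡0 : ∀ e {r} → r + e * e ≡ 0 → e ≡ 0
      e≡0 zero    _ = refl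
      e≡0 (suc e) {r} p = contradiction (m+n≡0⇒n≡0 r p) λ ()
    squares : b * b + d′ * d′ ≡ b′ * b′ + d * d
    squares = +-cancelˡ-≡ (a * a + H + i) _ _ (begin
      a * a + H + i + (b * b + d′ * d′)         ≡⟨ eq₁ (a * a) H i (b * b) (d′ * d′) ⟩
      a * a + b * b + H + (d′ * d′ + i)         ≡⟨ cong₂ _+_ eq (sym eq′) ⟩
      d * d + i + (a * a + b′ * b′ + H)         ≡⟨ eq₂ (a * a) H i (b′ * b′) (d * d) ⟩
      a * a + H + i + (b′ * b′ + d * d)         ∎)
      where
      eq₁ : ∀ a h i b d → a + h + i + (b + d) ≡ a + b + h + (d + i)
      eq₁ = solve-∀
      eq₂ : ∀ a h i b d → d + i + (a + b + h) ≡ a + h + i + (b + d)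
      eq₂ = solve-∀
    wlog : b ≤ b′ ⊎ b′ ≤ b → b ≡ b′
    wlog (inj₁ b≤b′) = ordered b b′ d d′ b≤b′ (trans s≡ (sym s≡′)) squares
    wlog (inj₂ b′≤b) = sym (ordered b′ b d′ d b′≤b (trans s≡′ (sym s≡)) (sym squares))

  partnerCodes : (H a : ℕ) → List (ℕ × ℕ)
  partnerCodes H a = pairs (interval (H + H)) (λ i → divisors (value H i a))

  ∈-partnerCodes : ∀ {H a b is} → PartnerCode H a b is → is ∈ partnerCodes H a
  ∈-partnerCodes {H} {a} {b} {i , s} (mkPartnerCode d i≤2H d≢b refl eq) =
    ∈-pairs⁺ (∈-interval⁺ i≤2H) (∈-divisors⁺ 0<value (subst (s ∣_) (sym value≡) (n∣m*n ∣ d - b ∣)))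
    where
    open ≡-Reasoning
    value≡ : value H i a ≡ ∣ d - b ∣ * (d + b)
    value≡ = begin
      ∣ a * a + H - i ∣                          ≡⟨ ∣m+n-m+o∣≡∣n-o∣ (b * b) (a * a + H) i ⟨
      ∣ b * b + (a * a + H) - b * b + i ∣        ≡⟨ cong₂ ∣_-_∣ (trans (eq₁ (a * a) (b * b) H) (trans eq (+-comm (d * d) i))) (+-comm (b * b) i) ⟩
      ∣ i + d * d - i + b * b ∣                  ≡⟨ ∣m+n-m+o∣≡∣n-o∣ i (d * d) (b * b) ⟩
      ∣ d * d - b * b ∣                          ≡⟨ ∣²-²∣ d b ⟩
      ∣ d - b ∣ * (d + b)                        ∎
      where
      eq₁ : ∀ a b h → b + (a + h) ≡ a + b + h
      eq₁ = solve-∀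
    -- Essential because `divisors 0` is empty: a vanishing value would offer no codes. It is
    -- positive since d ≠ b.
    0<value : 0 < value H i a
    0<value = subst (0 <_) (sym value≡) (*-mono-≤ (n≢0⇒n>0 λ e → d≢b (∣m-n∣≡0⇒m≡n e))
      (n≢0⇒n>0 λ e → d≢b (trans (m+n≡0⇒m≡0 d e) (sym (m+n≡0⇒n≡0 d e)))))

  length-partnerCodes : ∀ H a → length (partnerCodes H a) ≡ ∑ (interval (H + H)) (λ i → τ 1 (value H i a))
  length-partnerCodes H a = trans (length-pairs (interval (H + H)) (λ i → divisors (value H i a)))
    (∑-cong (interval (H + H)) (λ {i} _ → length≡∑ (divisors (value H i a))))

  -- R links an element to its roots (a, b, c). It is a relation because one floor may come from
  -- several roots; only the roots must determine the element. A fixed a admits at most (∑ τ(∣a² -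
  -- h∣))² pairs of codes, the sum running over ∣h∣ ≤ H, and `∑-square-≤` over the shifts h reduces
  -- this to the second moments.
  partnered-≤ : ∀ H → ∃[ C ] ∀ N K → 0 < N → N < 2 ^ K →
    (R : A → ℕ × ℕ × ℕ → Set) → (∀ {x y t} → R x t → R y t → x ≡ y) →
    ∀ xs → Unique xs →
    All (λ x → ∃[ a ] ∃[ b ] ∃[ c ] (R x (a , b , c) × 0 < a × a ≤ N × Partner H a b × Partner H a c)) xs →
    length xs ≤ C * (N * K ^ 15)
  partnered-≤ {A} H = 2 * length I * C′ , bound
    where
    I : List ℕ
    I = interval (H + H)
    cst : ℕ → ℕ
    cst i = proj₁ (secondMoment H i)
    C′ : ℕ
    C′ = ∑ I cst
    bound : ∀ N K → 0 < N → N < 2 ^ K →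
      (R : A → ℕ × ℕ × ℕ → Set) → (∀ {x y t} → R x t → R y t → x ≡ y) →
      ∀ xs → Unique xs →
      All (λ x → ∃[ a ] ∃[ b ] ∃[ c ] (R x (a , b , c) × 0 < a × a ≤ N × Partner H a b × Partner H a c)) xs →
      length xs ≤ 2 * length I * C′ * (N * K ^ 15)
    bound N K 0<N N<2^K R R-injective xs xs-unique partnered = begin
      length xs
        ≡⟨ length≡∑ xs ⟩
      ∑ xs (λ _ → 1)
        ≤⟨ ∑-matching Code xs-unique
             (λ x∈ → let a , b , c , r , 0<a , a≤N , (p , pc) , (q , qc) = All.lookup partnered x∈ in
               (a , p , q) ,
               ∈-pairs⁺ (∈-range⁺ N 0<a a≤N) (∈-cartesianProduct⁺ (∈-partnerCodes pc) (∈-partnerCodes qc)) ,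
               (b , c , r , pc , qc) , ≤-refl)
             (λ { _ _ (b , c , r , pc , qc) (b′ , c′ , r′ , pc′ , qc′) →
               R-injective r (subst₂ (λ b c → R _ (_ , b , c))
                 (sym (partnerCode-injective pc pc′)) (sym (partnerCode-injective qc qc′)) r′) }) ⟩
      ∑ (pairs (range N) codes) (λ _ → 1)
        ≡⟨ trans (sym (length≡∑ (pairs (range N) codes))) (length-pairs (range N) codes) ⟩
      ∑ (range N) (λ a → length (codes a))
        ≡⟨ ∑-cong (range N) (λ {a} _ → trans (length≡∑ (codes a))
             (∑-cartesianProduct-* (partnerCodes H a) (partnerCodes H a) (λ _ → 1) (λ _ → 1))) ⟩
      ∑ (range N) (λ a → ∑ (partnerCodes H a) (λ _ → 1) * ∑ (partnerCodes H a) (λ _ → 1))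
        ≡⟨ ∑-cong (range N) (λ {a} _ → cong (λ n → n * n)
             (trans (sym (length≡∑ (partnerCodes H a))) (length-partnerCodes H a))) ⟩
      ∑ (range N) (λ a → ∑ I (t a) * ∑ I (t a))
        ≤⟨ ∑-mono (range N) (λ {a} _ → ∑-square-≤ I (t a)) ⟩
      ∑ (range N) (λ a → 2 * length I * ∑ I (λ i → t a i * t a i))
        ≡⟨ ∑-*ˡ (range N) _ (2 * length I) ⟩
      2 * length I * ∑ (range N) (λ a → ∑ I (λ i → t a i * t a i))
        ≡⟨ cong (2 * length I *_) (∑-swap (range N) I (λ a i → t a i * t a i)) ⟩
      2 * length I * ∑ I (λ i → ∑ (range N) (λ a → t a i * t a i))
        ≤⟨ *-monoʳ-≤ (2 * length I) (∑-mono I (λ {i} _ → proj₂ (secondMoment H i) N K 0<N N<2^K)) ⟩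
      2 * length I * ∑ I (λ i → cst i * (N * K ^ 15))
        ≡⟨ cong (2 * length I *_) (∑-*ʳ I cst (N * K ^ 15)) ⟩
      2 * length I * (C′ * (N * K ^ 15))
        ≡⟨ *-assoc (2 * length I) C′ _ ⟨
      2 * length I * C′ * (N * K ^ 15) ∎
      where
      open ≤-Reasoning
      Code : A → ℕ × (ℕ × ℕ) × (ℕ × ℕ) → Set
      Code x (a , p , q) = ∃[ b ] ∃[ c ] (R x (a , b , c) × PartnerCode H a b p × PartnerCode H a c q)
      codes : ℕ → List ((ℕ × ℕ) × (ℕ × ℕ))
      codes a = cartesianProduct (partnerCodes H a) (partnerCodes H a)
      t : ℕ → ℕ → ℕ
      t a i = τ 1 (value H i a)

-- Rational arithmetic and a lower bound for the logarithm series

module RationalEstimates where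

  open import Data.Nat.Base as ℕ using (ℕ; zero; suc)
  import Data.Nat.Properties as ℕ
  open import Data.Rational.Base as ℚ using (ℚ; 0ℚ; 1ℚ; ½; _+_; _*_; _-_; -_; _≤_; _<_)
  import Data.Rational.Properties as ℚ
  open import Data.Rational.Solver
  open +-*-Solver using (solve; _:=_; _:+_; _:*_; _:-_; con)
  open import Defs using (module Rational)
  open Rational using (_^_; fromℕ; fromℕ-suc; fromℕ-mono; fromℕ-pos; recip; recip-inverse; recip-pos;
    recip-antimono; *-mono-≤; *-nonNeg; +-pos; *-pos; 0<1; 0<½; artanhSum; ratio; +-cancelʳ-≤; ≤-+ʳ)

  fromℕ-+ : ∀ m n → fromℕ (m ℕ.+ n) ≡ fromℕ m + fromℕ n
  fromℕ-+ zero    n = sym (ℚ.+-identityˡ (fromℕ n))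
  fromℕ-+ (suc m) n = begin
    fromℕ (suc (m ℕ.+ n))        ≡⟨ fromℕ-suc (m ℕ.+ n) ⟩
    fromℕ (m ℕ.+ n) + 1ℚ         ≡⟨ cong (_+ 1ℚ) (fromℕ-+ m n) ⟩
    fromℕ m + fromℕ n + 1ℚ       ≡⟨ swap (fromℕ m) (fromℕ n) ⟩
    fromℕ m + 1ℚ + fromℕ n       ≡⟨ cong (_+ fromℕ n) (fromℕ-suc m) ⟨
    fromℕ (suc m) + fromℕ n      ∎
    where
    open ≡-Reasoning
    swap : ∀ a b → a + b + 1ℚ ≡ a + 1ℚ + b
    swap = solve 2 (λ a b → a :+ b :+ con 1ℚ := a :+ con 1ℚ :+ b) refl

  fromℕ-* : ∀ m n → fromℕ (m ℕ.* n) ≡ fromℕ m * fromℕ n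
  fromℕ-* zero    n = sym (ℚ.*-zeroˡ (fromℕ n))
  fromℕ-* (suc m) n = begin
    fromℕ (n ℕ.+ m ℕ.* n)        ≡⟨ fromℕ-+ n (m ℕ.* n) ⟩
    fromℕ n + fromℕ (m ℕ.* n)    ≡⟨ cong (fromℕ n +_) (fromℕ-* m n) ⟩
    fromℕ n + fromℕ m * fromℕ n  ≡⟨ expand (fromℕ m) (fromℕ n) ⟩
    (fromℕ m + 1ℚ) * fromℕ n     ≡⟨ cong (_* fromℕ n) (fromℕ-suc m) ⟨
    fromℕ (suc m) * fromℕ n      ∎
    where
    open ≡-Reasoning
    expand : ∀ a b → b + a * b ≡ (a + 1ℚ) * b
    expand = solve 2 (λ a b → b :+ a :* b := (a :+ con 1ℚ) :* b) refl

  fromℕ-^ : ∀ m k → fromℕ (m ℕ.^ k) ≡ fromℕ m ^ k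
  fromℕ-^ m zero    = refl
  fromℕ-^ m (suc k) = trans (fromℕ-* m (m ℕ.^ k)) (cong (fromℕ m *_) (fromℕ-^ m k))

  fromℕ-cancel-< : ∀ {m n} → fromℕ m < fromℕ n → m ℕ.< n
  fromℕ-cancel-< {m} {n} m<n with m ℕ.<? n
  ... | yes p = p
  ... | no ¬p = contradiction (ℚ.<-≤-trans m<n (fromℕ-mono (ℕ.≮⇒≥ ¬p))) (ℚ.<-irrefl refl)

  fromℕ-cancel-≤ : ∀ {m n} → fromℕ m ≤ fromℕ n → m ℕ.≤ n
  fromℕ-cancel-≤ {m} {n} m≤n = ℕ.≤-pred (fromℕ-cancel-< (begin-strict
    fromℕ m          ≤⟨ m≤n ⟩
    fromℕ n          ≡⟨ ℚ.+-identityʳ (fromℕ n) ⟨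
    fromℕ n + 0ℚ     <⟨ ℚ.+-monoʳ-< (fromℕ n) 0<1 ⟩
    fromℕ n + 1ℚ     ≡⟨ fromℕ-suc n ⟨
    fromℕ (suc n)    ∎))
    where open ℚ.≤-Reasoning

  0≤fromℕ : ∀ n → 0ℚ ≤ fromℕ n
  0≤fromℕ n = fromℕ-mono {0} {n} ℕ.z≤n

  ^-nonNeg : ∀ {q} k → 0ℚ ≤ q → 0ℚ ≤ q ^ k
  ^-nonNeg zero    0≤q = ℚ.<⇒≤ 0<1
  ^-nonNeg (suc k) 0≤q = *-nonNeg 0≤q (^-nonNeg k 0≤q)

  ^-pos : ∀ {q} k → 0ℚ < q → 0ℚ < q ^ k
  ^-pos zero    0<q = 0<1
  ^-pos (suc k) 0<q = *-pos 0<q (^-pos k 0<q)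

  ^-mono-≤ : ∀ {p q} k → 0ℚ ≤ p → p ≤ q → p ^ k ≤ q ^ k
  ^-mono-≤ zero    0≤p p≤q = ℚ.≤-refl
  ^-mono-≤ (suc k) 0≤p p≤q = *-mono-≤ 0≤p p≤q (^-nonNeg k 0≤p) (^-mono-≤ k 0≤p p≤q)

  ^-distribʳ-* : ∀ p q k → (p * q) ^ k ≡ p ^ k * q ^ k
  ^-distribʳ-* p q zero    = refl
  ^-distribʳ-* p q (suc k) = trans (cong (p * q *_) (^-distribʳ-* p q k))
    (interchange p q (p ^ k) (q ^ k))
    where
    interchange : ∀ a b c d → a * b * (c * d) ≡ a * c * (b * d)
    interchange = solve 4 (λ a b c d → a :* b :* (c :* d) := a :* c :* (b :* d)) refl

  -- Bernoulli's inequality (1 - t)ᵏ ≥ 1 - k t, arranged without subtraction.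
  bernoulli : ∀ {q t} k → 0ℚ ≤ q → 0ℚ ≤ t → q + t ≡ 1ℚ → 1ℚ ≤ q ^ k + fromℕ k * t
  bernoulli {q} {t} zero 0≤q 0≤t q+t≡1 = ≤-+ʳ (*-nonNeg (0≤fromℕ 0) 0≤t)
  bernoulli {q} {t} (suc k) 0≤q 0≤t q+t≡1 = begin
    1ℚ                                    ≡⟨ trans (sym q+t≡1) (cong (_+ t) (sym (ℚ.*-identityʳ q))) ⟩
    q * 1ℚ + t                            ≤⟨ ℚ.+-monoˡ-≤ t (*-mono-≤ 0≤q ℚ.≤-refl (ℚ.<⇒≤ 0<1) (bernoulli k 0≤q 0≤t q+t≡1)) ⟩
    q * (q ^ k + fromℕ k * t) + t         ≡⟨ cong (_+ t) (ℚ.*-distribˡ-+ q (q ^ k) (fromℕ k * t)) ⟩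
    q ^ suc k + q * (fromℕ k * t) + t     ≤⟨ ℚ.+-monoˡ-≤ t (ℚ.+-monoʳ-≤ (q ^ suc k) (*-mono-≤ 0≤q q≤1 0≤kt ℚ.≤-refl)) ⟩
    q ^ suc k + 1ℚ * (fromℕ k * t) + t    ≡⟨ collect (q ^ suc k) (fromℕ k) t ⟩
    q ^ suc k + (fromℕ k + 1ℚ) * t        ≡⟨ cong (λ f → q ^ suc k + f * t) (fromℕ-suc k) ⟨
    q ^ suc k + fromℕ (suc k) * t         ∎
    where
    open ℚ.≤-Reasoning
    0≤kt : 0ℚ ≤ fromℕ k * t
    0≤kt = *-nonNeg (0≤fromℕ k) 0≤t
    q≤1 : q ≤ 1ℚ
    q≤1 = ℚ.≤-trans (≤-+ʳ 0≤t) (ℚ.≤-reflexive q+t≡1)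
    collect : ∀ a f t → a + 1ℚ * (f * t) + t ≡ a + (f + 1ℚ) * t
    collect = solve 3 (λ a f t → a :+ con 1ℚ :* (f :* t) :+ t := a :+ (f :+ con 1ℚ) :* t) refl

  artanhTerm : ℕ → ℚ → ℚ
  artanhTerm k q = q ^ suc (2 ℕ.* k) * recip (fromℕ (suc (2 ℕ.* k)))

  artanhSum-block : ∀ {q β m} c →
    (∀ {k} → k ℕ.< c ℕ.+ m → β ≤ artanhTerm k q) →
    fromℕ c * β + artanhSum m q ≤ artanhSum (c ℕ.+ m) q
  artanhSum-block {q} {β} {m} zero    β≤ =
    ℚ.≤-reflexive (trans (cong (_+ artanhSum m q) (ℚ.*-zeroˡ β)) (ℚ.+-identityˡ _))
  artanhSum-block {q} {β} {m} (suc c) β≤ = begin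
    fromℕ (suc c) * β + artanhSum m q        ≡⟨ cong (λ f → f * β + artanhSum m q) (fromℕ-suc c) ⟩
    (fromℕ c + 1ℚ) * β + artanhSum m q       ≡⟨ collect (fromℕ c) β (artanhSum m q) ⟩
    fromℕ c * β + artanhSum m q + β          ≤⟨ ℚ.+-mono-≤ (artanhSum-block c (λ k< → β≤ (ℕ.m<n⇒m<1+n k<))) (β≤ (ℕ.n<1+n _)) ⟩
    artanhSum (suc c ℕ.+ m) q                ∎
    where
    open ℚ.≤-Reasoning
    collect : ∀ f b a → (f + 1ℚ) * b + a ≡ f * b + a + b
    collect = solve 3 (λ f b a → (f :+ con 1ℚ) :* b :+ a := f :* b :+ a :+ b) refl

  artanhSum-mono : ∀ {q m n} → 0ℚ ≤ q → m ℕ.≤ n → artanhSum m q ≤ artanhSum n q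
  artanhSum-mono {q} {m} {n} 0≤q m≤n = begin
    artanhSum m q                            ≡⟨ ℚ.+-identityˡ _ ⟨
    0ℚ + artanhSum m q                       ≡⟨ cong (_+ artanhSum m q) (ℚ.*-zeroʳ (fromℕ (n ℕ.∸ m))) ⟨
    fromℕ (n ℕ.∸ m) * 0ℚ + artanhSum m q     ≤⟨ artanhSum-block (n ℕ.∸ m) (λ {k} _ →
                                                  *-nonNeg (^-nonNeg (suc (2 ℕ.* k)) 0≤q) (ℚ.<⇒≤ (recip-pos (fromℕ-pos (2 ℕ.* k))))) ⟩
    artanhSum (n ℕ.∸ m ℕ.+ m) q              ≡⟨ cong (λ i → artanhSum i q) (ℕ.m∸n+n≡m m≤n) ⟩
    artanhSum n q                            ∎
    where open ℚ.≤-Reasoning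

  -- Here y approximates a real x ≥ 2, for which 3/2 is a safe eventual lower bound. The artanh
  -- argument is q = 1 - t with t = 2 / (y + 1). Its powers stay above ½ for about y/4 steps, so up
  -- to there the series grows like the harmonic sum over odd denominators.
  module _ {y : ℚ} (3/2≤y : 1ℚ + ½ ≤ y) where

    private
      r t q : ℚ
      r = recip (y + 1ℚ)
      t = r + r
      q = ratio y

      0<y+1 : 0ℚ < y + 1ℚ
      0<y+1 = +-pos (ℚ.<-≤-trans (+-pos 0<1 0<½) 3/2≤y) 0<1

      0≤r : 0ℚ ≤ r
      0≤r = ℚ.<⇒≤ (recip-pos 0<y+1)

      q+t≡1 : q + t ≡ 1ℚ
      q+t≡1 = trans (eq y r) (recip-inverse 0<y+1)
        where
        eq : ∀ y r → (y - 1ℚ) * r + (r + r) ≡ (y + 1ℚ) * r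
        eq = solve 2 (λ y r → (y :- con 1ℚ) :* r :+ (r :+ r) := (y :+ con 1ℚ) :* r) refl

      ½≤y-1 : ½ ≤ y - 1ℚ
      ½≤y-1 = ℚ.+-monoˡ-≤ (- 1ℚ) 3/2≤y

    0≤ratio : 0ℚ ≤ q
    0≤ratio = *-nonNeg (ℚ.≤-trans (ℚ.<⇒≤ 0<½) ½≤y-1) 0≤r

    -- 1 = (y + 1) r ≤ 8 (y - 1) r.
    1≤8*ratio : 1ℚ ≤ fromℕ 8 * q
    1≤8*ratio = begin
      1ℚ                                   ≡⟨ recip-inverse 0<y+1 ⟨
      (y + 1ℚ) * r                         ≤⟨ *-mono-≤ (ℚ.<⇒≤ 0<y+1) y+1≤ 0≤r ℚ.≤-refl ⟩
      (fromℕ 8 * (y - 1ℚ)) * r             ≡⟨ ℚ.*-assoc (fromℕ 8) (y - 1ℚ) r ⟩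
      fromℕ 8 * q                          ∎
      where
      open ℚ.≤-Reasoning
      z = y - 1ℚ
      0≤z : 0ℚ ≤ z
      0≤z = ℚ.≤-trans (ℚ.<⇒≤ 0<½) ½≤y-1
      y+1≤ : y + 1ℚ ≤ fromℕ 8 * z
      y+1≤ = begin
        y + 1ℚ                             ≡⟨ eq y ⟩
        z + fromℕ 4 * ½                    ≤⟨ ℚ.+-monoʳ-≤ z (*-mono-≤ (0≤fromℕ 4) ℚ.≤-refl (ℚ.<⇒≤ 0<½) ½≤y-1) ⟩
        z + fromℕ 4 * z                    ≤⟨ ≤-+ʳ (*-nonNeg (0≤fromℕ 3) 0≤z) ⟩
        z + fromℕ 4 * z + fromℕ 3 * z      ≡⟨ eq′ z ⟩
        fromℕ 8 * z                        ∎
        where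
        eq : ∀ y → y + 1ℚ ≡ (y - 1ℚ) + fromℕ 4 * ½
        eq = solve 1 (λ y → y :+ con 1ℚ := (y :- con 1ℚ) :+ con (fromℕ 4) :* con ½) refl
        eq′ : ∀ z → z + fromℕ 4 * z + fromℕ 3 * z ≡ fromℕ 8 * z
        eq′ = solve 1 (λ z → z :+ con (fromℕ 4) :* z :+ con (fromℕ 3) :* z := con (fromℕ 8) :* z) refl

    -- Bernoulli gives qʲ ≥ 1 - j t, and j t = 2j / (y + 1) is at most ½ by hypothesis.
    ½≤ratio^ : ∀ j → fromℕ (4 ℕ.* j) ≤ y + 1ℚ → ½ ≤ q ^ j
    ½≤ratio^ j 4j≤y+1 = +-cancelʳ-≤ ½ (begin
      ½ + ½                     ≡⟨⟩
      1ℚ                        ≤⟨ bernoulli j 0≤ratio (ℚ.+-mono-≤ 0≤r 0≤r) q+t≡1 ⟩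
      q ^ j + fromℕ j * t       ≤⟨ ℚ.+-monoʳ-≤ (q ^ j) jt≤½ ⟩
      q ^ j + ½                 ∎)
      where
      open ℚ.≤-Reasoning
      jt≤½ : fromℕ j * t ≤ ½
      jt≤½ = begin
        fromℕ j * t                      ≡⟨ eq (fromℕ j) r ⟩
        ½ * (fromℕ 4 * fromℕ j * r)      ≡⟨ cong (λ f → ½ * (f * r)) (fromℕ-* 4 j) ⟨
        ½ * (fromℕ (4 ℕ.* j) * r)        ≤⟨ *-mono-≤ (ℚ.<⇒≤ 0<½) ℚ.≤-refl (*-nonNeg (0≤fromℕ (4 ℕ.* j)) 0≤r)
                                              (*-mono-≤ (0≤fromℕ (4 ℕ.* j)) 4j≤y+1 0≤r ℚ.≤-refl) ⟩
        ½ * ((y + 1ℚ) * r)               ≡⟨ cong (½ *_) (recip-inverse 0<y+1) ⟩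
        ½ * 1ℚ                           ≡⟨⟩
        ½                                ∎
        where
        eq : ∀ j r → j * (r + r) ≡ ½ * (fromℕ 4 * j * r)
        eq = solve 2 (λ j r → j :* (r :+ r) := con ½ :* (con (fromℕ 4) :* j :* r)) refl

    -- Each dyadic block 2ˢ ≤ k < 2ˢ⁺¹ contributes at least 1/8.
    artanhSum-≥ : ∀ s → s ≡ 0 ⊎ fromℕ (8 ℕ.* 2 ℕ.^ s) ≤ y + 1ℚ →
      fromℕ (suc s) ≤ fromℕ 8 * artanhSum (2 ℕ.^ s) q
    artanhSum-≥ zero _ = ℚ.≤-trans 1≤8*ratio (ℚ.≤-reflexive (eq q))
      where
      eq : ∀ q → fromℕ 8 * q ≡ fromℕ 8 * (0ℚ + q * 1ℚ * 1ℚ)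
      eq = solve 1 (λ q → con (fromℕ 8) :* q := con (fromℕ 8) :* (con 0ℚ :+ q :* con 1ℚ :* con 1ℚ)) refl
    artanhSum-≥ (suc s) (inj₂ h) = begin
      fromℕ (2 ℕ.+ s)                          ≡⟨ trans (fromℕ-suc (suc s)) (ℚ.+-comm (fromℕ (suc s)) 1ℚ) ⟩
      1ℚ + fromℕ (suc s)                       ≤⟨ ℚ.+-mono-≤ (ℚ.≤-reflexive (sym block≡1)) (artanhSum-≥ s (inj₂ h′)) ⟩
      fromℕ 8 * (fromℕ m * β) + fromℕ 8 * artanhSum m q
                                               ≡⟨ ℚ.*-distribˡ-+ (fromℕ 8) (fromℕ m * β) (artanhSum m q) ⟨
      fromℕ 8 * (fromℕ m * β + artanhSum m q)  ≤⟨ *-mono-≤ (0≤fromℕ 8) ℚ.≤-refl 0≤block (artanhSum-block m term≥) ⟩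
      fromℕ 8 * artanhSum (m ℕ.+ m) q          ≡⟨ cong (λ i → fromℕ 8 * artanhSum (m ℕ.+ i) q) (ℕ.+-identityʳ m) ⟨
      fromℕ 8 * artanhSum (2 ℕ.^ suc s) q      ∎
      where
      open ℚ.≤-Reasoning
      m = 2 ℕ.^ s
      -- For k < 2m the exponent 2k + 1 is at most 4m. Then 4 (2k + 1) ≤ 16m = 8 · 2^(s + 1) ≤ y +
      -- 1, so the power is at least ½ and the term at least ½ / (4m) = β. The m terms of the block
      -- add 1/8.
      ρ β : ℚ
      ρ = recip (fromℕ (4 ℕ.* m))
      β = ½ * ρ
      0<4m : 0ℚ < fromℕ (4 ℕ.* m)
      0<4m = ℚ.<-≤-trans (fromℕ-pos 0) (fromℕ-mono (ℕ.*-mono-≤ {1} {4} (ℕ.s≤s ℕ.z≤n) (ℕ.m^n>0 2 s)))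
      0≤β : 0ℚ ≤ β
      0≤β = *-nonNeg (ℚ.<⇒≤ 0<½) (ℚ.<⇒≤ (recip-pos 0<4m))
      block≡1 : fromℕ 8 * (fromℕ m * β) ≡ 1ℚ
      block≡1 = trans (eq (fromℕ m) ρ) (trans (cong (_* ρ) (sym (fromℕ-* 4 m))) (recip-inverse 0<4m))
        where
        eq : ∀ m r → fromℕ 8 * (m * (½ * r)) ≡ fromℕ 4 * m * r
        eq = solve 2 (λ m r → con (fromℕ 8) :* (m :* (con ½ :* r)) := con (fromℕ 4) :* m :* r) refl
      h′ : fromℕ (8 ℕ.* m) ≤ y + 1ℚ
      h′ = ℚ.≤-trans (fromℕ-mono (ℕ.*-monoʳ-≤ 8 (ℕ.m≤m+n m _))) h
      0≤sum : ∀ i → 0ℚ ≤ artanhSum i q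
      0≤sum i = artanhSum-mono {m = 0} {i} 0≤ratio ℕ.z≤n
      0≤block : 0ℚ ≤ fromℕ m * β + artanhSum m q
      0≤block = ℚ.+-mono-≤ (*-nonNeg (0≤fromℕ m) 0≤β) (0≤sum m)
      j≤4m : ∀ {k} → k ℕ.< m ℕ.+ m → suc (2 ℕ.* k) ℕ.≤ 4 ℕ.* m
      j≤4m {k} k<2m = ℕ.≤-trans (ℕ.≤-trans (ℕ.n≤1+n _) (ℕ.≤-reflexive (sym (ℕ.*-suc 2 k))))
        (ℕ.≤-trans (ℕ.*-monoʳ-≤ 2 k<2m) (ℕ.≤-reflexive (trans (cong (λ i → 2 ℕ.* (m ℕ.+ i)) (sym (ℕ.+-identityʳ m))) (sym (ℕ.*-assoc 2 2 m)))))
      term≥ : ∀ {k} → k ℕ.< m ℕ.+ m → β ≤ artanhTerm k q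
      term≥ {k} k<2m = *-mono-≤ (ℚ.<⇒≤ 0<½)
        (½≤ratio^ (suc (2 ℕ.* k)) (ℚ.≤-trans (fromℕ-mono (ℕ.≤-trans (ℕ.*-monoʳ-≤ 4 (j≤4m k<2m)) (ℕ.≤-reflexive 16m≡))) h))
        (ℚ.<⇒≤ (recip-pos 0<4m))
        (recip-antimono (fromℕ-pos (2 ℕ.* k)) (fromℕ-mono (j≤4m k<2m)))
        where
        16m≡ : 4 ℕ.* (4 ℕ.* m) ≡ 8 ℕ.* (2 ℕ.* m)
        16m≡ = trans (sym (ℕ.*-assoc 4 4 m)) (ℕ.*-assoc 8 2 m)

    -- Take 2ˢ terms with s = K - 4, since 8 · 2^(K - 4) = 2^(K - 1) ≤ y. For K < 4 the truncated
    -- difference is 0, where the first term alone suffices. The shift costs K + 1 ≤ 5 (s + 1),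
    -- whence 5 · 8 = 20 · 2.
    log-≥ : ∀ K {n} → fromℕ (2 ℕ.^ K) ≤ fromℕ 2 * y → 2 ℕ.^ K ℕ.≤ n →
      fromℕ (suc K) ≤ fromℕ 20 * (fromℕ 2 * artanhSum n q)
    log-≥ K {n} 2^K≤2y 2^K≤n = begin
      fromℕ (suc K)                                    ≤⟨ fromℕ-mono 1+K≤ ⟩
      fromℕ (5 ℕ.* suc s)                              ≡⟨ fromℕ-* 5 (suc s) ⟩
      fromℕ 5 * fromℕ (suc s)                          ≤⟨ *-mono-≤ (0≤fromℕ 5) ℚ.≤-refl (0≤fromℕ (suc s)) (artanhSum-≥ s (large K 2^K≤2y)) ⟩
      fromℕ 5 * (fromℕ 8 * artanhSum (2 ℕ.^ s) q)      ≡⟨ eq (artanhSum (2 ℕ.^ s) q) ⟩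
      fromℕ 40 * artanhSum (2 ℕ.^ s) q                 ≤⟨ ℚ.*-monoˡ-≤-nonNeg (fromℕ 40) (artanhSum-mono 0≤ratio
                                                            (ℕ.≤-trans (ℕ.^-monoʳ-≤ 2 (ℕ.m∸n≤m K 4)) 2^K≤n)) ⟩
      fromℕ 40 * artanhSum n q                         ≡⟨ eq′ (artanhSum n q) ⟩
      fromℕ 20 * (fromℕ 2 * artanhSum n q)             ∎
      where
      open ℚ.≤-Reasoning
      s = K ℕ.∸ 4
      1+K≤ : suc K ℕ.≤ 5 ℕ.* suc s
      1+K≤ = ℕ.≤-trans (ℕ.s≤s (ℕ.m≤n+m∸n K 4))
        (ℕ.≤-trans (ℕ.+-monoʳ-≤ 5 (ℕ.m≤n*m s 5)) (ℕ.≤-reflexive (sym (ℕ.*-suc 5 s))))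
      large : ∀ K → fromℕ (2 ℕ.^ K) ≤ fromℕ 2 * y → K ℕ.∸ 4 ≡ 0 ⊎ fromℕ (8 ℕ.* 2 ℕ.^ (K ℕ.∸ 4)) ≤ y + 1ℚ
      large 0 _ = inj₁ refl
      large 1 _ = inj₁ refl
      large 2 _ = inj₁ refl
      large 3 _ = inj₁ refl
      large (suc (suc (suc (suc s)))) le = inj₂ (begin
        fromℕ (8 ℕ.* 2 ℕ.^ s)                    ≡⟨ half (8 ℕ.* 2 ℕ.^ s) ⟩
        ½ * fromℕ (2 ℕ.* (8 ℕ.* 2 ℕ.^ s))        ≡⟨ cong (λ i → ½ * fromℕ i) pow≡ ⟨
        ½ * fromℕ (2 ℕ.^ (4 ℕ.+ s))              ≤⟨ ℚ.*-monoˡ-≤-nonNeg ½ le ⟩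
        ½ * (fromℕ 2 * y)                        ≡⟨ eq″ y ⟩
        y                                        ≤⟨ ≤-+ʳ (ℚ.<⇒≤ 0<1) ⟩
        y + 1ℚ                                   ∎)
        where
        eq″ : ∀ y → ½ * (fromℕ 2 * y) ≡ y
        eq″ = solve 1 (λ y → con ½ :* (con (fromℕ 2) :* y) := y) refl
        half : ∀ n → fromℕ n ≡ ½ * fromℕ (2 ℕ.* n)
        half n = trans (sym (eq″ (fromℕ n))) (cong (½ *_) (sym (fromℕ-* 2 n)))
        pow≡ : 2 ℕ.^ (4 ℕ.+ s) ≡ 2 ℕ.* (8 ℕ.* 2 ℕ.^ s)
        pow≡ = trans (ℕ.^-distribˡ-+-* 2 4 s) (ℕ.*-assoc 2 8 (2 ℕ.^ s))
      eq : ∀ a → fromℕ 5 * (fromℕ 8 * a) ≡ fromℕ 40 * a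
      eq = solve 1 (λ a → con (fromℕ 5) :* (con (fromℕ 8) :* a) := con (fromℕ 40) :* a) refl
      eq′ : ∀ a → fromℕ 40 * a ≡ fromℕ 20 * (fromℕ 2 * a)
      eq′ = solve 1 (λ a → con (fromℕ 40) :* a := con (fromℕ 20) :* (con (fromℕ 2) :* a)) refl

open import Data.Nat.Base as ℕ using (ℕ; zero; suc)
import Data.Nat.Properties as ℕ
open import Data.Rational.Base as ℚ using (ℚ; 0ℚ; 1ℚ; ½)
import Data.Rational.Properties as ℚ
open import Data.Rational.Solver
open +-*-Solver using (solve; _:=_; _:+_; _:*_; _:-_; :-_; con)
open import Data.List.Base using (length)
open import Data.List.Relation.Unary.All as All using ()
open import Defs
open Rational using (fromℕ-suc; fromℕ-mono; fromℕ-pos; recip; recip-inverse; recip-pos;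
  *-mono-≤; *-nonNeg; *-pos; 0<1; 0<½; +-cancelʳ-≤; ≤-+ʳ; a≤∣a∣; -a≤∣a∣; natAbove; ≤-natAbove;
  largest; largest-holds; largest-max)
open RationalEstimates
open Counting using (Partner; mkPartnerCode; partnered-≤)

private
  ⌜_⌝ : ℕ → ℚ
  ⌜_⌝ = Rational.fromℕ

-- Floors of reals and the approximate equation a² + b² = d²

fromℕ-≤-<-fromℕ : ∀ {m n} y → fromℕ m ≤ y → y < fromℕ n → m ℕ.< n
fromℕ-≤-<-fromℕ {m} {n} y m≤y (ε , 0<ε , N , y<n)
  with M , m≤y′ ← m≤y (½ ℚ.* ε) (*-pos 0<½ 0<ε) = fromℕ-cancel-< (begin-strict
    ⌜ m ⌝                            ≤⟨ m≤y′ i (ℕ.m≤n⊔m N M) ⟩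
    seq y i ℚ.+ ½ ℚ.* ε              <⟨ ℚ.+-monoʳ-< (seq y i) ½ε<ε ⟩
    seq y i ℚ.+ ε                    ≤⟨ y<n i (ℕ.m≤m⊔n N M) ⟩
    ⌜ n ⌝                            ∎)
  where
  open ℚ.≤-Reasoning
  i = N ℕ.⊔ M
  ½ε<ε : ½ ℚ.* ε ℚ.< ε
  ½ε<ε = begin-strict
    ½ ℚ.* ε                ≡⟨ ℚ.+-identityʳ (½ ℚ.* ε) ⟨
    ½ ℚ.* ε ℚ.+ 0ℚ         <⟨ ℚ.+-monoʳ-< (½ ℚ.* ε) (*-pos 0<½ 0<ε) ⟩
    ½ ℚ.* ε ℚ.+ ½ ℚ.* ε    ≡⟨ halves ε ⟩
    ε                      ∎
    where
    halves : ∀ e → ½ ℚ.* e ℚ.+ ½ ℚ.* e ≡ e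
    halves = solve 1 (λ e → con ½ :* e :+ con ½ :* e := e) refl

⌊⌋-unique : ∀ y {m n} → ⌊ y ⌋≡ m → ⌊ y ⌋≡ n → m ≡ n
⌊⌋-unique y (m≤y , y<m+1) (n≤y , y<n+1) = ℕ.≤-antisym
  (ℕ.≤-pred (fromℕ-≤-<-fromℕ y m≤y y<n+1)) (ℕ.≤-pred (fromℕ-≤-<-fromℕ y n≤y y<m+1))

-- An error of 1 on either side: `≤` holds only up to ε, and ε = 1 keeps the constants integral. The
-- errors of two summands and of their sum add up to the 3 in `defect`.
⌊⌋-eventually : ∀ y {k} → ⌊ y ⌋≡ k → ∃[ N ] ∀ n → N ℕ.≤ n →
  ⌜ k ⌝ ℚ.≤ seq y n ℚ.+ 1ℚ × seq y n ℚ.≤ ⌜ k ⌝ ℚ.+ 1ℚ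
⌊⌋-eventually y {k} (k≤y , (ε , 0<ε , N , y<k+1)) with M , k≤y′ ← k≤y 1ℚ 0<1 =
  N ℕ.⊔ M , λ n le →
    k≤y′ n (ℕ.m⊔n≤o⇒n≤o N M le) ,
    ℚ.≤-trans (≤-+ʳ (ℚ.<⇒≤ 0<ε))
      (ℚ.≤-trans (y<k+1 n (ℕ.m⊔n≤o⇒m≤o N M le)) (ℚ.≤-reflexive (fromℕ-suc k)))

module _ (α : ℝ) (0<α : 0ℝ < α) where

  private
    δ : ℚ
    δ = proj₁ 0<α

    0<δ : 0ℚ ℚ.< δ
    0<δ = proj₁ (proj₂ 0<α)

  -- Bounds ∣a² + b² - d²∣, since α ∣a² + b² - d²∣ ≤ 3 and α ≥ δ.
  defect : ℕ
  defect = natAbove (⌜ 3 ⌝ ℚ.* recip δ)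

  value : ℕ → ℝ
  value n = α * fromℕ n ^ 2

  small-multiple : ∀ {A e} → δ ℚ.≤ A → A ℚ.* ⌜ e ⌝ ℚ.≤ ⌜ 3 ⌝ → e ℕ.≤ defect
  small-multiple {A} {e} δ≤A Ae≤3 = fromℕ-cancel-≤ (begin
    ⌜ e ⌝                                ≡⟨ ℚ.*-identityˡ ⌜ e ⌝ ⟨
    1ℚ ℚ.* ⌜ e ⌝                         ≡⟨ cong (ℚ._* ⌜ e ⌝) (recip-inverse 0<δ) ⟨
    δ ℚ.* recip δ ℚ.* ⌜ e ⌝              ≡⟨ swap δ (recip δ) ⌜ e ⌝ ⟩
    δ ℚ.* ⌜ e ⌝ ℚ.* recip δ              ≤⟨ *-mono-≤ (*-nonNeg (ℚ.<⇒≤ 0<δ) (0≤fromℕ e))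
                                              (ℚ.≤-trans (*-mono-≤ (ℚ.<⇒≤ 0<δ) δ≤A (0≤fromℕ e) ℚ.≤-refl) Ae≤3)
                                              (ℚ.<⇒≤ (recip-pos 0<δ)) ℚ.≤-refl ⟩
    ⌜ 3 ⌝ ℚ.* recip δ                    ≤⟨ ≤-natAbove _ ⟩
    ⌜ defect ⌝                           ∎)
    where
    open ℚ.≤-Reasoning
    swap : ∀ a b c → a ℚ.* b ℚ.* c ≡ a ℚ.* c ℚ.* b
    swap = solve 3 (λ a b c → a :* b :* c := a :* c :* b) refl

  private
    cancel-squares : ∀ A {B C} p q e → p ≡ q ℕ.+ e → A ℚ.* ⌜ p ⌝ ℚ.≤ C → B ℚ.≤ A ℚ.* ⌜ q ⌝ →
      C ℚ.≤ B ℚ.+ ⌜ 3 ⌝ → A ℚ.* ⌜ e ⌝ ℚ.≤ ⌜ 3 ⌝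
    cancel-squares A {B} {C} _ q e refl Ap≤C B≤Aq C≤B+3 =
      +-cancelʳ-≤ (A ℚ.* ⌜ q ⌝) (begin
        A ℚ.* ⌜ e ⌝ ℚ.+ A ℚ.* ⌜ q ⌝      ≡⟨ trans (ℚ.+-comm (A ℚ.* ⌜ e ⌝) _) (sym (ℚ.*-distribˡ-+ A ⌜ q ⌝ ⌜ e ⌝)) ⟩
        A ℚ.* (⌜ q ⌝ ℚ.+ ⌜ e ⌝)          ≡⟨ cong (A ℚ.*_) (fromℕ-+ q e) ⟨
        A ℚ.* ⌜ q ℕ.+ e ⌝                ≤⟨ Ap≤C ⟩
        C                                ≤⟨ C≤B+3 ⟩
        B ℚ.+ ⌜ 3 ⌝                      ≤⟨ ℚ.+-monoˡ-≤ ⌜ 3 ⌝ B≤Aq ⟩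
        A ℚ.* ⌜ q ⌝ ℚ.+ ⌜ 3 ⌝            ≡⟨ ℚ.+-comm (A ℚ.* ⌜ q ⌝) ⌜ 3 ⌝ ⟩
        ⌜ 3 ⌝ ℚ.+ A ℚ.* ⌜ q ⌝            ∎)
      where open ℚ.≤-Reasoning

    square : ∀ n i → seq (value n) i ≡ seq α i ℚ.* ⌜ n ℕ.* n ⌝
    square n i = cong (seq α i ℚ.*_) (trans (cong (⌜ n ⌝ ℚ.*_) (ℚ.*-identityʳ ⌜ n ⌝)) (sym (fromℕ-* n n)))

  -- All three floors are compared at one index, late enough that the approximant of α is at least
  -- δ. The signed difference a² + b² - d² is shifted by `defect` so that i is a natural number.
  near-pythagorean : ∀ {a b d k ℓ} →
    ⌊ value a ⌋≡ k → ⌊ value b ⌋≡ ℓ → ⌊ value d ⌋≡ (k ℕ.+ ℓ) →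
    ∃[ i ] (i ℕ.≤ defect ℕ.+ defect × a ℕ.* a ℕ.+ b ℕ.* b ℕ.+ defect ≡ d ℕ.* d ℕ.+ i)
  near-pythagorean {a} {b} {d} {k} {ℓ} fa fb fd
    with Na , ha ← ⌊⌋-eventually (value a) fa
    with Nb , hb ← ⌊⌋-eventually (value b) fb
    with Nd , hd ← ⌊⌋-eventually (value d) fd
    = go (ℕ.≤-total (d ℕ.* d) (a ℕ.* a ℕ.+ b ℕ.* b))
    where
    open ℚ.≤-Reasoning
    Nα = proj₁ (proj₂ (proj₂ 0<α))
    n = (Na ℕ.⊔ Nb) ℕ.⊔ (Nd ℕ.⊔ Nα)
    A = seq α n
    δ≤A : δ ℚ.≤ A
    δ≤A = ℚ.≤-trans (ℚ.≤-reflexive (sym (ℚ.+-identityˡ δ)))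
      (proj₂ (proj₂ (proj₂ 0<α)) n (ℕ.≤-trans (ℕ.m≤n⊔m Nd Nα) (ℕ.m≤n⊔m (Na ℕ.⊔ Nb) _)))
    va = ha n (ℕ.≤-trans (ℕ.m≤m⊔n Na Nb) (ℕ.m≤m⊔n (Na ℕ.⊔ Nb) (Nd ℕ.⊔ Nα)))
    vb = hb n (ℕ.≤-trans (ℕ.m≤n⊔m Na Nb) (ℕ.m≤m⊔n (Na ℕ.⊔ Nb) (Nd ℕ.⊔ Nα)))
    vd = hd n (ℕ.≤-trans (ℕ.m≤m⊔n Nd Nα) (ℕ.m≤n⊔m (Na ℕ.⊔ Nb) (Nd ℕ.⊔ Nα)))
    sum-squares : seq (value a) n ℚ.+ seq (value b) n ≡ A ℚ.* ⌜ a ℕ.* a ℕ.+ b ℕ.* b ⌝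
    sum-squares = trans (cong₂ ℚ._+_ (square a n) (square b n))
      (trans (sym (ℚ.*-distribˡ-+ A _ _)) (cong (A ℚ.*_) (sym (fromℕ-+ (a ℕ.* a) (b ℕ.* b)))))
    upper : A ℚ.* ⌜ a ℕ.* a ℕ.+ b ℕ.* b ⌝ ℚ.≤ ⌜ k ℕ.+ ℓ ⌝ ℚ.+ (1ℚ ℚ.+ 1ℚ)
    upper = begin
      A ℚ.* ⌜ a ℕ.* a ℕ.+ b ℕ.* b ⌝              ≡⟨ sum-squares ⟨
      seq (value a) n ℚ.+ seq (value b) n        ≤⟨ ℚ.+-mono-≤ (proj₂ va) (proj₂ vb) ⟩
      ⌜ k ⌝ ℚ.+ 1ℚ ℚ.+ (⌜ ℓ ⌝ ℚ.+ 1ℚ)            ≡⟨ swap ⌜ k ⌝ ⌜ ℓ ⌝ 1ℚ ⟩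
      ⌜ k ⌝ ℚ.+ ⌜ ℓ ⌝ ℚ.+ (1ℚ ℚ.+ 1ℚ)            ≡⟨ cong (ℚ._+ (1ℚ ℚ.+ 1ℚ)) (fromℕ-+ k ℓ) ⟨
      ⌜ k ℕ.+ ℓ ⌝ ℚ.+ (1ℚ ℚ.+ 1ℚ)                ∎
      where
      swap : ∀ a b c → a ℚ.+ c ℚ.+ (b ℚ.+ c) ≡ a ℚ.+ b ℚ.+ (c ℚ.+ c)
      swap = solve 3 (λ a b c → a :+ c :+ (b :+ c) := a :+ b :+ (c :+ c)) refl
    lower : ⌜ k ℕ.+ ℓ ⌝ ℚ.- (1ℚ ℚ.+ 1ℚ) ℚ.≤ A ℚ.* ⌜ a ℕ.* a ℕ.+ b ℕ.* b ⌝
    lower = +-cancelʳ-≤ (1ℚ ℚ.+ 1ℚ) (begin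
      ⌜ k ℕ.+ ℓ ⌝ ℚ.- (1ℚ ℚ.+ 1ℚ) ℚ.+ (1ℚ ℚ.+ 1ℚ)                      ≡⟨ cancel ⌜ k ℕ.+ ℓ ⌝ (1ℚ ℚ.+ 1ℚ) ⟩
      ⌜ k ℕ.+ ℓ ⌝                                                      ≡⟨ fromℕ-+ k ℓ ⟩
      ⌜ k ⌝ ℚ.+ ⌜ ℓ ⌝                                                  ≤⟨ ℚ.+-mono-≤ (proj₁ va) (proj₁ vb) ⟩
      seq (value a) n ℚ.+ 1ℚ ℚ.+ (seq (value b) n ℚ.+ 1ℚ)              ≡⟨ swap (seq (value a) n) (seq (value b) n) 1ℚ ⟩
      seq (value a) n ℚ.+ seq (value b) n ℚ.+ (1ℚ ℚ.+ 1ℚ)              ≡⟨ cong (ℚ._+ (1ℚ ℚ.+ 1ℚ)) sum-squares ⟩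
      A ℚ.* ⌜ a ℕ.* a ℕ.+ b ℕ.* b ⌝ ℚ.+ (1ℚ ℚ.+ 1ℚ)                    ∎)
      where
      cancel : ∀ a b → a ℚ.- b ℚ.+ b ≡ a
      cancel = solve 2 (λ a b → a :- b :+ b := a) refl
      swap : ∀ a b c → a ℚ.+ c ℚ.+ (b ℚ.+ c) ≡ a ℚ.+ b ℚ.+ (c ℚ.+ c)
      swap = solve 3 (λ a b c → a :+ c :+ (b :+ c) := a :+ b :+ (c :+ c)) refl
    upper-d : A ℚ.* ⌜ d ℕ.* d ⌝ ℚ.≤ ⌜ k ℕ.+ ℓ ⌝ ℚ.+ 1ℚ
    upper-d = ℚ.≤-trans (ℚ.≤-reflexive (sym (square d n))) (proj₂ vd)
    lower-d : ⌜ k ℕ.+ ℓ ⌝ ℚ.- 1ℚ ℚ.≤ A ℚ.* ⌜ d ℕ.* d ⌝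
    lower-d = +-cancelʳ-≤ 1ℚ (begin
      ⌜ k ℕ.+ ℓ ⌝ ℚ.- 1ℚ ℚ.+ 1ℚ            ≡⟨ cancel ⌜ k ℕ.+ ℓ ⌝ ⟩
      ⌜ k ℕ.+ ℓ ⌝                          ≤⟨ proj₁ vd ⟩
      seq (value d) n ℚ.+ 1ℚ               ≡⟨ cong (ℚ._+ 1ℚ) (square d n) ⟩
      A ℚ.* ⌜ d ℕ.* d ⌝ ℚ.+ 1ℚ             ∎)
      where
      cancel : ∀ a → a ℚ.- 1ℚ ℚ.+ 1ℚ ≡ a
      cancel = solve 1 (λ a → a :- con 1ℚ :+ con 1ℚ := a) refl
    go : d ℕ.* d ℕ.≤ a ℕ.* a ℕ.+ b ℕ.* b ⊎ a ℕ.* a ℕ.+ b ℕ.* b ℕ.≤ d ℕ.* d →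
      ∃[ i ] (i ℕ.≤ defect ℕ.+ defect × a ℕ.* a ℕ.+ b ℕ.* b ℕ.+ defect ≡ d ℕ.* d ℕ.+ i)
    go (inj₁ le) with e , eq ← ℕ.m≤n⇒∃[o]m+o≡n le =
      e ℕ.+ defect , ℕ.+-monoˡ-≤ defect (small-multiple δ≤A
        (cancel-squares A _ (d ℕ.* d) e (sym eq) upper lower-d (ℚ.≤-reflexive (gap ⌜ k ℕ.+ ℓ ⌝)))) ,
      trans (cong (ℕ._+ defect) (sym eq)) (ℕ.+-assoc (d ℕ.* d) e defect)
      where
      gap : ∀ s → s ℚ.+ (1ℚ ℚ.+ 1ℚ) ≡ s ℚ.- 1ℚ ℚ.+ ⌜ 3 ⌝
      gap = solve 1 (λ s → s :+ (con 1ℚ :+ con 1ℚ) := s :- con 1ℚ :+ con ⌜ 3 ⌝) refl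
    go (inj₂ le) with e , eq ← ℕ.m≤n⇒∃[o]m+o≡n le =
      defect ℕ.∸ e , ℕ.≤-trans (ℕ.m∸n≤m defect e) (ℕ.m≤m+n defect defect) ,
      trans (cong (a ℕ.* a ℕ.+ b ℕ.* b ℕ.+_) (sym (ℕ.m+[n∸m]≡n e≤defect)))
        (trans (sym (ℕ.+-assoc _ e (defect ℕ.∸ e))) (cong (ℕ._+ (defect ℕ.∸ e)) eq))
      where
      gap : ∀ s → s ℚ.+ 1ℚ ≡ s ℚ.- (1ℚ ℚ.+ 1ℚ) ℚ.+ ⌜ 3 ⌝
      gap = solve 1 (λ s → s :+ con 1ℚ := s :- (con 1ℚ :+ con 1ℚ) :+ con ⌜ 3 ⌝) refl
      e≤defect : e ℕ.≤ defect
      e≤defect = small-multiple δ≤A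
        (cancel-squares A _ (a ℕ.* a ℕ.+ b ℕ.* b) e (sym eq) upper-d lower (ℚ.≤-reflexive (gap ⌜ k ℕ.+ ℓ ⌝)))

  partner : ∀ {a b k ℓ} → 0 ℕ.< k →
    ⌊ value a ⌋≡ k → ⌊ value b ⌋≡ ℓ → S α 0<α (k ℕ.+ ℓ) → Partner defect a b
  partner {a} {b} {k} {ℓ} 0<k fa fb (d , _ , _ , fd)
    with i , i≤ , eq ← near-pythagorean {a} {b} {d} fa fb fd =
    (i , d ℕ.+ b) , mkPartnerCode d i≤ d≢b refl eq
    where
    d≢b : d ≢ b
    d≢b refl = ℕ.<⇒≢ (ℕ.+-monoˡ-< ℓ 0<k) (⌊⌋-unique (value b) fb fd)

-- From a real x to an integer bound and its binary length

binary-length : ∀ n → 0 ℕ.< n → ∃[ K ] (2 ℕ.^ K ℕ.≤ n × n ℕ.< 2 ℕ.^ suc K)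
binary-length (suc zero)    _ = 0 , ℕ.s≤s ℕ.z≤n , ℕ.s≤s (ℕ.s≤s ℕ.z≤n)
binary-length (suc (suc n)) _ with K , lower , upper ← binary-length (suc n) (ℕ.s≤s ℕ.z≤n)
  with suc (suc n) ℕ.<? 2 ℕ.^ suc K
... | yes n< = K , ℕ.m≤n⇒m≤1+n lower , n<
... | no  n≮ = suc K , ℕ.≮⇒≥ n≮ ,
  ℕ.≤-<-trans upper (ℕ.^-monoʳ-< 2 (ℕ.s≤s (ℕ.s≤s ℕ.z≤n)) (ℕ.n<1+n (suc K)))

module _ (x : ℝ) (2≤x : fromℕ 2 ≤ x) where

  private
    n₀ n₁ : ℕ
    n₀ = proj₁ (cauchy x ½ 0<½)
    n₁ = proj₁ (2≤x ½ 0<½)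

    r : ℚ
    r = seq x n₀

    below? : ∀ j → Dec (⌜ j ⌝ ℚ.≤ r ℚ.+ 1ℚ)
    below? j = ⌜ j ⌝ ℚ.≤? r ℚ.+ 1ℚ

    N : ℕ
    N = largest below? (natAbove (r ℚ.+ 1ℚ))

    close : ∀ n → n₀ ℕ.≤ n → ℚ.∣ seq x n ℚ.- r ∣ ℚ.≤ ½
    close n n₀≤n = ℚ.<⇒≤ (proj₂ (cauchy x ½ 0<½) n n₀ n₀≤n ℕ.≤-refl)

    seq≤r+½ : ∀ n → n₀ ℕ.≤ n → seq x n ℚ.≤ r ℚ.+ ½
    seq≤r+½ n n₀≤n = begin
      seq x n                        ≡⟨ eq (seq x n) r ⟩
      r ℚ.+ (seq x n ℚ.- r)          ≤⟨ ℚ.+-monoʳ-≤ r (ℚ.≤-trans (a≤∣a∣ _) (close n n₀≤n)) ⟩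
      r ℚ.+ ½                        ∎
      where
      open ℚ.≤-Reasoning
      eq : ∀ a r → a ≡ r ℚ.+ (a ℚ.- r)
      eq = solve 2 (λ a r → a := r :+ (a :- r)) refl

    r≤seq+½ : ∀ n → n₀ ℕ.≤ n → r ℚ.≤ seq x n ℚ.+ ½
    r≤seq+½ n n₀≤n = begin
      r                                  ≡⟨ eq (seq x n) r ⟩
      seq x n ℚ.+ ℚ.- (seq x n ℚ.- r)    ≤⟨ ℚ.+-monoʳ-≤ (seq x n) (ℚ.≤-trans (-a≤∣a∣ (seq x n ℚ.- r)) (close n n₀≤n)) ⟩
      seq x n ℚ.+ ½                      ∎
      where
      open ℚ.≤-Reasoning
      eq : ∀ a r → r ≡ a ℚ.+ ℚ.- (a ℚ.- r)
      eq = solve 2 (λ a r → r := a :+ :- (a :- r)) refl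

    below⇒≤N : ∀ {a} → ⌜ a ⌝ ℚ.≤ r ℚ.+ 1ℚ → a ℕ.≤ N
    below⇒≤N {a} a≤r+1 = ℕ.≮⇒≥ λ N<a →
      largest-max below? (natAbove (r ℚ.+ 1ℚ)) above (ℚ.≤-trans (fromℕ-mono N<a) a≤r+1)
      where
      above : ¬ (⌜ suc (natAbove (r ℚ.+ 1ℚ)) ⌝ ℚ.≤ r ℚ.+ 1ℚ)
      above le = ℕ.<-irrefl refl (fromℕ-cancel-≤ (ℚ.≤-trans le (≤-natAbove (r ℚ.+ 1ℚ))))

    3/2≤seq : ∀ n → n₁ ℕ.≤ n → 1ℚ ℚ.+ ½ ℚ.≤ seq x n
    3/2≤seq n n₁≤n = +-cancelʳ-≤ ½ (proj₂ (2≤x ½ 0<½) n n₁≤n)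

    0<r+1 : 1ℚ ℚ.≤ r ℚ.+ 1ℚ
    0<r+1 = begin
      1ℚ                      ≤⟨ ≤-+ʳ (ℚ.<⇒≤ 0<1) ⟩
      1ℚ ℚ.+ 1ℚ               ≡⟨⟩
      1ℚ ℚ.+ ½ ℚ.+ ½          ≤⟨ ℚ.+-monoˡ-≤ ½ (3/2≤seq i (ℕ.m≤n⊔m n₀ n₁)) ⟩
      seq x i ℚ.+ ½           ≤⟨ ℚ.+-monoˡ-≤ ½ (seq≤r+½ i (ℕ.m≤m⊔n n₀ n₁)) ⟩
      r ℚ.+ ½ ℚ.+ ½           ≡⟨ ℚ.+-assoc r ½ ½ ⟩
      r ℚ.+ 1ℚ                ∎
      where
      open ℚ.≤-Reasoning
      i = n₀ ℕ.⊔ n₁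

    N≤r+1 : ⌜ N ⌝ ℚ.≤ r ℚ.+ 1ℚ
    N≤r+1 with largest-holds below? (natAbove (r ℚ.+ 1ℚ))
    ... | inj₁ N≡0 = ℚ.≤-trans (ℚ.≤-reflexive (cong ⌜_⌝ N≡0)) (ℚ.≤-trans (ℚ.<⇒≤ 0<1) 0<r+1)
    ... | inj₂ le  = le

  -- The floor of x is not computable, so N is the largest integer up to r + 1, where the
  -- approximant r is within ½ of all later ones. Any integer a ≤ x is at most r + 1. Conversely N ≤
  -- r + 1 ≤ xₙ + 3/2 ≤ 2 xₙ, as xₙ ≥ 3/2.
  integer-bound : ∃[ N ] (0 ℕ.< N × (∀ a → fromℕ a ≤ x → a ℕ.≤ N) ×
    ∃[ M ] ∀ n → M ℕ.≤ n → 1ℚ ℚ.+ ½ ℚ.≤ seq x n × ⌜ N ⌝ ℚ.≤ ⌜ 2 ⌝ ℚ.* seq x n)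
  integer-bound = N , below⇒≤N 0<r+1 , ≤x⇒≤N , n₀ ℕ.⊔ n₁ , λ n le →
    3/2≤seq n (ℕ.m⊔n≤o⇒n≤o n₀ n₁ le) , (begin
    ⌜ N ⌝                             ≤⟨ N≤r+1 ⟩
    r ℚ.+ 1ℚ                          ≤⟨ ℚ.+-monoˡ-≤ 1ℚ (r≤seq+½ n (ℕ.m⊔n≤o⇒m≤o n₀ n₁ le)) ⟩
    seq x n ℚ.+ ½ ℚ.+ 1ℚ              ≡⟨ ℚ.+-assoc (seq x n) ½ 1ℚ ⟩
    seq x n ℚ.+ (1ℚ ℚ.+ ½)            ≤⟨ ℚ.+-monoʳ-≤ (seq x n) (3/2≤seq n (ℕ.m⊔n≤o⇒n≤o n₀ n₁ le)) ⟩
    seq x n ℚ.+ seq x n               ≡⟨ double (seq x n) ⟩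
    ⌜ 2 ⌝ ℚ.* seq x n                 ∎)
    where
    open ℚ.≤-Reasoning
    double : ∀ a → a ℚ.+ a ≡ ⌜ 2 ⌝ ℚ.* a
    double = solve 1 (λ a → a :+ a := con ⌜ 2 ⌝ :* a) refl
    ≤x⇒≤N : ∀ a → fromℕ a ≤ x → a ℕ.≤ N
    ≤x⇒≤N a a≤x with M , h ← a≤x ½ 0<½ = below⇒≤N (begin
      ⌜ a ⌝                     ≤⟨ h i (ℕ.m≤n⊔m n₀ M) ⟩
      seq x i ℚ.+ ½             ≤⟨ ℚ.+-monoˡ-≤ ½ (seq≤r+½ i (ℕ.m≤m⊔n n₀ M)) ⟩
      r ℚ.+ ½ ℚ.+ ½             ≡⟨ ℚ.+-assoc r ½ ½ ⟩
      r ℚ.+ 1ℚ                  ∎)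
      where i = n₀ ℕ.⊔ M

seq-^ : ∀ y k n → seq (y ^ k) n ≡ seq y n Rational.^ k
seq-^ y zero    n = refl
seq-^ y (suc k) n = cong (seq y n ℚ.*_) (seq-^ y k n)

seq-scaled : ∀ c x y k n → seq (fromℚ c * x * y ^ k) n ≡ c ℚ.* seq x n ℚ.* seq y n Rational.^ k
seq-scaled c x y k n = cong (c ℚ.* seq x n ℚ.*_) (seq-^ y k n)

-- Abstract, lest the numeral 20 ^ 15 be evaluated.
abstract
  scaled-bound : ∀ C e → ∃[ c ] (0ℚ ℚ.< c × ∀ N K {y l} → 0ℚ ℚ.≤ l →
    ⌜ N ⌝ ℚ.≤ ⌜ 2 ⌝ ℚ.* y → ⌜ K ⌝ ℚ.≤ ⌜ 20 ⌝ ℚ.* l →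
    ⌜ C ℕ.* (N ℕ.* K ℕ.^ e) ⌝ ℚ.≤ c ℚ.* y ℚ.* l Rational.^ e)
  scaled-bound C e = c , 0<c , λ N K {y} {l} 0≤l N≤2y K≤20l → begin
    ⌜ C ℕ.* (N ℕ.* K ℕ.^ e) ⌝
      ≤⟨ fromℕ-mono (ℕ.*-monoˡ-≤ (N ℕ.* K ℕ.^ e) (ℕ.n≤1+n C)) ⟩
    ⌜ suc C ℕ.* (N ℕ.* K ℕ.^ e) ⌝
      ≡⟨ trans (fromℕ-* (suc C) _) (cong (⌜ suc C ⌝ ℚ.*_) (trans (fromℕ-* N _) (cong (⌜ N ⌝ ℚ.*_) (fromℕ-^ K e)))) ⟩
    ⌜ suc C ⌝ ℚ.* (⌜ N ⌝ ℚ.* ⌜ K ⌝ Rational.^ e)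
      ≤⟨ *-mono-≤ (0≤fromℕ (suc C)) ℚ.≤-refl (*-nonNeg (0≤fromℕ N) (^-nonNeg e (0≤fromℕ K)))
           (*-mono-≤ (0≤fromℕ N) N≤2y (^-nonNeg e (0≤fromℕ K)) (^-mono-≤ e (0≤fromℕ K) K≤20l)) ⟩
    ⌜ suc C ⌝ ℚ.* (⌜ 2 ⌝ ℚ.* y ℚ.* (⌜ 20 ⌝ ℚ.* l) Rational.^ e)
      ≡⟨ cong (λ p → ⌜ suc C ⌝ ℚ.* (⌜ 2 ⌝ ℚ.* y ℚ.* p)) (^-distribʳ-* ⌜ 20 ⌝ l e) ⟩
    ⌜ suc C ⌝ ℚ.* (⌜ 2 ⌝ ℚ.* y ℚ.* (⌜ 20 ⌝ Rational.^ e ℚ.* l Rational.^ e))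
      ≡⟨ rearrange ⌜ suc C ⌝ ⌜ 2 ⌝ y (⌜ 20 ⌝ Rational.^ e) (l Rational.^ e) ⟩
    c ℚ.* y ℚ.* l Rational.^ e ∎
    where
    open ℚ.≤-Reasoning
    c : ℚ
    -- C + 1 in place of C keeps c positive even if C = 0.
    c = ⌜ suc C ⌝ ℚ.* (⌜ 2 ⌝ ℚ.* ⌜ 20 ⌝ Rational.^ e)
    0<c : 0ℚ ℚ.< c
    0<c = *-pos (fromℕ-pos C) (*-pos (fromℕ-pos 1) (^-pos e (fromℕ-pos 19)))
    rearrange : ∀ c a y p q → c ℚ.* (a ℚ.* y ℚ.* (p ℚ.* q)) ≡ c ℚ.* (a ℚ.* p) ℚ.* y ℚ.* q
    rearrange = solve 5 (λ c a y p q → c :* (a :* y :* (p :* q)) := c :* (a :* p) :* y :* q) refl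

seq-log : ∀ x 0<x n → seq (log x 0<x) n ≡ ⌜ 2 ⌝ ℚ.* Rational.artanhSum n (Rational.ratio (seq x n))
seq-log x 0<x n = refl

log-bound : ∀ x (2≤x : fromℕ 2 ≤ x) → ∃[ N ] ∃[ K ] (0 ℕ.< N × N ℕ.< 2 ℕ.^ K ×
  (∀ a → fromℕ a ≤ x → a ℕ.≤ N) ×
  ∃[ M ] ∀ n → M ℕ.≤ n →
    0ℚ ℚ.≤ seq (log x (2≤⇒0< x 2≤x)) n × ⌜ N ⌝ ℚ.≤ ⌜ 2 ⌝ ℚ.* seq x n ×
    ⌜ K ⌝ ℚ.≤ ⌜ 20 ⌝ ℚ.* seq (log x (2≤⇒0< x 2≤x)) n)
log-bound x 2≤x =
  let N , 0<N , ≤x⇒≤N , M , eventually = integer-bound x 2≤x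
      K , 2^K≤N , N<2^1+K = binary-length N 0<N
  in
  -- The n-th approximant of the logarithm has only n terms of the series, so n must also reach 2ᴷ
  -- before `log-≥` applies.
  N , suc K , 0<N , N<2^1+K , ≤x⇒≤N , M ℕ.⊔ 2 ℕ.^ K , λ n le →
  let 3/2≤xₙ , N≤2xₙ = eventually n (ℕ.m⊔n≤o⇒m≤o M (2 ℕ.^ K) le)
      log≡ = sym (seq-log x (2≤⇒0< x 2≤x) n)
  in subst (0ℚ ℚ.≤_) log≡ (*-nonNeg (0≤fromℕ 2) (artanhSum-mono {m = 0} {n} (0≤ratio 3/2≤xₙ) ℕ.z≤n)) ,
     N≤2xₙ ,
     subst (λ l → ⌜ suc K ⌝ ℚ.≤ ⌜ 20 ⌝ ℚ.* l) log≡
       (log-≥ 3/2≤xₙ K (ℚ.≤-trans (fromℕ-mono 2^K≤N) N≤2xₙ) (ℕ.m⊔n≤o⇒n≤o M (2 ℕ.^ K) le))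

theorem1p5 : (α : ℝ) (0<α : 0ℝ < α) →
    ∃[ C ] (0ℝ < C ×
    ((x : ℝ) (2≤x : fromℕ 2 ≤ x) →
    Card≤ (T≤ α 0<α x) (C * x * log x (2≤⇒0< x 2≤x) ^ 15)))
theorem1p5 α 0<α = fromℚ c , (c , 0<c , 0 , λ _ _ → ℚ.≤-reflexive (ℚ.+-identityˡ c)) , bound
  where
  H = defect α 0<α
  C′ = proj₁ (partnered-≤ {ℕ × ℕ × ℕ} H)
  c = proj₁ (scaled-bound C′ 15)
  0<c = proj₁ (proj₂ (scaled-bound C′ 15))
  Floors : ℕ × ℕ × ℕ → ℕ × ℕ × ℕ → Set
  Floors (k , ℓ , m) (a , b , e) =
    ⌊ value α 0<α a ⌋≡ k × ⌊ value α 0<α b ⌋≡ ℓ × ⌊ value α 0<α e ⌋≡ m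
  floors-injective : ∀ {x y t} → Floors x t → Floors y t → x ≡ y
  floors-injective {t = a , b , e} (fa , fb , fe) (fa′ , fb′ , fe′) =
    cong₂ _,_ (⌊⌋-unique (value α 0<α a) fa fa′)
      (cong₂ _,_ (⌊⌋-unique (value α 0<α b) fb fb′) (⌊⌋-unique (value α 0<α e) fe fe′))
  bound : (x : ℝ) (2≤x : fromℕ 2 ≤ x) →
    Card≤ (T≤ α 0<α x) (fromℚ c * x * log x (2≤⇒0< x 2≤x) ^ 15)
  bound x 2≤x xs xs-unique xs⊆T ε 0<ε =
    let N , K , 0<N , N<2^K , ≤x⇒≤N , M , eventually = log-bound x 2≤x
    in M , λ n M≤n →
    let 0≤lₙ , N≤2xₙ , K≤20lₙ = eventually n M≤n
    in begin
    ⌜ length xs ⌝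
      ≤⟨ fromℕ-mono (proj₂ (partnered-≤ H) N K 0<N N<2^K Floors
           (λ {s} {t} {abe} → floors-injective {s} {t} {abe}) xs xs-unique
           (All.map (λ {t} → partners ≤x⇒≤N {t}) xs⊆T)) ⟩
    ⌜ C′ ℕ.* (N ℕ.* K ℕ.^ 15) ⌝
      ≤⟨ proj₂ (proj₂ (scaled-bound C′ 15)) N K 0≤lₙ N≤2xₙ K≤20lₙ ⟩
    c ℚ.* seq x n ℚ.* seq (log x (2≤⇒0< x 2≤x)) n Rational.^ 15
      ≡⟨ seq-scaled c x (log x (2≤⇒0< x 2≤x)) 15 n ⟨
    seq (fromℚ c * x * log x (2≤⇒0< x 2≤x) ^ 15) n
      ≤⟨ ≤-+ʳ (ℚ.<⇒≤ 0<ε) ⟩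
    seq (fromℚ c * x * log x (2≤⇒0< x 2≤x) ^ 15) n ℚ.+ ε ∎
    where
    open ℚ.≤-Reasoning
    partners : ∀ {N} → (∀ a → fromℕ a ≤ x → a ℕ.≤ N) → ∀ {t} → T≤ α 0<α x t →
      ∃[ a ] ∃[ b ] ∃[ e ] (Floors t (a , b , e) × 0 ℕ.< a × a ℕ.≤ N × Partner H a b × Partner H a e)
    partners ≤x⇒≤N {k , ℓ , m}
      ((0<k , _ , _ , _ , _ , _ , Sk+ℓ , _ , Sm+k , _) ,
       (a , 0<a , _ , a≤x , fa) , (b , _ , _ , _ , fb) , (e , _ , _ , _ , fe)) =
      a , b , e , (fa , fb , fe) , 0<a , ≤x⇒≤N a a≤x ,
      partner α 0<α {a} {b} 0<k fa fb Sk+ℓ ,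
      partner α 0<α {a} {e} 0<k fa fe (subst (S α 0<α) (ℕ.+-comm m k) Sm+k)
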